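{- Let $n$ be a positive integer and let $a(n)$ be the number of triangular numbers between $1$ and $n$ (equivalently, $a(n)$ is the largest integer $m$ such that $\frac{m(m+1)}{2}\le n$). For all $v,w \in (\mathbb Z/2\mathbb Z)^n$, the integer $$\sum_{\lambda \vdash n} C_2(v, \lambda)\, C_2(w, \lambda)$$ is divisible by $2^{n-a(n)}$, where the sum runs over all partitions $\lambda$ of $n$.
   Context: Partitions are identified with their Young diagrams (row $i$ from the top has $\lambda_i$ cells, left-aligned). The $2$-residue of the cell $(i,j)$ (row $i$, column $j$) is $i-j \bmod 2 \in \mathbb Z/2\mathbb Z$. For a standard Young tableau $T$ with $n$ cells, its $2$-residue sequence is $(i_1,\dots,i_n)\in(\mathbb Z/2\mathbb Z)^n$, where $i_k$ is the $2$-residue of the cell containing the entry $k$. For $v\in(\mathbb Z/2\mathbb Z)^n$ and $\lambda\vdash n$, $C_2(v,\lambda)$ denotes the number of standard Young tableaux of shape $\lambda$ whose $2$-residue sequence is $v$. (For $v=(0,1,0,1,\dots)$, $C_2(v,\lambda)$ is the number of chess tableaux of shape $\lambda$.) -}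

module Defs where

open import Data.Nat using (ℕ; zero; suc; _+_; _*_; _≤_; _<_; _≤?_; _<?_)
open import Data.Nat.Properties using () renaming (_≟_ to _≟ℕ_)
open import Data.Nat.DivMod using (_/_; _mod_)
open import Data.Fin using (Fin; toℕ) renaming (_≟_ to _≟F_)
open import Data.Fin.Properties using (all?; any?)
open import Data.List using (List; []; _∷_; length; filter; map; concatMap; upTo; allFin)
open import Data.Nat.ListAction using (sum)
open import Data.Vec using (Vec; lookup) renaming ([] to []ᵥ; _∷_ to _∷ᵥ_)
open import Data.Product using (_×_; _,_; proj₁; proj₂; ∃)
open import Data.Product.Properties using (≡-dec)
open import Relation.Binary.PropositionalEquality using (_≡_)
open import Relation.Nullary using (Dec; yes; no; ¬_)
open import Relation.Nullary.Decidable using (_×-dec_; _→-dec_)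
open import Relation.Unary using (Decidable)

-- Young diagrams.  A partition is a list of parts (λ₁, λ₂, …).
-- Cells are (row , column), 0-indexed (shifting both indices by one does
-- not change the residue i - j mod 2).

rowLen : List ℕ → ℕ → ℕ
rowLen []       _       = 0
rowLen (x ∷ xs) zero    = x
rowLen (x ∷ xs) (suc i) = rowLen xs i

Cell : Set
Cell = ℕ × ℕ

InShape : List ℕ → Cell → Set
InShape sh (i , j) = j < rowLen sh i

data Decreasing : List ℕ → Set where
  dec-nil  : Decreasing []
  dec-one  : ∀ x → Decreasing (x ∷ [])
  dec-cons : ∀ {x y ys} → y ≤ x → Decreasing (y ∷ ys) → Decreasing (x ∷ y ∷ ys)

data AllPositive : List ℕ → Set where
  pos-nil  : AllPositive []
  pos-cons : ∀ {x xs} → 0 < x → AllPositive xs → AllPositive (x ∷ xs)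

IsPartition : ℕ → List ℕ → Set
IsPartition n sh = (sum sh ≡ n) × Decreasing sh × AllPositive sh

-- 2-residues.  ℤ/2ℤ is Fin 2.  For cell (i , j) the residue i - j mod 2
-- equals (i + j) mod 2.

residue : Cell → Fin 2
residue (i , j) = (i + j) mod 2

-- Standard Young tableaux.  A filling of a shape with 1..n is given by
-- T : Fin n → Cell, where T k is the cell containing entry k+1.

record IsSYT (n : ℕ) (sh : List ℕ) (T : Fin n → Cell) : Set where
  field
    inShape  : ∀ k → InShape sh (T k)
    injective : ∀ k l → T k ≡ T l → k ≡ l
    surjective : ∀ i j → InShape sh (i , j) → ∃ λ k → T k ≡ (i , j)
    rowsIncrease : ∀ k l → proj₁ (T l) ≡ proj₁ (T k) →
                   proj₂ (T l) ≡ suc (proj₂ (T k)) → toℕ k < toℕ l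
    colsIncrease : ∀ k l → proj₂ (T l) ≡ proj₂ (T k) →
                   proj₁ (T l) ≡ suc (proj₁ (T k)) → toℕ k < toℕ l

HasResidues : ∀ {n} → (Fin n → Cell) → (Fin n → Fin 2) → Set
HasResidues T v = ∀ k → residue (T k) ≡ v k

private
  _≟C_ : (a b : Cell) → Dec (a ≡ b)
  _≟C_ = ≡-dec _≟ℕ_ _≟ℕ_

  -- bounded surjectivity check: all cells of λ lie in rows < length λ
  -- and columns < rowLen λ i
  inShape? : ∀ sh c → Dec (InShape sh c)
  inShape? sh (i , j) = j <? rowLen sh i

  allBelow? : ∀ {P : ℕ → Set} → (∀ m → Dec (P m)) → ∀ b → Dec (∀ m → m < b → P m)
  allBelow? P? zero = yes λ m ()
  allBelow? {P} P? (suc b) with P? b | allBelow? P? b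
  ... | no ¬p | _ = no λ f → ¬p (f b (Data.Nat.Properties.n<1+n b))
  ... | yes p | no ¬f = no λ f → ¬f λ m m<b → f m (Data.Nat.Properties.m<n⇒m<1+n m<b)
  ... | yes p | yes f = yes λ m m<1+b → helper m (Data.Nat.Properties.m<1+n⇒m<n∨m≡n m<1+b)
    where
    open import Data.Sum using (inj₁; inj₂)
    open import Relation.Binary.PropositionalEquality using (refl)
    helper : ∀ m → _ → P m
    helper m (inj₁ m<b) = f m m<b
    helper m (inj₂ refl) = p

  surj? : ∀ {n} sh (T : Fin n → Cell) →
          Dec (∀ i j → InShape sh (i , j) → ∃ λ k → T k ≡ (i , j))
  surj? sh T with allBelow? (λ i → allBelow? (λ j → any? (λ k → T k ≟C (i , j))) (rowLen sh i)) (length sh)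
  ... | yes f = yes λ i j j<r → f i (rowBound sh i j j<r) j j<r
    where
    open import Relation.Binary.PropositionalEquality using (refl)
    rowBound : ∀ sh i j → j < rowLen sh i → i < length sh
    rowBound [] i j ()
    rowBound (x ∷ sh) zero j _ = Data.Nat.s≤s Data.Nat.z≤n
    rowBound (x ∷ sh) (suc i) j p = Data.Nat.s≤s (rowBound sh i j p)
  ... | no ¬f = no λ g → ¬f λ i _ j j<r → g i j j<r

isSYT? : ∀ n sh (T : Fin n → Cell) → Dec (IsSYT n sh T)
isSYT? n sh T with all? (λ k → inShape? sh (T k))
                | all? (λ k → all? (λ l → (T k ≟C T l) →-dec (k ≟F l)))
                | surj? sh T
                | all? (λ k → all? (λ l → (proj₁ (T l) ≟ℕ proj₁ (T k)) →-dec
                    ((proj₂ (T l) ≟ℕ suc (proj₂ (T k))) →-dec (toℕ k <? toℕ l))))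
                | all? (λ k → all? (λ l → (proj₂ (T l) ≟ℕ proj₂ (T k)) →-dec
                    ((proj₁ (T l) ≟ℕ suc (proj₁ (T k))) →-dec (toℕ k <? toℕ l))))
... | yes a | yes b | yes c | yes d | yes e = yes record
      { inShape = a ; injective = b ; surjective = c ; rowsIncrease = d ; colsIncrease = e }
... | no ¬a | _ | _ | _ | _ = no λ s → ¬a (IsSYT.inShape s)
... | yes _ | no ¬b | _ | _ | _ = no λ s → ¬b (IsSYT.injective s)
... | yes _ | yes _ | no ¬c | _ | _ = no λ s → ¬c (IsSYT.surjective s)
... | yes _ | yes _ | yes _ | no ¬d | _ = no λ s → ¬d (IsSYT.rowsIncrease s)
... | yes _ | yes _ | yes _ | yes _ | no ¬e = no λ s → ¬e (IsSYT.colsIncrease s)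

hasResidues? : ∀ {n} (T : Fin n → Cell) (v : Fin n → Fin 2) → Dec (HasResidues T v)
hasResidues? T v = all? (λ k → residue (T k) ≟F v k)

-- Finite enumeration of candidate fillings.  Every cell of a partition
-- of n lies in {0..n-1} × {0..n-1}, so every SYT of shape λ ⊢ n occurs
-- (exactly once) among the maps Fin n → {0..n-1}².

vecsOf : ∀ {A : Set} → List A → (k : ℕ) → List (Vec A k)
vecsOf xs zero    = []ᵥ ∷ []
vecsOf xs (suc k) = concatMap (λ x → map (x ∷ᵥ_) (vecsOf xs k)) xs

boxCells : ℕ → List Cell
boxCells n = concatMap (λ i → map (i ,_) (upTo n)) (upTo n)

candidates : (n : ℕ) → List (Fin n → Cell)
candidates n = map lookup (vecsOf (boxCells n) n)

C₂ : ∀ {n} → (Fin n → Fin 2) → List ℕ → ℕ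
C₂ {n} v sh = length (filter (λ T → isSYT? n sh T ×-dec hasResidues? T v) (candidates n))

-- a(n): the number of triangular numbers m(m+1)/2 (m ≥ 1) that are ≤ n.
-- (Only m ≤ n can qualify, since m(m+1)/2 ≥ m.)

a : ℕ → ℕ
a n = length (filter (λ m → (m * suc m) / 2 ≤? n) (map suc (upTo n)))

{-# OPTIONS --safe #-}
module Submission where

-- In the Fock space on partitions let f₀, f₁ add a cell of residue 0, 1; the sum in question is
-- the pairing of f_v ∅ with f_w ∅.  Let p_k be multiplication by a power sum and y_i = 2^i p_{2i+1}.
-- The key fact is that f₀ and f₁ preserve the lattice L = ℤ₍₂₎[y₀, y₁, …] ∅.  Since f₀ + f₁ = y₀ and
-- [f₁, y_i] = 2^i X_{2i+2} for the modes X_m of the vertex operator of principal ŝl₂, and commutators of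
-- X_m with y_i are again modes, this reduces to 2^⌊(m−1)/2⌋ X_m ∅ ∈ L.  The Sugawara formula gives
-- m X_m ∅ = [m odd] p_m ∅ + 2 Σ_{k odd, k < m} p_k X_{m−k} ∅, which settles odd m; for even m one
-- subtracts the image under f₁ of the relation for m − 1, and gets an odd multiple of X_m ∅.
-- Monomials in the y_i are orthogonal, and ∏ y_i^{m_i} ∅ has square norm ∏ (2i+1)^{m_i} 4^{i m_i} m_i!.
-- Merging equal parts (Glaisher) turns the odd parts into s distinct parts, so s ≤ a(n), and the
-- norm is divisible by 2^{n−s}.
--
-- A partition is a strictly decreasing sequence of bead positions (an exterior power), and a
-- vector is a functional on functions of bead positions, compared on alternating ones only.

open import Defs
open import Data.Nat using (ℕ; zero; suc; _+_; _*_; _^_; _∸_; _≤_; _<_; z≤n; s≤s; _≤?_; _<?_; _≟_; _!)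
import Data.Nat.Properties as ℕₚ
open import Data.Nat.Divisibility using (_∣_; divides; ∣-refl; ∣-trans; *-pres-∣; 1∣_; *-cancelˡ-∣; *-monoʳ-∣; *-monoˡ-∣; ∣n⇒∣m*n)
open import Data.Nat.DivMod using (_/_; _mod_; _%_; /-monoˡ-≤; m*n/n≡m; [m+n]%n≡m%n)
import Data.Nat.Tactic.RingSolver as ℕ-Solver
open import Data.Nat.ListAction using (sum)
open import Data.Integer using (ℤ; +_; 0ℤ; 1ℤ)
import Data.Integer as ℤ
import Data.Integer.Properties as ℤₚ
open import Data.Integer.Tactic.RingSolver using (solve-∀)
open import Data.Fin using (Fin; zero; suc; toℕ; inject₁; fromℕ) renaming (_≟_ to _≟F_)
import Data.Fin.Properties as Finₚ
open import Data.Fin.Relation.Unary.Top using (view; ‵fromℕ; ‵inject₁)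
open import Data.List using (List; []; _∷_; length; map; filter; concatMap; _++_; upTo; applyUpTo)
import Data.List.Properties as Listₚ
open import Data.List.Membership.Propositional using (_∈_; find; lose)
open import Data.List.Membership.Propositional.Properties using (∈-map⁺; ∈-map⁻; ∈-filter⁺; ∈-filter⁻; ∈-concatMap⁺; ∈-concatMap⁻; ∈-upTo⁺)
open import Data.List.Membership.Propositional.Properties.WithK using (unique∧set⇒bag)
open import Data.List.Relation.Binary.BagAndSetEquality using (∼bag⇒↭)
open import Data.List.Relation.Binary.Permutation.Propositional as Perm using (_↭_)
open import Data.List.Relation.Unary.All as All using ([]; _∷_)
open import Data.List.Relation.Unary.AllPairs using ([]; _∷_)
open import Data.List.Relation.Unary.Any using (here; there)
open import Data.List.Relation.Unary.Unique.Propositional using (Unique)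
import Data.List.Relation.Unary.Unique.Propositional.Properties as Uniqueₚ
open import Data.Vec using (Vec; []; _∷_; lookup; _∷ʳ_; initLast)
import Data.Vec.Properties as Vecₚ
open import Data.Vec.Membership.Propositional using () renaming (_∈_ to _∈ᵥ_)
open import Data.Vec.Relation.Unary.All as VecAll using ([]; _∷_) renaming (All to Allᵥ)
open import Data.Vec.Relation.Unary.Any as VecAny using (here; there)
open import Data.Product using (_×_; _,_; proj₁; proj₂; ∃; ∃₂)
open import Data.Sum using (_⊎_; inj₁; inj₂)
open import Data.Empty using (⊥; ⊥-elim)
open import Function.Bundles using (_⇔_; mk⇔; Equivalence)
open import Relation.Nullary using (yes; no; ¬_)
open import Relation.Nullary.Decidable using (_×-dec_)
open import Relation.Unary using (Decidable)
open import Relation.Binary.Definitions using (tri<; tri≈; tri>)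
open import Relation.Binary.PropositionalEquality using (_≡_; _≢_; refl; sym; trans; cong; cong₂; subst; subst₂; module ≡-Reasoning)

-- One-body operators on alternating functions

-- The powers of two come from the commutator of X_m with p_{2i+1}, which is -2 X_{m+2i+1}: scaling
-- p_{2i+1} by 2^i and X_m by 2^⌊(m-1)/2⌋ keeps all these commutators integral. The obstacle is a
-- circularity. For even m the relation for X_m ∅ contains images under f₁, and commuting f₁ to the
-- vacuum can produce X_m ∅ again. These images enter with the coefficient 2, so the total
-- coefficient of X_m ∅ changes by an even number and remains odd; X_m ∅ is then recovered by
-- dividing by it. The Sugawara formula holds because Σ p_k D_k, with D_k adjoint to p_k, multiplies
-- an alternating vector by its degree. On X_m ∅ each D_k can be commuted to the vacuum. Only
-- finitely many beads are used. Operators that lower beads are then truncated, and their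
-- commutators acquire corrections on the lowest beads. These corrections send beads to occupied
-- sites and vanish as long as the degree leaves enough room, which is the origin of the degree
-- bounds. The number of beads is odd, so that bead parity is the residue, f₁ kills the vacuum, and
-- the alternating signs of the occupied sites sum to 1.

infixl 6 _+ᶻ_
infixl 7 _*ᶻ_
infix 8 -ᶻ_
-- Opaque, so that unification does not unfold integer arithmetic.
opaque
  _+ᶻ_ _*ᶻ_ : ℤ → ℤ → ℤ
  _+ᶻ_ = ℤ._+_
  _*ᶻ_ = ℤ._*_
  -ᶻ_ : ℤ → ℤ
  -ᶻ_ = ℤ.-_

  +ᶻ-identityˡ : ∀ x → 0ℤ +ᶻ x ≡ x
  +ᶻ-identityˡ = ℤₚ.+-identityˡ
  +ᶻ-identityʳ : ∀ x → x +ᶻ 0ℤ ≡ x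
  +ᶻ-identityʳ = ℤₚ.+-identityʳ
  +ᶻ-comm : ∀ x y → x +ᶻ y ≡ y +ᶻ x
  +ᶻ-comm = ℤₚ.+-comm
  +ᶻ-assoc : ∀ x y z → (x +ᶻ y) +ᶻ z ≡ x +ᶻ (y +ᶻ z)
  +ᶻ-assoc = ℤₚ.+-assoc
  *ᶻ-assoc : ∀ x y z → (x *ᶻ y) *ᶻ z ≡ x *ᶻ (y *ᶻ z)
  *ᶻ-assoc = ℤₚ.*-assoc
  *ᶻ-identityˡ : ∀ x → 1ℤ *ᶻ x ≡ x
  *ᶻ-identityˡ = ℤₚ.*-identityˡ
  *ᶻ-zeroʳ : ∀ x → x *ᶻ 0ℤ ≡ 0ℤ
  *ᶻ-zeroʳ = ℤₚ.*-zeroʳ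
  *ᶻ-zeroˡ : ∀ x → 0ℤ *ᶻ x ≡ 0ℤ
  *ᶻ-zeroˡ = ℤₚ.*-zeroˡ
  *ᶻ-distribˡ-+ : ∀ k x y → k *ᶻ (x +ᶻ y) ≡ k *ᶻ x +ᶻ k *ᶻ y
  *ᶻ-distribˡ-+ = ℤₚ.*-distribˡ-+
  neg-+ : ∀ x y → -ᶻ (x +ᶻ y) ≡ -ᶻ x +ᶻ -ᶻ y
  neg-+ = ℤₚ.neg-distrib-+
  neg-*ʳ : ∀ x y → -ᶻ (x *ᶻ y) ≡ x *ᶻ (-ᶻ y)
  neg-*ʳ = ℤₚ.neg-distribʳ-*
  neg-involutive : ∀ x → -ᶻ (-ᶻ x) ≡ x
  neg-involutive = ℤₚ.neg-involutive
  neg-0 : -ᶻ 0ℤ ≡ 0ℤ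
  neg-0 = refl
  -1*ᶻ : ∀ x → (-ᶻ 1ℤ) *ᶻ x ≡ -ᶻ x
  -1*ᶻ = solve-∀
  +ᶻ-inverseʳ : ∀ x → x +ᶻ -ᶻ x ≡ 0ℤ
  +ᶻ-inverseʳ = ℤₚ.+-inverseʳ
  self-neg⇒0 : ∀ x → x ≡ -ᶻ x → x ≡ 0ℤ
  self-neg⇒0 (+ zero) _ = refl
  self-neg⇒0 (+ suc n) ()
  self-neg⇒0 (ℤ.-[1+ n ]) ()

  +ᶻ-interchange : ∀ x y u v → (x +ᶻ y) +ᶻ (u +ᶻ v) ≡ (x +ᶻ u) +ᶻ (y +ᶻ v)
  +ᶻ-interchange = solve-∀
  +ᶻ-exch : ∀ x y z → x +ᶻ (y +ᶻ z) ≡ y +ᶻ (x +ᶻ z)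
  +ᶻ-exch = solve-∀
  *ᶻ-swap : ∀ k l x → k *ᶻ (l *ᶻ x) ≡ l *ᶻ (k *ᶻ x)
  *ᶻ-swap = solve-∀
  ring-+ : ∀ c x y u v → c *ᶻ (x +ᶻ y) +ᶻ (u +ᶻ v) ≡ (c *ᶻ x +ᶻ u) +ᶻ (c *ᶻ y +ᶻ v)
  ring-+ = solve-∀
  ring-* : ∀ c k x u → c *ᶻ (k *ᶻ x) +ᶻ k *ᶻ u ≡ k *ᶻ (c *ᶻ x +ᶻ u)
  ring-* = solve-∀
  ring-comm : ∀ x t p q u v →
    ((x +ᶻ t) +ᶻ p) +ᶻ (q +ᶻ (u +ᶻ v)) ≡ ((x +ᶻ q) +ᶻ (p +ᶻ u)) +ᶻ (t +ᶻ v)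
  ring-comm = solve-∀
  ring-alt : ∀ p q x y u → p *ᶻ (-ᶻ x) +ᶻ (q *ᶻ (-ᶻ y) +ᶻ -ᶻ u) ≡ -ᶻ (q *ᶻ y +ᶻ (p *ᶻ x +ᶻ u))
  ring-alt = solve-∀

Fun : ℕ → Set
Fun N = Vec ℕ N → ℤ

-- The transpose of the operator that moves one bead from `a` to `τ a` with weight `c a`, summed
-- over the beads. Beads already passed are absorbed into the function, which keeps the recursion
-- structural.
oneBody : (ℕ → ℤ) → (ℕ → ℕ) → ∀ {N} → Fun N → Fun N
oneBody c τ g []       = 0ℤ
oneBody c τ g (a ∷ as) = c a *ᶻ g (τ a ∷ as) +ᶻ oneBody c τ (λ r → g (a ∷ r)) as

oneBody-cong : ∀ c τ {N} {g h : Fun N} → (∀ as → g as ≡ h as) →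
               ∀ as → oneBody c τ g as ≡ oneBody c τ h as
oneBody-cong c τ eq []       = refl
oneBody-cong c τ eq (a ∷ as) =
  cong₂ (λ x y → c a *ᶻ x +ᶻ y) (eq (τ a ∷ as)) (oneBody-cong c τ (λ r → eq (a ∷ r)) as)

oneBody-+ : ∀ c τ {N} (g h : Fun N) as →
            oneBody c τ (λ r → g r +ᶻ h r) as ≡ oneBody c τ g as +ᶻ oneBody c τ h as
oneBody-+ c τ g h []       = sym (+ᶻ-identityʳ 0ℤ)
oneBody-+ c τ g h (a ∷ as) rewrite oneBody-+ c τ (λ r → g (a ∷ r)) (λ r → h (a ∷ r)) as =
  ring-+ _ _ _ _ _

oneBody-* : ∀ c τ {N} k (g : Fun N) as →
            oneBody c τ (λ r → k *ᶻ g r) as ≡ k *ᶻ oneBody c τ g as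
oneBody-* c τ k g []       = sym (*ᶻ-zeroʳ k)
oneBody-* c τ k g (a ∷ as) rewrite oneBody-* c τ k (λ r → g (a ∷ r)) as =
  ring-* _ _ _ _

-- Quantifying over test functions `h` expresses an identity of one-bead operators in which the
-- targets of the moves may disagree wherever a weight vanishes.
oneBody-lin : ∀ c₁ τ₁ c₂ τ₂ c₃ τ₃ →
  (∀ a (h : ℕ → ℤ) → c₁ a *ᶻ h (τ₁ a) ≡ c₂ a *ᶻ h (τ₂ a) +ᶻ c₃ a *ᶻ h (τ₃ a)) →
  ∀ {N} (g : Fun N) as → oneBody c₁ τ₁ g as ≡ oneBody c₂ τ₂ g as +ᶻ oneBody c₃ τ₃ g as
oneBody-lin c₁ τ₁ c₂ τ₂ c₃ τ₃ H g []       = sym (+ᶻ-identityʳ 0ℤ)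
oneBody-lin c₁ τ₁ c₂ τ₂ c₃ τ₃ H g (a ∷ as)
  rewrite H a (λ x → g (x ∷ as)) | oneBody-lin c₁ τ₁ c₂ τ₂ c₃ τ₃ H (λ r → g (a ∷ r)) as = +ᶻ-interchange _ _ _ _

-- The four terms record whether each of the two operators hits the first bead or a later one.
oneBody² : ∀ c τ c′ τ′ {N} (g : Fun (suc N)) a as →
  oneBody c′ τ′ (oneBody c τ g) (a ∷ as) ≡
    (c′ a *ᶻ (c (τ′ a) *ᶻ g (τ (τ′ a) ∷ as)) +ᶻ c′ a *ᶻ oneBody c τ (λ r → g (τ′ a ∷ r)) as)
    +ᶻ (c a *ᶻ oneBody c′ τ′ (λ r → g (τ a ∷ r)) as
        +ᶻ oneBody c′ τ′ (oneBody c τ (λ r → g (a ∷ r))) as)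
oneBody² c τ c′ τ′ g a as = cong₂ _+ᶻ_ (*ᶻ-distribˡ-+ (c′ a) _ _)
  (trans (oneBody-+ c′ τ′ (λ r → c a *ᶻ g (τ a ∷ r)) (oneBody c τ (λ r → g (a ∷ r))) as)
         (cong (_+ᶻ oneBody c′ τ′ (oneBody c τ (λ r → g (a ∷ r))) as)
               (oneBody-* c′ τ′ (c a) (λ r → g (τ a ∷ r)) as)))

-- On different beads the two operators commute, so the commutator is again one-body.
oneBody-comm : ∀ c₁ τ₁ c₂ τ₂ c₃ τ₃ →
  (∀ a (h : ℕ → ℤ) → c₂ a *ᶻ (c₁ (τ₂ a) *ᶻ h (τ₁ (τ₂ a)))
                   ≡ c₁ a *ᶻ (c₂ (τ₁ a) *ᶻ h (τ₂ (τ₁ a))) +ᶻ c₃ a *ᶻ h (τ₃ a)) →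
  ∀ {N} (g : Fun N) as →
  oneBody c₂ τ₂ (oneBody c₁ τ₁ g) as ≡ oneBody c₁ τ₁ (oneBody c₂ τ₂ g) as +ᶻ oneBody c₃ τ₃ g as
oneBody-comm c₁ τ₁ c₂ τ₂ c₃ τ₃ H g []       = sym (+ᶻ-identityʳ 0ℤ)
oneBody-comm c₁ τ₁ c₂ τ₂ c₃ τ₃ H g (a ∷ as)
  rewrite oneBody² c₁ τ₁ c₂ τ₂ g a as | oneBody² c₂ τ₂ c₁ τ₁ g a as
        | H a (λ x → g (x ∷ as))
        | oneBody-comm c₁ τ₁ c₂ τ₂ c₃ τ₃ H (λ r → g (a ∷ r)) as = ring-comm _ _ _ _ _ _

-- Adjacent transpositions generate all permutations. Imposing them one position at a time makes
-- antisymmetry hereditary when leading beads are fixed.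
data Alt : ∀ {N} → Fun N → Set where
  alt-nil  : ∀ {g : Fun 0} → Alt g
  alt-one  : ∀ {g : Fun 1} → Alt g
  alt-cons : ∀ {N} {g : Fun (suc (suc N))} →
             (∀ a b r → g (a ∷ b ∷ r) ≡ -ᶻ g (b ∷ a ∷ r)) →
             (∀ a → Alt (λ r → g (a ∷ r))) → Alt g

alt-tail : ∀ {N} {g : Fun (suc N)} → Alt g → ∀ a → Alt (λ r → g (a ∷ r))
alt-tail alt-one        a = alt-nil
alt-tail (alt-cons _ t) a = t a

alt-resp : ∀ {N} {g h : Fun N} → (∀ as → g as ≡ h as) → Alt g → Alt h
alt-resp eq alt-nil = alt-nil
alt-resp eq alt-one = alt-one
alt-resp eq (alt-cons s t) =
  alt-cons (λ a b r → trans (sym (eq _)) (trans (s a b r) (cong -ᶻ_ (eq _))))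
           (λ a → alt-resp (λ r → eq (a ∷ r)) (t a))

alt-+ : ∀ {N} {g h : Fun N} → Alt g → Alt h → Alt (λ as → g as +ᶻ h as)
alt-+ alt-nil _ = alt-nil
alt-+ alt-one _ = alt-one
alt-+ (alt-cons s t) (alt-cons s′ t′) =
  alt-cons (λ a b r → trans (cong₂ _+ᶻ_ (s a b r) (s′ a b r)) (sym (neg-+ _ _)))
           (λ a → alt-+ (t a) (t′ a))

alt-* : ∀ {N} k {g : Fun N} → Alt g → Alt (λ as → k *ᶻ g as)
alt-* k alt-nil = alt-nil
alt-* k alt-one = alt-one
alt-* k (alt-cons s t) =
  alt-cons (λ a b r → trans (cong (k *ᶻ_) (s a b r)) (sym (neg-*ʳ k _)))
           (λ a → alt-* k (t a))

oneBody-alt : ∀ c τ {N} {g : Fun N} → Alt g → Alt (oneBody c τ g)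
oneBody-alt c τ alt-nil = alt-nil
oneBody-alt c τ alt-one = alt-one
oneBody-alt c τ {g = g} (alt-cons s t) =
  alt-cons swap (λ a → alt-+ (alt-* (c a) (t (τ a))) (oneBody-alt c τ (t a)))
  where
  swap : ∀ a b r → oneBody c τ g (a ∷ b ∷ r) ≡ -ᶻ oneBody c τ g (b ∷ a ∷ r)
  swap a b r
    rewrite s (τ a) b r | s a (τ b) r
          | oneBody-cong c τ (λ r → trans (s a b r) (sym (-1*ᶻ (g (b ∷ a ∷ r))))) r
          | oneBody-* c τ (-ᶻ 1ℤ) (λ r → g (b ∷ a ∷ r)) r
          | -1*ᶻ (oneBody c τ (λ r → g (b ∷ a ∷ r)) r)
    = ring-alt _ _ _ _ _

-- Vectors as linear functionals.

record Vect (N : ℕ) : Set where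
  field
    app      : Fun N → ℤ
    app-cong : ∀ {g h} → (∀ as → g as ≡ h as) → app g ≡ app h
    app-+    : ∀ g h → app (λ as → g as +ᶻ h as) ≡ app g +ᶻ app h
    app-*    : ∀ k g → app (λ as → k *ᶻ g as) ≡ k *ᶻ app g
open Vect public

infix 4 _≈_
_≈_ : ∀ {N} → Vect N → Vect N → Set
φ ≈ ψ = ∀ g → Alt g → app φ g ≡ app ψ g

ev : ∀ {N} → Vec ℕ N → Vect N
ev as = record { app = λ g → g as ; app-cong = λ e → e as ; app-+ = λ _ _ → refl ; app-* = λ _ _ → refl }

-- Precomposition reverses the order of composites: in `act c₁ τ₁ (act c₂ τ₂ φ)` a bead is moved by
-- `τ₂` first, which is the order used in the hypothesis of `act-comm`.
act : (ℕ → ℤ) → (ℕ → ℕ) → ∀ {N} → Vect N → Vect N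
act c τ φ = record
  { app      = λ g → app φ (oneBody c τ g)
  ; app-cong = λ e → app-cong φ (oneBody-cong c τ e)
  ; app-+    = λ g h → trans (app-cong φ (oneBody-+ c τ g h)) (app-+ φ _ _)
  ; app-*    = λ k g → trans (app-cong φ (oneBody-* c τ k g)) (app-* φ _ _) }

infixl 6 _⊕_
infixr 7 _⊙_
_⊕_ : ∀ {N} → Vect N → Vect N → Vect N
φ ⊕ ψ = record
  { app      = λ g → app φ g +ᶻ app ψ g
  ; app-cong = λ e → cong₂ _+ᶻ_ (app-cong φ e) (app-cong ψ e)
  ; app-+    = λ g h → trans (cong₂ _+ᶻ_ (app-+ φ g h) (app-+ ψ g h)) (+ᶻ-interchange _ _ _ _)
  ; app-*    = λ k g → trans (cong₂ _+ᶻ_ (app-* φ k g) (app-* ψ k g)) (sym (*ᶻ-distribˡ-+ k _ _)) }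

_⊙_ : ∀ {N} → ℤ → Vect N → Vect N
k ⊙ φ = record
  { app      = λ g → k *ᶻ app φ g
  ; app-cong = λ e → cong (k *ᶻ_) (app-cong φ e)
  ; app-+    = λ g h → trans (cong (k *ᶻ_) (app-+ φ g h)) (*ᶻ-distribˡ-+ k _ _)
  ; app-*    = λ l g → trans (cong (k *ᶻ_) (app-* φ l g)) (*ᶻ-swap _ _ _) }

𝟘 : ∀ {N} → Vect N
𝟘 = record { app = λ _ → 0ℤ ; app-cong = λ _ → refl ; app-+ = λ _ _ → sym (+ᶻ-identityʳ 0ℤ)
           ; app-* = λ k _ → sym (*ᶻ-zeroʳ k) }

act-cong : ∀ c τ {N} {φ ψ : Vect N} → φ ≈ ψ → act c τ φ ≈ act c τ ψ
act-cong c τ e g A = e _ (oneBody-alt c τ A)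

act-comm : ∀ c₁ τ₁ c₂ τ₂ c₃ τ₃ →
  (∀ a (h : ℕ → ℤ) → c₂ a *ᶻ (c₁ (τ₂ a) *ᶻ h (τ₁ (τ₂ a)))
                   ≡ c₁ a *ᶻ (c₂ (τ₁ a) *ᶻ h (τ₂ (τ₁ a))) +ᶻ c₃ a *ᶻ h (τ₃ a)) →
  ∀ {N} (φ : Vect N) g →
  app (act c₁ τ₁ (act c₂ τ₂ φ)) g ≡ app (act c₂ τ₂ (act c₁ τ₁ φ)) g +ᶻ app (act c₃ τ₃ φ) g
act-comm c₁ τ₁ c₂ τ₂ c₃ τ₃ H φ g =
  trans (app-cong φ (oneBody-comm c₁ τ₁ c₂ τ₂ c₃ τ₃ H g)) (app-+ φ _ _)

-- The vacuum and collisions of beads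

-- Here one distinguished bead can be exchanged with every other bead, not only with its neighbour.
-- This is the form of antisymmetry from which vanishing at a collision is immediate.
data Swap : ∀ {N} → (ℕ → Fun N) → Set where
  swap-nil  : ∀ {H : ℕ → Fun 0} → Swap H
  swap-cons : ∀ {N} {H : ℕ → Fun (suc N)} →
              (∀ u b r → H u (b ∷ r) ≡ -ᶻ H b (u ∷ r)) →
              (∀ b → Swap (λ u r → H u (b ∷ r))) → Swap H

swap-neg : ∀ {N} {H H′ : ℕ → Fun N} → (∀ u r → H u r ≡ -ᶻ H′ u r) → Swap H′ → Swap H
swap-neg e swap-nil = swap-nil
swap-neg e (swap-cons s t) =
  swap-cons (λ u b r → trans (e u (b ∷ r)) (cong -ᶻ_ (trans (s u b r) (sym (e b (u ∷ r))))))
            (λ b → swap-neg (λ u r → e u (b ∷ r)) (t b))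

alt⇒swap : ∀ {N} {g : Fun (suc N)} → Alt g → Swap (λ u r → g (u ∷ r))
alt⇒swap alt-one = swap-nil
alt⇒swap (alt-cons s t) =
  swap-cons s (λ b → swap-neg (λ u r → s u b r) (alt⇒swap (t b)))

swap-vanish : ∀ {N} {H : ℕ → Fun N} → Swap H → ∀ {x as} → x ∈ᵥ as → H x as ≡ 0ℤ
swap-vanish (swap-cons s t) (here refl) = self-neg⇒0 _ (s _ _ _)
swap-vanish (swap-cons s t) (there {x = b} p) = swap-vanish (t b) p

alt-vanish : ∀ {N} {g : Fun (suc N)} → Alt g → ∀ {x as} → x ∈ᵥ as → g (x ∷ as) ≡ 0ℤ
alt-vanish A = swap-vanish (alt⇒swap A)

δ : ∀ N → Vec ℕ N
δ zero    = []
δ (suc N) = N ∷ δ N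

<⇒∈δ : ∀ {N x} → x < N → x ∈ᵥ δ N
<⇒∈δ {suc N} {x} (s≤s x≤N) with ℕₚ.m≤n⇒m<n∨m≡n x≤N
... | inj₁ x<N  = there (<⇒∈δ x<N)
... | inj₂ refl = here refl

vac : ∀ {N} → Vect N
vac {N} = ev (δ N)

-- Every move with nonzero weight hits an occupied site. Once the top beads have been absorbed into
-- `h`, the sites from `N` up to `B` are theirs, and `V` remembers them as a vanishing condition on
-- `h`.
oneBody-occupied : ∀ c τ B {N} {h : Fun N} → Alt h →
  (∀ as x → x ∈ᵥ as → N ≤ x → x < B → h as ≡ 0ℤ) →
  (∀ a → a < N → c a ≡ 0ℤ ⊎ (τ a ≢ a × τ a < B)) →
  oneBody c τ h (δ N) ≡ 0ℤ
oneBody-occupied c τ B {zero} A V C = refl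
oneBody-occupied c τ B {suc N} {h} A V C =
  trans (cong₂ _+ᶻ_ (head (C N ℕₚ.≤-refl)) tail) (+ᶻ-identityʳ 0ℤ)
  where
  head : c N ≡ 0ℤ ⊎ (τ N ≢ N × τ N < B) → c N *ᶻ h (τ N ∷ δ N) ≡ 0ℤ
  head (inj₁ e) rewrite e = *ᶻ-zeroˡ _
  head (inj₂ (ne , lt)) with τ N <? N
  ... | yes p rewrite alt-vanish A (<⇒∈δ p) = *ᶻ-zeroʳ _
  ... | no ¬p rewrite V (τ N ∷ δ N) (τ N) (here refl)
                        (ℕₚ.≤∧≢⇒< (ℕₚ.≮⇒≥ ¬p) (λ e → ne (sym e))) lt = *ᶻ-zeroʳ _
  V′ : ∀ as x → x ∈ᵥ as → N ≤ x → x < B → h (N ∷ as) ≡ 0ℤ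
  V′ as x p N≤x x<B with ℕₚ.m≤n⇒m<n∨m≡n N≤x
  ... | inj₁ N<x  = V (N ∷ as) x (there p) N<x x<B
  ... | inj₂ refl = alt-vanish A p
  tail : oneBody c τ (λ r → h (N ∷ r)) (δ N) ≡ 0ℤ
  tail = oneBody-occupied c τ B (alt-tail A N) V′ (λ a a<N → C a (ℕₚ.m<n⇒m<1+n a<N))

act-occupied : ∀ c τ {N} → (∀ a → a < N → c a ≡ 0ℤ ⊎ (τ a ≢ a × τ a < N)) →
               act c τ (vac {N}) ≈ 𝟘
act-occupied c τ {N} C g A =
  oneBody-occupied c τ N A (λ _ x _ p q → ⊥-elim (ℕₚ.<⇒≱ q p)) C

Σ< : (ℕ → ℤ) → ℕ → ℤ
Σ< c zero    = 0ℤ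
Σ< c (suc n) = c n +ᶻ Σ< c n

Σ<-cong : ∀ {c c′ : ℕ → ℤ} n → (∀ a → a < n → c a ≡ c′ a) → Σ< c n ≡ Σ< c′ n
Σ<-cong zero    e = refl
Σ<-cong (suc n) e = cong₂ _+ᶻ_ (e n ℕₚ.≤-refl) (Σ<-cong n (λ a p → e a (ℕₚ.m<n⇒m<1+n p)))

Σ<-+ : ∀ c c′ n → Σ< (λ a → c a +ᶻ c′ a) n ≡ Σ< c n +ᶻ Σ< c′ n
Σ<-+ c c′ zero    = sym (+ᶻ-identityʳ 0ℤ)
Σ<-+ c c′ (suc n) rewrite Σ<-+ c c′ n = +ᶻ-interchange _ _ _ _

Σ<-neg : ∀ c n → Σ< (λ a → -ᶻ c a) n ≡ -ᶻ Σ< c n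
Σ<-neg c zero    = sym neg-0
Σ<-neg c (suc n) rewrite Σ<-neg c n = sym (neg-+ _ _)

opaque
  unfolding _+ᶻ_ _*ᶻ_ -ᶻ_
  ring-factor : ∀ c u x → c *ᶻ x +ᶻ u *ᶻ x ≡ (c +ᶻ u) *ᶻ x
  ring-factor = solve-∀
  1-0 : 1ℤ +ᶻ -ᶻ 0ℤ ≡ 1ℤ
  1-0 = refl
  s-from-o : 1ℤ ≡ 1ℤ +ᶻ -ᶻ ((+ 2) *ᶻ 0ℤ)
  s-from-o = refl
  s-from-o-step : ∀ o → -ᶻ (1ℤ +ᶻ -ᶻ ((+ 2) *ᶻ o)) ≡ 1ℤ +ᶻ -ᶻ ((+ 2) *ᶻ (1ℤ +ᶻ -ᶻ o))
  s-from-o-step = solve-∀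
  1-[1-x] : ∀ x → 1ℤ +ᶻ -ᶻ (1ℤ +ᶻ -ᶻ x) ≡ x
  1-[1-x] = solve-∀
  neg+0 : ∀ x → -ᶻ x +ᶻ x ≡ 0ℤ
  neg+0 = solve-∀

oneBody-diagonal : ∀ c τ N → (∀ a → a < N → τ a ≡ a) → ∀ (g : Fun N) →
                   oneBody c τ g (δ N) ≡ Σ< c N *ᶻ g (δ N)
oneBody-diagonal c τ zero    e g = sym (*ᶻ-zeroˡ _)
oneBody-diagonal c τ (suc N) e g
  rewrite e N ℕₚ.≤-refl
        | oneBody-diagonal c τ N (λ a p → e a (ℕₚ.m<n⇒m<1+n p)) (λ r → g (N ∷ r)) = ring-factor _ _ _

-- The sign (-1)^a and the indicator of odd a. The relation s = 1 - 2o is what turns commutators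
-- with `F₁` into modes of the vertex operator.
s o : ℕ → ℤ
s zero    = 1ℤ
s (suc a) = -ᶻ s a
o zero    = 0ℤ
o (suc a) = 1ℤ +ᶻ -ᶻ o a

s≡1-2o : ∀ a → s a ≡ 1ℤ +ᶻ -ᶻ ((+ 2) *ᶻ o a)
s≡1-2o zero    = s-from-o
s≡1-2o (suc a) rewrite s≡1-2o a = s-from-o-step _

dbl : ℕ → ℕ
dbl zero    = zero
dbl (suc n) = suc (suc (dbl n))

dbl-+ : ∀ m n → dbl (m + n) ≡ dbl m + dbl n
dbl-+ zero    n = refl
dbl-+ (suc m) n = cong (λ x → suc (suc x)) (dbl-+ m n)

dbl≡+ : ∀ n → dbl n ≡ n + n
dbl≡+ zero    = refl
dbl≡+ (suc n) = cong suc (trans (cong suc (dbl≡+ n)) (sym (ℕₚ.+-suc n n)))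

s-dbl : ∀ i a → s (dbl i + a) ≡ s a
s-dbl zero    a = refl
s-dbl (suc i) a = trans (neg-involutive _) (s-dbl i a)

o-dbl : ∀ i a → o (dbl i + a) ≡ o a
o-dbl zero    a = refl
o-dbl (suc i) a = trans (1-[1-x] _) (o-dbl i a)

Σ<s-even : ∀ i → Σ< s (dbl i) ≡ 0ℤ
Σ<s-even zero    = refl
Σ<s-even (suc i) rewrite Σ<s-even i = trans (cong (-ᶻ s (dbl i) +ᶻ_) (+ᶻ-identityʳ _)) (neg+0 _)

Σ<s-odd : ∀ i → Σ< s (suc (dbl i)) ≡ 1ℤ
Σ<s-odd i rewrite Σ<s-even i =
  trans (+ᶻ-identityʳ _) (trans (cong s (sym (ℕₚ.+-identityʳ (dbl i)))) (s-dbl i 0))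

-- The indicator of `k ≤ a`. As the weight of `D k` it suppresses the beads at which truncated
-- subtraction would give a wrong target.
ge : ℕ → ℕ → ℤ
ge zero    a       = 1ℤ
ge (suc k) zero    = 0ℤ
ge (suc k) (suc a) = ge k a

ge-yes : ∀ {k a} → k ≤ a → ge k a ≡ 1ℤ
ge-yes z≤n     = refl
ge-yes (s≤s p) = ge-yes p

ge-no : ∀ {k a} → a < k → ge k a ≡ 0ℤ
ge-no {suc k} {zero}  p       = refl
ge-no {suc k} {suc a} (s≤s p) = ge-no p

-- P k multiplies by the power sum p_k, D k is its adjoint, X m is a mode of the vertex operator.
X P D : ℕ → ∀ {N} → Vect N → Vect N
X m = act s (_+_ m)
P k = act (λ _ → 1ℤ) (_+_ k)
D k = act (ge k) (_∸ k)

-- With an odd number of beads, a bead at position a adds a cell of residue a mod 2 when it moves.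
F₁ : ∀ {N} → Vect N → Vect N
F₁ = act o suc

-- Commutators

oneBody-weight : ∀ k c τ {N} (g : Fun N) as →
                 oneBody (λ a → k *ᶻ c a) τ g as ≡ k *ᶻ oneBody c τ g as
oneBody-weight k c τ g []       = sym (*ᶻ-zeroʳ k)
oneBody-weight k c τ g (a ∷ as)
  rewrite oneBody-weight k c τ (λ r → g (a ∷ r)) as | *ᶻ-assoc k (c a) (g (τ a ∷ as)) =
  sym (*ᶻ-distribˡ-+ k _ _)

act-weight : ∀ k c τ {N} (φ : Vect N) g →
             app (act (λ a → k *ᶻ c a) τ φ) g ≡ k *ᶻ app (act c τ φ) g
act-weight k c τ φ g = trans (app-cong φ (oneBody-weight k c τ g)) (app-* φ k _)

act-lin : ∀ c₁ τ₁ c₂ τ₂ c₃ τ₃ →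
  (∀ a (h : ℕ → ℤ) → c₁ a *ᶻ h (τ₁ a) ≡ c₂ a *ᶻ h (τ₂ a) +ᶻ c₃ a *ᶻ h (τ₃ a)) →
  ∀ {N} (φ : Vect N) g →
  app (act c₁ τ₁ φ) g ≡ app (act c₂ τ₂ φ) g +ᶻ app (act c₃ τ₃ φ) g
act-lin c₁ τ₁ c₂ τ₂ c₃ τ₃ H φ g =
  trans (app-cong φ (oneBody-lin c₁ τ₁ c₂ τ₂ c₃ τ₃ H g)) (app-+ φ _ _)

-2ᶻ : ℤ
-2ᶻ = ℤ.-[1+ 1 ]

opaque
  unfolding _+ᶻ_ _*ᶻ_ -ᶻ_
  ring-XP : ∀ s x → 1ℤ *ᶻ ((-ᶻ s) *ᶻ x) ≡ s *ᶻ (1ℤ *ᶻ x) +ᶻ (-2ᶻ *ᶻ s) *ᶻ x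
  ring-XP = solve-∀
  ring-F₁P : ∀ o x → 1ℤ *ᶻ ((1ℤ +ᶻ -ᶻ o) *ᶻ x) ≡ o *ᶻ (1ℤ *ᶻ x) +ᶻ (1ℤ +ᶻ -ᶻ ((+ 2) *ᶻ o)) *ᶻ x
  ring-F₁P = solve-∀
  ring-F₁X : ∀ o s x → s *ᶻ ((1ℤ +ᶻ -ᶻ o) *ᶻ x) ≡ o *ᶻ ((-ᶻ s) *ᶻ x) +ᶻ s *ᶻ x
  ring-F₁X = solve-∀
  ring-PP : ∀ x → 1ℤ *ᶻ (1ℤ *ᶻ x) ≡ 1ℤ *ᶻ (1ℤ *ᶻ x) +ᶻ 0ℤ *ᶻ x
  ring-PP = solve-∀

s-odd : ∀ i a → s (suc (dbl i) + a) ≡ -ᶻ s a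
s-odd i a = cong -ᶻ_ (s-dbl i a)

o-odd : ∀ i a → o (suc (dbl i) + a) ≡ 1ℤ +ᶻ -ᶻ o a
o-odd i a = cong (λ x → 1ℤ +ᶻ -ᶻ x) (o-dbl i a)

+-exch : ∀ m n k → m + (n + k) ≡ n + (m + k)
+-exch m n k = trans (sym (ℕₚ.+-assoc m n k)) (trans (cong (_+ k) (ℕₚ.+-comm m n)) (ℕₚ.+-assoc n m k))

-- An odd shift reverses the sign `s`, so the two orders of the moves on a bead have opposite
-- weights and their difference is twice a mode.
X-P : ∀ m i {N} (φ : Vect N) g → app (X m (P (suc (dbl i)) φ)) g ≡
      app (P (suc (dbl i)) (X m φ)) g +ᶻ -2ᶻ *ᶻ app (X (suc (dbl i) + m) φ) g
X-P m i φ g =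
  trans (act-comm s (_+_ m) _ (_+_ k) (λ a → -2ᶻ *ᶻ s a) (_+_ (k + m)) H φ g)
        (cong (app (P k (X m φ)) g +ᶻ_) (act-weight -2ᶻ s _ φ g))
  where
  k : ℕ
  k = suc (dbl i)
  H : ∀ a (h : ℕ → ℤ) → 1ℤ *ᶻ (s (k + a) *ᶻ h (m + (k + a)))
        ≡ s a *ᶻ (1ℤ *ᶻ h (k + (m + a))) +ᶻ (-2ᶻ *ᶻ s a) *ᶻ h (k + m + a)
  H a h rewrite s-odd i a | +-exch m k a | ℕₚ.+-assoc (dbl i) m a = ring-XP (s a) _

-- An odd shift replaces o by 1 - o, and the difference 1 - 2o is the sign `s`.
F₁-P : ∀ i {N} (φ : Vect N) g → app (F₁ (P (suc (dbl i)) φ)) g ≡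
       app (P (suc (dbl i)) (F₁ φ)) g +ᶻ app (X (dbl (suc i)) φ) g
F₁-P i φ g = act-comm o suc _ (_+_ (suc (dbl i))) s (_+_ (dbl (suc i))) H φ g
  where
  H : ∀ a (h : ℕ → ℤ) → 1ℤ *ᶻ (o (suc (dbl i) + a) *ᶻ h (suc (suc (dbl i) + a)))
        ≡ o a *ᶻ (1ℤ *ᶻ h (suc (dbl i) + suc a)) +ᶻ s a *ᶻ h (dbl (suc i) + a)
  H a h rewrite o-odd i a | ℕₚ.+-suc (dbl i) a | s≡1-2o a = ring-F₁P (o a) _

-- Both o and s are reversed by the odd shift; the commutator weight is s(1 - o) + so = s.
F₁-X : ∀ i {N} (φ : Vect N) g → app (F₁ (X (suc (dbl i)) φ)) g ≡
       app (X (suc (dbl i)) (F₁ φ)) g +ᶻ app (X (dbl (suc i)) φ) g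
F₁-X i φ g = act-comm o suc s (_+_ (suc (dbl i))) s (_+_ (dbl (suc i))) H φ g
  where
  H : ∀ a (h : ℕ → ℤ) → s a *ᶻ (o (suc (dbl i) + a) *ᶻ h (suc (suc (dbl i) + a)))
        ≡ o a *ᶻ ((-ᶻ s a) *ᶻ h (suc (dbl i) + suc a)) +ᶻ s a *ᶻ h (dbl (suc i) + a)
  H a h rewrite o-odd i a | ℕₚ.+-suc (dbl i) a = ring-F₁X (o a) (s a) _

oneBody-0 : ∀ τ {N} (g : Fun N) as → oneBody (λ _ → 0ℤ) τ g as ≡ 0ℤ
oneBody-0 τ g []       = refl
oneBody-0 τ g (a ∷ as) rewrite oneBody-0 τ (λ r → g (a ∷ r)) as =
  trans (+ᶻ-identityʳ _) (*ᶻ-zeroˡ _)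

P-P : ∀ k l {N} (φ : Vect N) g → app (P k (P l φ)) g ≡ app (P l (P k φ)) g
P-P k l φ g =
  trans (act-comm _ (_+_ k) _ (_+_ l) (λ _ → 0ℤ) (λ a → l + (k + a)) H φ g)
  (trans (cong (app (P l (P k φ)) g +ᶻ_)
          (trans (app-cong φ (λ as → trans (oneBody-0 _ g as) (sym (*ᶻ-zeroˡ 0ℤ))))
                 (trans (app-* φ 0ℤ (λ _ → 0ℤ)) (*ᶻ-zeroˡ _))))
         (+ᶻ-identityʳ _))
  where
  H : ∀ a (h : ℕ → ℤ) → 1ℤ *ᶻ (1ℤ *ᶻ h (k + (l + a)))
        ≡ 1ℤ *ᶻ (1ℤ *ᶻ h (l + (k + a))) +ᶻ 0ℤ *ᶻ h (l + (k + a))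
  H a h rewrite +-exch k l a = ring-PP _

-- The top one of an odd number of beads is at an even position and has weight zero; every other
-- bead moves onto its upper neighbour.
F₁-vac : ∀ K → F₁ (vac {suc (dbl K)}) ≈ 𝟘
F₁-vac K = act-occupied o suc C
  where
  C : ∀ a → a < suc (dbl K) → o a ≡ 0ℤ ⊎ (suc a ≢ a × suc a < suc (dbl K))
  C a (s≤s p) with ℕₚ.m≤n⇒m<n∨m≡n p
  ... | inj₁ q    = inj₂ ((λ ()) , s≤s q)
  ... | inj₂ refl = inj₁ (trans (cong o (sym (ℕₚ.+-identityʳ (dbl K)))) (o-dbl K 0))

D-vac : ∀ k {N} → D (suc k) (vac {N}) ≈ 𝟘
D-vac k {N} = act-occupied _ _ C
  where
  C : ∀ a → a < N → ge (suc k) a ≡ 0ℤ ⊎ (a ∸ suc k ≢ a × a ∸ suc k < N)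
  C zero    p = inj₁ refl
  C (suc a) p = inj₂ (ℕₚ.<⇒≢ (s≤s (ℕₚ.m∸n≤m a k)) , ℕₚ.≤-<-trans (ℕₚ.m∸n≤m (suc a) (suc k)) p)

-- The commutator of `D k` and `X m` at a bead in `a`: the weight for raising before lowering, minus
-- the weight for the other order.
DXweight : ℕ → ℕ → ℕ → ℤ
DXweight k m a = s a *ᶻ ge k (m + a) +ᶻ -ᶻ (ge k a *ᶻ s (a ∸ k))

opaque
  unfolding _+ᶻ_ _*ᶻ_ -ᶻ_
  ring-DX₁ : ∀ s t x → s *ᶻ (1ℤ *ᶻ x) ≡ 1ℤ *ᶻ (t *ᶻ x) +ᶻ (s *ᶻ 1ℤ +ᶻ -ᶻ (1ℤ *ᶻ t)) *ᶻ x
  ring-DX₁ = solve-∀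
  ring-DX₂ : ∀ s t g x y → s *ᶻ (g *ᶻ x) ≡ 0ℤ *ᶻ (t *ᶻ y) +ᶻ (s *ᶻ g +ᶻ -ᶻ (0ℤ *ᶻ t)) *ᶻ x
  ring-DX₂ = solve-∀
  ring-DX₃ : ∀ s t → s *ᶻ 0ℤ +ᶻ -ᶻ (0ℤ *ᶻ t) ≡ 0ℤ
  ring-DX₃ = solve-∀
  ring-DX₄ : ∀ s → s *ᶻ 1ℤ +ᶻ -ᶻ (1ℤ *ᶻ s) ≡ 0ℤ
  ring-DX₄ = solve-∀
  ring-DX₅ : ∀ s x w → w *ᶻ x ≡ ((+ 2) *ᶻ s) *ᶻ x +ᶻ (w +ᶻ -ᶻ ((+ 2) *ᶻ s)) *ᶻ x
  ring-DX₅ = solve-∀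
  ring-DX₆ : ∀ s → (s *ᶻ 1ℤ +ᶻ -ᶻ (1ℤ *ᶻ (-ᶻ s))) +ᶻ -ᶻ ((+ 2) *ᶻ s) ≡ 0ℤ
  ring-DX₆ = solve-∀
  ring-DX₇ : ∀ s → s *ᶻ 1ℤ ≡ s
  ring-DX₇ = solve-∀

-- D k annihilates the vacuum, so only the commutator of D k and X m survives.
D-X-vac : ∀ k m {N} → D (suc k) (X m (vac {N})) ≈ act (DXweight (suc k) m) (λ a → m + a ∸ suc k) vac
D-X-vac k m {N} g A = trans (act-comm (ge (suc k)) (_∸ suc k) s (_+_ m) _ _ H vac g)
  (trans (cong (_+ᶻ app (act (DXweight (suc k) m) (λ a → m + a ∸ suc k) vac) g)
               (act-cong s (_+_ m) {φ = D (suc k) vac} {ψ = 𝟘} (D-vac k {N}) g A))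
         (+ᶻ-identityˡ _))
  where
  H : ∀ a (h : ℕ → ℤ) → s a *ᶻ (ge (suc k) (m + a) *ᶻ h (m + a ∸ suc k))
        ≡ ge (suc k) a *ᶻ (s (a ∸ suc k) *ᶻ h (m + (a ∸ suc k)))
          +ᶻ DXweight (suc k) m a *ᶻ h (m + a ∸ suc k)
  H a h with suc k ≤? a
  ... | yes p rewrite ge-yes p | ge-yes (ℕₚ.≤-trans p (ℕₚ.m≤n+m a m)) | ℕₚ.+-∸-assoc m p =
        ring-DX₁ (s a) _ _
  ... | no ¬p rewrite ge-no (ℕₚ.≰⇒> ¬p) = ring-DX₂ _ _ _ _ _

-- The net displacement is downwards, so a bead of the vacuum that can move at all lands on another
-- one.
D-X-above : ∀ k m {N} → m < suc k → D (suc k) (X m (vac {N})) ≈ 𝟘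
D-X-above k m {N} m<k g A = trans (D-X-vac k m g A) (act-occupied _ _ C g A)
  where
  C : ∀ a → a < N → DXweight (suc k) m a ≡ 0ℤ ⊎ (m + a ∸ suc k ≢ a × m + a ∸ suc k < N)
  C a a<N with suc k ≤? m + a
  ... | no ¬p = inj₁ (trans (cong₂ (λ x y → s a *ᶻ x +ᶻ -ᶻ (y *ᶻ s (a ∸ suc k)))
                      (ge-no (ℕₚ.≰⇒> ¬p)) (ge-no (ℕₚ.≤-<-trans (ℕₚ.m≤n+m a m) (ℕₚ.≰⇒> ¬p))))
                     (ring-DX₃ (s a) _))
  ... | yes p = inj₂ (ℕₚ.<⇒≢ lt , ℕₚ.<-trans lt a<N)
    where
    lt : m + a ∸ suc k < a
    lt = ℕₚ.≤-trans (ℕₚ.≤-reflexive (sym (ℕₚ.+-∸-assoc 1 p)))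
           (ℕₚ.≤-trans (ℕₚ.∸-monoˡ-≤ (suc k) (ℕₚ.+-monoˡ-≤ a m<k))
                       (ℕₚ.≤-reflexive (ℕₚ.m+n∸m≡n (suc k) a)))

∸-cancel : ∀ k j a → k + j + a ∸ k ≡ j + a
∸-cancel k j a = trans (cong (_∸ k) (ℕₚ.+-assoc k j a)) (ℕₚ.m+n∸m≡n k (j + a))

-- A bead below `k` cannot be lowered first, so its commutator weight does not cancel. The bound on
-- `k + suc j` ensures that its upward displacement still ends on an occupied site.
shift-below : ∀ k j {N a} → k + suc j ≤ N → a < k →
              k + suc j + a ∸ k ≢ a × k + suc j + a ∸ k < N
shift-below k j {N} {a} le a<k rewrite ∸-cancel k (suc j) a =
  (λ e → ℕₚ.<⇒≢ (s≤s (ℕₚ.m≤n+m a j)) (sym e)) ,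
  ℕₚ.<-≤-trans (ℕₚ.+-monoʳ-< (suc j) a<k) (ℕₚ.≤-trans (ℕₚ.≤-reflexive (ℕₚ.+-comm (suc j) k)) le)

ge-far : ∀ k j a → ge k (k + j + a) ≡ 1ℤ
ge-far k j a = ge-yes (ℕₚ.≤-trans (ℕₚ.m≤m+n k j) (ℕₚ.m≤m+n (k + j) a))

s-∸-even : ∀ i a → dbl i ≤ a → s (a ∸ dbl i) ≡ s a
s-∸-even i a p = trans (sym (s-dbl i (a ∸ dbl i))) (cong s (ℕₚ.m+[n∸m]≡n p))

s-∸-odd : ∀ i a → suc (dbl i) ≤ a → s (a ∸ suc (dbl i)) ≡ -ᶻ s a
s-∸-odd i a p = trans (sym (neg-involutive _))
  (cong -ᶻ_ (trans (sym (s-odd i (a ∸ suc (dbl i)))) (cong s (ℕₚ.m+[n∸m]≡n p))))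

-- An even lowering preserves `s`: the two orders cancel on beads from `k` upwards, and the
-- remaining beads collide by `shift-below`.
D-X-even : ∀ i j {N} → dbl (suc i) + suc j ≤ N → D (dbl (suc i)) (X (dbl (suc i) + suc j) (vac {N})) ≈ 𝟘
D-X-even i j {N} le g A = trans (D-X-vac _ _ g A) (act-occupied _ _ C g A)
  where
  k : ℕ
  k = dbl (suc i)
  C : ∀ a → a < N → DXweight k (k + suc j) a ≡ 0ℤ ⊎ (k + suc j + a ∸ k ≢ a × k + suc j + a ∸ k < N)
  C a a<N with k ≤? a
  ... | no ¬p = inj₂ (shift-below k j le (ℕₚ.≰⇒> ¬p))
  ... | yes p = inj₁ (trans
          (cong₂ (λ x y → s a *ᶻ x +ᶻ -ᶻ y) (ge-far k (suc j) a) (cong₂ _*ᶻ_ (ge-yes p) (s-∸-even (suc i) a p)))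
          (ring-DX₄ (s a)))

-- An odd lowering reverses `s`, so the two orders add up to twice a mode on beads from `k` upwards.
-- After subtracting that mode everywhere, the remainder `w′` lives below `k`, where beads collide.
D-X-odd : ∀ i j {N} → suc (dbl i) + suc j ≤ N →
          D (suc (dbl i)) (X (suc (dbl i) + suc j) (vac {N})) ≈ (+ 2) ⊙ X (suc j) vac
D-X-odd i j {N} le g A = trans (D-X-vac _ _ g A)
  (trans (act-lin w τ (λ a → (+ 2) *ᶻ s a) (_+_ (suc j)) w′ τ H vac g)
  (trans (cong₂ _+ᶻ_ (act-weight (+ 2) s _ vac g) (act-occupied w′ τ C g A))
         (+ᶻ-identityʳ _)))
  where
  k : ℕ
  k = suc (dbl i)
  w w′ : ℕ → ℤ
  w a = DXweight k (k + suc j) a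
  w′ a = w a +ᶻ -ᶻ ((+ 2) *ᶻ s a)
  τ : ℕ → ℕ
  τ a = k + suc j + a ∸ k
  H : ∀ a (h : ℕ → ℤ) → w a *ᶻ h (τ a) ≡ ((+ 2) *ᶻ s a) *ᶻ h (suc j + a) +ᶻ w′ a *ᶻ h (τ a)
  H a h = trans (ring-DX₅ (s a) (h (τ a)) (w a))
                (cong (λ x → ((+ 2) *ᶻ s a) *ᶻ h x +ᶻ w′ a *ᶻ h (τ a)) (∸-cancel k (suc j) a))
  C : ∀ a → a < N → w′ a ≡ 0ℤ ⊎ (τ a ≢ a × τ a < N)
  C a a<N with k ≤? a
  ... | no ¬p = inj₂ (shift-below k j le (ℕₚ.≰⇒> ¬p))
  ... | yes p = inj₁ (trans
          (cong₂ (λ x y → (s a *ᶻ x +ᶻ -ᶻ y) +ᶻ -ᶻ ((+ 2) *ᶻ s a)) (ge-far k (suc j) a)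
                 (cong₂ _*ᶻ_ (ge-yes p) (s-∸-odd i a p)))
          (ring-DX₆ (s a)))

Σ<-shift : ∀ k n → Σ< (λ a → ge k a *ᶻ s (a ∸ k)) (k + n) ≡ Σ< s n
Σ<-shift k zero rewrite ℕₚ.+-identityʳ k = zeros k ℕₚ.≤-refl
  where
  zeros : ∀ n → n ≤ k → Σ< (λ a → ge k a *ᶻ s (a ∸ k)) n ≡ 0ℤ
  zeros zero    p = refl
  zeros (suc n) p rewrite zeros n (ℕₚ.<⇒≤ p) | ge-no p = trans (+ᶻ-identityʳ _) (*ᶻ-zeroˡ _)
Σ<-shift k (suc n) rewrite ℕₚ.+-suc k n | Σ<-shift k n | ge-yes (ℕₚ.m≤m+n k n) | ℕₚ.m+n∸m≡n k n =
  cong (_+ᶻ Σ< s n) (*ᶻ-identityˡ _)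

-- The net displacement is zero, so the commutator acts by the sum of its weights. Its negative half
-- starts at site `suc k` and therefore sees only `n` signs.
D-X-diagonal : ∀ k n {N} → N ≡ suc k + n → ∀ (g : Fun N) → Alt g →
  app (D (suc k) (X (suc k) vac)) g ≡ (Σ< s N +ᶻ -ᶻ Σ< s n) *ᶻ g (δ N)
D-X-diagonal k n refl g A = trans (D-X-vac k (suc k) g A)
  (trans (oneBody-diagonal (DXweight (suc k) (suc k)) _ (suc k + n) (λ a _ → ℕₚ.m+n∸m≡n (suc k) a) g)
         (cong (_*ᶻ g (δ (suc k + n))) total))
  where
  total : Σ< (DXweight (suc k) (suc k)) (suc k + n) ≡ Σ< s (suc k + n) +ᶻ -ᶻ Σ< s n
  total = trans (Σ<-+ _ _ (suc k + n)) (cong₂ _+ᶻ_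
    (Σ<-cong (suc k + n) (λ a _ → trans (cong (s a *ᶻ_) (ge-yes (ℕₚ.m≤m+n (suc k) a))) (ring-DX₇ (s a))))
    (trans (Σ<-neg _ (suc k + n)) (cong -ᶻ_ (Σ<-shift (suc k) n))))

-- The Sugawara operator

Σ<-front : ∀ c n → Σ< c (suc n) ≡ c 0 +ᶻ Σ< (λ k → c (suc k)) n
Σ<-front c zero    = refl
Σ<-front c (suc n) = trans (cong (c (suc n) +ᶻ_) (Σ<-front c n)) (+ᶻ-exch _ _ _)

Σ<-zero : ∀ {c} n → (∀ k → k < n → c k ≡ 0ℤ) → Σ< c n ≡ 0ℤ
Σ<-zero zero    e = refl
Σ<-zero (suc n) e = trans (cong₂ _+ᶻ_ (e n ℕₚ.≤-refl) (Σ<-zero n (λ k p → e k (ℕₚ.m<n⇒m<1+n p)))) (+ᶻ-identityʳ 0ℤ)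

opaque
  unfolding _+ᶻ_ _*ᶻ_ -ᶻ_
  ring-flip : ∀ f a b → a ≡ -ᶻ b → (0ℤ +ᶻ b) +ᶻ -ᶻ f ≡ -ᶻ ((f +ᶻ a) +ᶻ -ᶻ 0ℤ)
  ring-flip f a b refl = lem f b
    where
    lem : ∀ f b → (0ℤ +ᶻ b) +ᶻ -ᶻ f ≡ -ᶻ ((f +ᶻ -ᶻ b) +ᶻ -ᶻ 0ℤ)
    lem = solve-∀
  ring-pair : ∀ x a y → (x +ᶻ a) +ᶻ -ᶻ y ≡ 0ℤ → x +ᶻ -ᶻ y ≡ -ᶻ a
  ring-pair x a y e = trans (lem x a y) (trans (cong (λ z → z +ᶻ -ᶻ a) e) (+ᶻ-identityˡ _))
    where
    lem : ∀ x a y → x +ᶻ -ᶻ y ≡ ((x +ᶻ a) +ᶻ -ᶻ y) +ᶻ -ᶻ a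
    lem = solve-∀
  pos-+ : ∀ m n → + (m + n) ≡ + m +ᶻ + n
  pos-+ = ℤₚ.pos-+
  ring-suc : ∀ n x → x +ᶻ (+ n) *ᶻ x ≡ (+ suc n) *ᶻ x
  ring-suc n x = sym (ℤₚ.suc-* (+ n) x)

-- `I a b` is the sum of `A` over the antidiagonal through (a, b): `S a b` covers the smaller first
-- coordinates, and antisymmetry turns the larger ones into -`S b a`. It depends only on a + b.
module Transfer (A : ℕ → ℕ → ℤ) (anti : ∀ u w → A u w ≡ -ᶻ A w u) where
  S : ℕ → ℕ → ℤ
  S zero    b = 0ℤ
  S (suc a) b = A a (suc b) +ᶻ S a (suc b)

  I : ℕ → ℕ → ℤ
  I a b = (S a b +ᶻ A a b) +ᶻ -ᶻ S b a

  opaque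
    unfolding _+ᶻ_ -ᶻ_
    ring-step : ∀ p q r t → ((p +ᶻ q) +ᶻ r) +ᶻ -ᶻ t ≡ (q +ᶻ p) +ᶻ -ᶻ (-ᶻ r +ᶻ t)
    ring-step = solve-∀

  I-step : ∀ a b → I (suc a) b ≡ I a (suc b)
  I-step a b = trans (ring-step _ _ _ _)
    (cong (λ z → (S a (suc b) +ᶻ A a (suc b)) +ᶻ -ᶻ (z +ᶻ S b (suc a))) (sym (anti b (suc a))))

  I-shift : ∀ a b → I a b ≡ I 0 (a + b)
  I-shift zero    b = refl
  I-shift (suc a) b = trans (I-step a b) (trans (I-shift a (suc b)) (cong (I 0) (ℕₚ.+-suc a b)))

  -- Reversing the antidiagonal negates the sum, while `I-shift` says that the sum does not change.
  I≡0 : ∀ a b → I a b ≡ 0ℤ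
  I≡0 a b = trans (I-shift a b) (self-neg⇒0 _ (trans (ring-flip _ _ _ (anti (a + b) 0))
    (cong -ᶻ_ (trans (I-shift (a + b) 0) (cong (I 0) (ℕₚ.+-identityʳ (a + b)))))))

  S-Σ< : ∀ M a b → a ≤ M → Σ< (λ k → ge (suc k) a *ᶻ A (a ∸ suc k) (suc k + b)) M ≡ S a b
  S-Σ< M zero b p = Σ<-zero M (λ k _ → *ᶻ-zeroˡ _)
  S-Σ< (suc M) (suc a) b (s≤s p) = trans (Σ<-front _ M) (cong₂ _+ᶻ_ (*ᶻ-identityˡ _)
    (trans (Σ<-cong M (λ k _ → cong (λ z → ge (suc k) a *ᶻ A (a ∸ suc k) z) (sym (ℕₚ.+-suc (suc k) b))))
           (S-Σ< M a (suc b) p)))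

  transfer : ∀ M a b → a ≤ M → b ≤ M →
    Σ< (λ k → ge (suc k) a *ᶻ A (a ∸ suc k) (suc k + b)
           +ᶻ ge (suc k) b *ᶻ A (suc k + a) (b ∸ suc k)) M ≡ -ᶻ A a b
  transfer M a b p q = trans (Σ<-+ _ _ M) (trans
    (cong₂ _+ᶻ_ (S-Σ< M a b p) (trans
       (Σ<-cong M (λ k _ → trans (cong (ge (suc k) b *ᶻ_) (anti (suc k + a) (b ∸ suc k))) (sym (neg-*ʳ _ _))))
       (trans (Σ<-neg _ M) (cong -ᶻ_ (S-Σ< M b a q)))))
    (ring-pair _ _ _ (I≡0 a b)))

P̂ D̂ : ℕ → ∀ {N} → Fun N → Fun N
P̂ k = oneBody (λ _ → 1ℤ) (_+_ k)
D̂ k = oneBody (ge k) (_∸ k)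

opaque
  unfolding _+ᶻ_ _*ᶻ_ -ᶻ_
  ring-cross : ∀ g x p y d → g *ᶻ (1ℤ *ᶻ x +ᶻ p) +ᶻ (y +ᶻ d) ≡ (g *ᶻ x +ᶻ y) +ᶻ (g *ᶻ p +ᶻ d)
  ring-cross = solve-∀
  ring-cross′ : ∀ n x → -ᶻ x +ᶻ -ᶻ (n *ᶻ x) ≡ -ᶻ (x +ᶻ n *ᶻ x)
  ring-cross′ = solve-∀
  ring-sug : ∀ g x p d e → (g *ᶻ (1ℤ *ᶻ x) +ᶻ g *ᶻ p) +ᶻ (1ℤ *ᶻ d +ᶻ e) ≡ (g *ᶻ x +ᶻ (g *ᶻ p +ᶻ d)) +ᶻ e
  ring-sug = solve-∀
  ring-sug′ : ∀ a n w x → (a *ᶻ x +ᶻ -ᶻ (n *ᶻ x)) +ᶻ w *ᶻ x ≡ ((a +ᶻ -ᶻ n) +ᶻ w) *ᶻ x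
  ring-sug′ = solve-∀
  ring-deg : ∀ c κ m a n w x y →
    c *ᶻ ((κ +ᶻ ((m +ᶻ a +ᶻ -ᶻ n) +ᶻ w)) *ᶻ x) +ᶻ ((κ +ᶻ (a +ᶻ -ᶻ n)) +ᶻ m +ᶻ w) *ᶻ y
    ≡ (κ +ᶻ m +ᶻ ((a +ᶻ -ᶻ n) +ᶻ w)) *ᶻ (c *ᶻ x +ᶻ y)
  ring-deg = solve-∀

-- These are the moves that pass `k` units from the distinguished bead to another one or back.
-- Summed over all `k`, each pair leaves minus the value at the unmoved configuration.
cross : ∀ {N} {H : ℕ → Fun N} → Swap H → ∀ M a (as : Vec ℕ N) → a ≤ M → Allᵥ (_≤ M) as →
  Σ< (λ k → ge (suc k) a *ᶻ P̂ (suc k) (H (a ∸ suc k)) as +ᶻ D̂ (suc k) (H (suc k + a)) as) M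
  ≡ -ᶻ ((+ N) *ᶻ H a as)
cross {zero} {H} sw M a [] p q =
  trans (Σ<-zero M (λ k _ → trans (+ᶻ-identityʳ _) (*ᶻ-zeroʳ _))) (sym (trans (cong -ᶻ_ (*ᶻ-zeroˡ _)) neg-0))
cross {suc N} {H} (swap-cons s t) M a (b ∷ bs) p (q ∷ qs) =
  trans (Σ<-cong M (λ k _ → ring-cross _ _ _ _ _))
  (trans (Σ<-+ _ _ M)
  (trans (cong₂ _+ᶻ_ (Transfer.transfer (λ u w → H u (w ∷ bs)) (λ u w → s u w bs) M a b p q)
                     (cross (t b) M a bs p qs))
  (trans (ring-cross′ (+ N) _) (cong -ᶻ_ (ring-suc N _)))))

-- Total displacement from the vacuum positions; for the beads of a partition this is its number of
-- cells.
weight : ∀ {N} → Vec ℕ N → ℤ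
weight []             = 0ℤ
weight {suc N} (a ∷ as) = (+ a +ᶻ -ᶻ (+ N)) +ᶻ weight as

Σ<-ge : ∀ M a x → a ≤ M → Σ< (λ k → ge (suc k) a *ᶻ x) M ≡ (+ a) *ᶻ x
Σ<-ge M zero x p = trans (Σ<-zero M (λ k _ → *ᶻ-zeroˡ _)) (sym (*ᶻ-zeroˡ _))
Σ<-ge (suc M) (suc a) x (s≤s p) = trans (Σ<-front _ M)
  (trans (cong₂ _+ᶻ_ (*ᶻ-identityˡ _) (Σ<-ge M a x p)) (ring-suc a x))

-- A pair of beads contributes −g as: its transfers run over all positions with the same sum except the given one,
-- and the complete sum vanishes by antisymmetry.
sugawara : ∀ {N} {g : Fun N} → Alt g → ∀ M as → Allᵥ (_≤ M) as →
           Σ< (λ k → D̂ (suc k) (P̂ (suc k) g) as) M ≡ weight as *ᶻ g as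
sugawara {zero} A M [] qs = trans (Σ<-zero M (λ _ _ → refl)) (sym (*ᶻ-zeroˡ _))
sugawara {suc N} {g} A M (a ∷ as) (q ∷ qs) =
  trans (Σ<-cong M (λ k _ → trans (oneBody² (λ _ → 1ℤ) (_+_ (suc k)) (ge (suc k)) (_∸ suc k) g a as)
          (trans (cong (λ z → (z +ᶻ ge (suc k) a *ᶻ P̂ (suc k) (λ r → g ((a ∸ suc k) ∷ r)) as)
                              +ᶻ (1ℤ *ᶻ D̂ (suc k) (λ r → g (suc k + a ∷ r)) as
                                  +ᶻ D̂ (suc k) (P̂ (suc k) (λ r → g (a ∷ r))) as)) (back k))
                 (ring-sug _ _ _ _ _))))
  (trans (Σ<-+ _ _ M)
  (trans (cong₂ _+ᶻ_ (trans (Σ<-+ _ _ M)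
                       (cong₂ _+ᶻ_ (Σ<-ge M a (g (a ∷ as)) q) (cross (alt⇒swap A) M a as q qs)))
                     (sugawara (alt-tail A a) M as qs))
         (ring-sug′ _ _ _ _)))
  where
  -- A bead in `a` that is lowered and raised again returns for each of the `a` admissible values of
  -- `k`. Together with -1 for each of its `N` pairs this gives its share a - N of the weight.
  back : ∀ k → ge (suc k) a *ᶻ (1ℤ *ᶻ g (suc k + (a ∸ suc k) ∷ as)) ≡ ge (suc k) a *ᶻ (1ℤ *ᶻ g (a ∷ as))
  back k with suc k ≤? a
  ... | yes p rewrite ℕₚ.m+[n∸m]≡n p = refl
  ... | no ¬p rewrite ge-no (ℕₚ.≰⇒> ¬p) = trans (*ᶻ-zeroˡ _) (sym (*ᶻ-zeroˡ _))

-- Raising one bead by `m` raises the weight by `m`; `κ` holds the contribution of the beads already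
-- passed.
oneBody-weighted : ∀ c m {N} κ (g : Fun N) as →
  oneBody c (_+_ m) (λ r → (κ +ᶻ weight r) *ᶻ g r) as
  ≡ (κ +ᶻ + m +ᶻ weight as) *ᶻ oneBody c (_+_ m) g as
oneBody-weighted c m κ g [] = sym (*ᶻ-zeroʳ _)
oneBody-weighted c m {suc N} κ g (a ∷ as) = trans
  (cong₂ (λ x y → c a *ᶻ ((κ +ᶻ ((x +ᶻ -ᶻ (+ N)) +ᶻ weight as)) *ᶻ g (m + a ∷ as)) +ᶻ y)
    (pos-+ m a)
    (trans (oneBody-cong c (_+_ m) (λ r → cong (_*ᶻ g (a ∷ r)) (sym (+ᶻ-assoc κ _ (weight r)))) as)
           (oneBody-weighted c m (κ +ᶻ (+ a +ᶻ -ᶻ (+ N))) (λ r → g (a ∷ r)) as)))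
  (ring-deg _ _ _ _ _ _ _ _)

weight-δ : ∀ N → weight (δ N) ≡ 0ℤ
weight-δ zero    = refl
weight-δ (suc N) rewrite weight-δ N = trans (+ᶻ-identityʳ _) (+ᶻ-inverseʳ _)

oneBody-cong-All : ∀ (Q : ℕ → Set) c τ {N} {g h : Fun N} → (∀ as → Allᵥ Q as → g as ≡ h as) →
  ∀ as → Allᵥ Q as → Allᵥ (λ a → Q (τ a)) as → oneBody c τ g as ≡ oneBody c τ h as
oneBody-cong-All Q c τ e [] _ _ = refl
oneBody-cong-All Q c τ e (a ∷ as) (q ∷ qs) (r ∷ rs) =
  cong₂ (λ x y → c a *ᶻ x +ᶻ y) (e _ (r ∷ qs))
        (oneBody-cong-All Q c τ (λ as qs → e (a ∷ as) (q ∷ qs)) as qs rs)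

δ-All : ∀ {Q : ℕ → Set} N → (∀ a → a < N → Q a) → Allᵥ Q (δ N)
δ-All zero    q = []
δ-All (suc N) q = q N ℕₚ.≤-refl ∷ δ-All N (λ a p → q a (ℕₚ.m<n⇒m<1+n p))

app-Σ< : ∀ {N} (φ : Vect N) (G : ℕ → Fun N) n →
         app φ (λ as → Σ< (λ k → G k as) n) ≡ Σ< (λ k → app φ (G k)) n
app-Σ< φ G zero    = trans (app-cong φ (λ _ → sym (*ᶻ-zeroˡ 0ℤ))) (trans (app-* φ 0ℤ (λ _ → 0ℤ)) (*ᶻ-zeroˡ _))
app-Σ< φ G (suc n) = trans (app-+ φ _ _) (cong (app φ (G n) +ᶻ_) (app-Σ< φ G n))

-- The vector has weight `m` and its beads lie at or below m + N, so the sum of `P k` after `D k`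
-- over this range multiplies it by `m`.
sugawara-X : ∀ m {N} (g : Fun N) → Alt g →
  (+ m) *ᶻ app (X m vac) g ≡ Σ< (λ k → app (P (suc k) (D (suc k) (X m vac))) g) (m + N)
sugawara-X m {N} g A = sym (trans (sym (app-Σ< (X m vac) (λ k → D̂ (suc k) (P̂ (suc k) g)) (m + N)))
  (trans (oneBody-cong-All (_≤ m + N) s (_+_ m)
            (λ as q → trans (sugawara A (m + N) as q) (cong (_*ᶻ g as) (sym (+ᶻ-identityˡ _))))
            (δ N) (δ-All N (λ a p → ℕₚ.≤-trans (ℕₚ.<⇒≤ p) (ℕₚ.m≤n+m N m)))
                  (δ-All N (λ a p → ℕₚ.+-monoʳ-≤ m (ℕₚ.<⇒≤ p))))
  (trans (oneBody-weighted s m 0ℤ g (δ N))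
         (cong (_*ᶻ app (X m vac) g) (trans (cong₂ _+ᶻ_ (+ᶻ-identityˡ _) (weight-δ N)) (+ᶻ-identityʳ _))))))

-- Newton relations on the vacuum

Σ<-above : ∀ (F : ℕ → ℤ) n t → (∀ k → n ≤ k → F k ≡ 0ℤ) → Σ< F (n + t) ≡ Σ< F n
Σ<-above F n zero    e rewrite ℕₚ.+-identityʳ n = refl
Σ<-above F n (suc t) e rewrite ℕₚ.+-suc n t | e (n + t) (ℕₚ.m≤m+n n t) =
  trans (+ᶻ-identityˡ _) (Σ<-above F n t e)

Σ<-pairs : ∀ (F : ℕ → ℤ) r → Σ< F (dbl r) ≡ Σ< (λ i → F (suc (dbl i)) +ᶻ F (dbl i)) r
Σ<-pairs F zero    = refl
Σ<-pairs F (suc r) = trans (sym (+ᶻ-assoc _ _ _)) (cong (F (suc (dbl r)) +ᶻ F (dbl r) +ᶻ_) (Σ<-pairs F r))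

oneBody-P-alt : ∀ k {N} {g : Fun N} → Alt g → Alt (P̂ k g)
oneBody-P-alt k = oneBody-alt (λ _ → 1ℤ) (_+_ k)

opaque
  unfolding _+ᶻ_ _*ᶻ_ -ᶻ_
  0-0 : 0ℤ +ᶻ -ᶻ 0ℤ ≡ 0ℤ
  0-0 = refl
  1-1 : 1ℤ +ᶻ -ᶻ 1ℤ ≡ 0ℤ
  1-1 = refl

-- The signs of an odd number of sites sum to 1 and those of an even number to 0. Since `N` is odd,
-- removing an odd number of sites leaves the difference 1, and removing an even number leaves 0.
D-X-diagonal-odd : ∀ r t {N} → N ≡ suc (dbl (r + t)) → D (suc (dbl r)) (X (suc (dbl r)) (vac {N})) ≈ vac
D-X-diagonal-odd r t refl g A =
  trans (D-X-diagonal (dbl r) (dbl t) (cong suc (dbl-+ r t)) g A)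
  (trans (cong (_*ᶻ g (δ _)) (trans (cong₂ (λ x y → x +ᶻ -ᶻ y) (Σ<s-odd (r + t)) (Σ<s-even t)) 1-0)) (*ᶻ-identityˡ _))

D-X-diagonal-even : ∀ r t {N} → N ≡ suc (dbl (suc r + t)) → D (dbl (suc r)) (X (dbl (suc r)) (vac {N})) ≈ 𝟘
D-X-diagonal-even r t refl g A =
  trans (D-X-diagonal (suc (dbl r)) (suc (dbl t))
           (trans (cong suc (dbl-+ (suc r) t)) (sym (ℕₚ.+-suc (dbl (suc r)) (dbl t)))) g A)
  (trans (cong (_*ᶻ g (δ _)) (trans (cong₂ (λ x y → x +ᶻ -ᶻ y) (Σ<s-odd (suc r + t)) (Σ<s-odd t)) 1-1)) (*ᶻ-zeroˡ _))

module Newton (K : ℕ) where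
  N : ℕ
  N = suc (dbl K)

  term : ℕ → ℕ → Fun N → ℤ
  term i m g = (+ 2) *ᶻ app (P (suc (dbl i)) (X m (vac {N}))) g

  dbl-mono : ∀ {i j} → i ≤ j → dbl i ≤ dbl j
  dbl-mono {j = j} z≤n = z≤n
  dbl-mono (s≤s p) = s≤s (s≤s (dbl-mono p))

  -- In the Sugawara sum the terms with even index or index above m vanish, odd indices below m give
  -- twice a lower mode, and the index m itself gives back the vacuum.
  newton-odd : ∀ r → r ≤ K → ∀ (g : Fun N) → Alt g →
    (+ suc (dbl r)) *ᶻ app (X (suc (dbl r)) vac) g
    ≡ app (P (suc (dbl r)) vac) g +ᶻ Σ< (λ i → term i (dbl (r ∸ i)) g) r
  newton-odd r r≤K g A = trans (sugawara-X m g A)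
    (trans (Σ<-above F m N above)
    (cong₂ _+ᶻ_ (D-X-diagonal-odd r (K ∸ r) (cong (λ x → suc (dbl x)) (sym (ℕₚ.m+[n∸m]≡n r≤K))) _ (oneBody-P-alt _ A))
                (trans (Σ<-pairs F r) (Σ<-cong r pair))))
    where
    m : ℕ
    m = suc (dbl r)
    F : ℕ → ℤ
    F k = app (P (suc k) (D (suc k) (X m vac))) g
    above : ∀ k → m ≤ k → F k ≡ 0ℤ
    above k p = D-X-above k m (s≤s p) _ (oneBody-P-alt _ A)
    pair : ∀ i → i < r → F (suc (dbl i)) +ᶻ F (dbl i) ≡ term i (dbl (r ∸ i)) g
    pair i i<r with r ∸ suc i | ℕₚ.m+[n∸m]≡n i<r
    ... | t | refl = trans (cong₂ _+ᶻ_ even odd) (+ᶻ-identityˡ _)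
      where
      m-ev : suc (dbl (suc i + t)) ≡ dbl (suc i) + suc (dbl t)
      m-ev = trans (cong suc (dbl-+ (suc i) t)) (sym (ℕₚ.+-suc (dbl (suc i)) (dbl t)))
      m-od : suc (dbl (suc i + t)) ≡ suc (dbl i) + suc (suc (dbl t))
      m-od = trans m-ev (cong suc (sym (ℕₚ.+-suc (dbl i) (suc (dbl t)))))
      le : suc (dbl (suc i + t)) ≤ N
      le = s≤s (dbl-mono r≤K)
      even : F (suc (dbl i)) ≡ 0ℤ
      even = trans (cong (λ x → app (P (dbl (suc i)) (D (dbl (suc i)) (X x vac))) g) m-ev)
                 (D-X-even i (dbl t) (subst (_≤ N) m-ev le) _ (oneBody-P-alt _ A))
      odd : F (dbl i) ≡ term i (dbl (suc i + t ∸ i)) g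
      odd = trans (cong (λ x → app (P (suc (dbl i)) (D (suc (dbl i)) (X x vac))) g) m-od)
          (trans (D-X-odd i (suc (dbl t)) (subst (_≤ N) m-od le) _ (oneBody-P-alt _ A))
                 (cong (λ x → term i (dbl x) g)
                   (sym (trans (cong (_∸ i) (sym (ℕₚ.+-suc i t))) (ℕₚ.m+n∸m≡n i (suc t))))))

  newton-even : ∀ r → suc r ≤ K → ∀ (g : Fun N) → Alt g →
    (+ dbl (suc r)) *ᶻ app (X (dbl (suc r)) vac) g
    ≡ Σ< (λ i → term i (suc (dbl (r ∸ i))) g) (suc r)
  newton-even r r<K g A = trans (sugawara-X m g A)
    (trans (Σ<-above F m N above)
    (trans (Σ<-pairs F (suc r)) (Σ<-cong (suc r) pair)))
    where
    m : ℕ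
    m = dbl (suc r)
    F : ℕ → ℤ
    F k = app (P (suc k) (D (suc k) (X m vac))) g
    above : ∀ k → m ≤ k → F k ≡ 0ℤ
    above k p = D-X-above k m (s≤s p) _ (oneBody-P-alt _ A)
    pair : ∀ i → i < suc r → F (suc (dbl i)) +ᶻ F (dbl i) ≡ term i (suc (dbl (r ∸ i))) g
    pair i (s≤s i≤r) with r ∸ i | ℕₚ.m+[n∸m]≡n i≤r
    ... | t | refl = trans (cong₂ _+ᶻ_ (even t refl) odd) (+ᶻ-identityˡ _)
      where
      m-od : dbl (suc i + t) ≡ suc (dbl i) + suc (dbl t)
      m-od = trans (dbl-+ (suc i) t) (cong suc (sym (ℕₚ.+-suc (dbl i) (dbl t))))
      le : dbl (suc i + t) ≤ N
      le = ℕₚ.≤-trans (dbl-mono r<K) (ℕₚ.n≤1+n _)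
      -- For `u` zero the even index equals m, and the diagonal computation replaces the collision
      -- argument.
      even : ∀ u → u ≡ t → F (suc (dbl i)) ≡ 0ℤ
      even zero refl = trans (cong (λ x → app (P (dbl (suc i)) (D (dbl (suc i)) (X (dbl (suc x)) vac))) g) (ℕₚ.+-identityʳ i))
        (D-X-diagonal-even i (K ∸ suc i)
          (cong (λ x → suc (dbl x)) (sym (ℕₚ.m+[n∸m]≡n (subst (λ x → suc x ≤ K) (ℕₚ.+-identityʳ i) r<K))))
          _ (oneBody-P-alt _ A))
      even (suc u) refl =
        trans (cong (λ x → app (P (dbl (suc i)) (D (dbl (suc i)) (X x vac))) g) (dbl-+ (suc i) (suc u)))
              (D-X-even i (suc (dbl u)) (subst (_≤ N) (dbl-+ (suc i) (suc u)) le) _ (oneBody-P-alt _ A))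
      odd : F (dbl i) ≡ term i (suc (dbl t)) g
      odd = trans (cong (λ x → app (P (suc (dbl i)) (D (suc (dbl i)) (X x vac))) g) m-od)
                 (D-X-odd i (dbl t) (subst (_≤ N) m-od le) _ (oneBody-P-alt _ A))

-- The lattice L

pow2 : ℕ → ℤ
pow2 zero    = 1ℤ
pow2 (suc n) = (+ 2) *ᶻ pow2 n

pow2-+ : ∀ m n → pow2 (m + n) ≡ pow2 m *ᶻ pow2 n
pow2-+ zero    n = sym (*ᶻ-identityˡ _)
pow2-+ (suc m) n rewrite pow2-+ m n = sym (*ᶻ-assoc _ _ _)

-- Localization at 2 is expressed without fractions: membership of an odd multiple implies
-- membership of the vector.
odd : ℤ → ℤ
odd t = 1ℤ +ᶻ (+ 2) *ᶻ t

-- `O r` and `E r` are the modes of index 2r + 1 and 2r + 2. With these powers of two the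
-- commutators with `Y i` are -2 `E (r + i)` and -`O (suc (r + i))`.
Y O E : ℕ → ∀ {N} → Vect N → Vect N
Y i φ = pow2 i ⊙ P (suc (dbl i)) φ
O r φ = pow2 r ⊙ X (suc (dbl r)) φ
E r φ = pow2 r ⊙ X (dbl (suc r)) φ

-- The ℤ₍₂₎-form of ℚ[y₀, y₁, …] applied to the vacuum, graded by size.
data L {N : ℕ} : ℕ → Vect N → Set where
  L-vac  : L 0 vac
  L-zero : ∀ {d} → L d 𝟘
  L-+    : ∀ {d φ ψ} → L d φ → L d ψ → L d (φ ⊕ ψ)
  L-⊙    : ∀ {d φ} k → L d φ → L d (k ⊙ φ)
  L-odd  : ∀ {d φ} t → L d (odd t ⊙ φ) → L d φ
  L-resp : ∀ {d φ ψ} → φ ≈ ψ → L d φ → L d ψ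
  L-Y    : ∀ {d φ} i → L d φ → L (suc (dbl i) + d) (Y i φ)

opaque
  unfolding _+ᶻ_ _*ᶻ_ -ᶻ_
  ring-OY : ∀ p q x y → p *ᶻ (q *ᶻ (x +ᶻ -2ᶻ *ᶻ y)) ≡ q *ᶻ (p *ᶻ x) +ᶻ -2ᶻ *ᶻ ((p *ᶻ q) *ᶻ y)
  ring-OY = solve-∀
  ring-EY : ∀ p q x y → p *ᶻ (q *ᶻ (x +ᶻ -2ᶻ *ᶻ y)) ≡ q *ᶻ (p *ᶻ x) +ᶻ (-ᶻ 1ℤ) *ᶻ (((+ 2) *ᶻ (p *ᶻ q)) *ᶻ y)
  ring-EY = solve-∀

O-Y : ∀ r i {N} (φ : Vect N) → O r (Y i φ) ≈ Y i (O r φ) ⊕ -2ᶻ ⊙ E (r + i) φ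
O-Y r i φ g A = trans (cong (λ z → pow2 r *ᶻ (pow2 i *ᶻ z)) (X-P (suc (dbl r)) i φ g))
  (trans (ring-OY (pow2 r) (pow2 i) _ _)
         (cong₂ (λ p m → app (Y i (O r φ)) g +ᶻ -2ᶻ *ᶻ (p *ᶻ app (X m φ) g)) (sym (pow2-+ r i)) eq))
  where
  eq : suc (dbl i) + suc (dbl r) ≡ dbl (suc (r + i))
  eq rewrite ℕₚ.+-comm r i | dbl-+ i r = cong suc (ℕₚ.+-suc (dbl i) (dbl r))

-- The target mode needs one more power of two than r + i; the factor 2 of `X-P` supplies it.
E-Y : ∀ r i {N} (φ : Vect N) → E r (Y i φ) ≈ Y i (E r φ) ⊕ (-ᶻ 1ℤ) ⊙ O (suc (r + i)) φ
E-Y r i φ g A = trans (cong (λ z → pow2 r *ᶻ (pow2 i *ᶻ z)) (X-P (dbl (suc r)) i φ g))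
  (trans (ring-EY (pow2 r) (pow2 i) _ _)
         (cong₂ (λ p m → app (Y i (E r φ)) g +ᶻ (-ᶻ 1ℤ) *ᶻ (((+ 2) *ᶻ p) *ᶻ app (X m φ) g)) (sym (pow2-+ r i)) eq))
  where
  eq : suc (dbl i) + dbl (suc r) ≡ suc (dbl (suc (r + i)))
  eq rewrite ℕₚ.+-comm r i | dbl-+ i r =
    cong suc (trans (ℕₚ.+-suc (dbl i) (suc (dbl r))) (cong suc (ℕₚ.+-suc (dbl i) (dbl r))))

F₁-Y : ∀ i {N} (φ : Vect N) → F₁ (Y i φ) ≈ Y i (F₁ φ) ⊕ E i φ
F₁-Y i φ g A = trans (cong (pow2 i *ᶻ_) (F₁-P i φ g)) (*ᶻ-distribˡ-+ _ _ _)

-- The closure argument is run for `L` and for the enlargement of `L` used in even degrees, so its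
-- demands on the goal are abstracted. The bound `D` restricts the vacuum cases to degrees that are
-- already settled.
record Target {N : ℕ} (D : ℕ) (M : ℕ → Vect N → Set) : Set where
  field
    M-zero : ∀ {d} → M d 𝟘
    M-+    : ∀ {d φ ψ} → M d φ → M d ψ → M d (φ ⊕ ψ)
    M-⊙    : ∀ {d φ} k → M d φ → M d (k ⊙ φ)
    M-odd  : ∀ {d φ} t → M d (odd t ⊙ φ) → M d φ
    M-resp : ∀ {d φ ψ} → φ ≈ ψ → M d φ → M d ψ
    M-Y    : ∀ {d φ} i → suc (dbl i) + d ≤ D → M d φ → M (suc (dbl i) + d) (Y i φ)
    M-O    : ∀ r → suc (dbl r) ≤ D → M (suc (dbl r)) (O r vac)
    M-E    : ∀ r → dbl (suc r) ≤ D → M (dbl (suc r)) (E r vac)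

≈-sym : ∀ {N} {φ ψ : Vect N} → φ ≈ ψ → ψ ≈ φ
≈-sym e g A = sym (e g A)

module Closure (K D : ℕ) {M : ℕ → Vect (suc (dbl K)) → Set} (T : Target D M) where
  open Target T

  cast : ∀ {d d′ φ} → d ≡ d′ → M d φ → M d′ φ
  cast refl x = x

  linear-+ : ∀ c τ p {d} {φ ψ : Vect (suc (dbl K))} →
             M d (p ⊙ act c τ φ) → M d (p ⊙ act c τ ψ) → M d (p ⊙ act c τ (φ ⊕ ψ))
  linear-+ c τ p {d} {φ} {ψ} x y = M-resp {φ = p ⊙ act c τ φ ⊕ p ⊙ act c τ ψ}
    (λ g A → sym (*ᶻ-distribˡ-+ p _ _)) (M-+ x y)

  linear-⊙ : ∀ c τ p k {d} {φ : Vect (suc (dbl K))} →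
             M d (p ⊙ act c τ φ) → M d (p ⊙ act c τ (k ⊙ φ))
  linear-⊙ c τ p k {d} {φ} x = M-resp {φ = k ⊙ p ⊙ act c τ φ} (λ g A → *ᶻ-swap k p _) (M-⊙ k x)

  linear-odd : ∀ c τ p t {d} {φ : Vect (suc (dbl K))} →
               M d (p ⊙ act c τ (odd t ⊙ φ)) → M d (p ⊙ act c τ φ)
  linear-odd c τ p t {d} {φ} x = M-odd t (M-resp (λ g A → *ᶻ-swap p (odd t) _) x)

  linear-zero : ∀ c τ p {d} → M d (p ⊙ act c τ 𝟘)
  linear-zero c τ p = M-resp (λ g A → sym (*ᶻ-zeroʳ p)) M-zero

  linear-resp : ∀ c τ p {d} {φ ψ : Vect (suc (dbl K))} → φ ≈ ψ →
                M d (p ⊙ act c τ φ) → M d (p ⊙ act c τ ψ)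
  linear-resp c τ p e = M-resp (λ g A → cong (p *ᶻ_) (e _ (oneBody-alt c τ A)))

  -- Induction on the membership derivation moves the mode past each `Y i` until it meets the
  -- vacuum. The two families need each other because a commutator with `Y i` changes the parity of
  -- the index.
  close-O : ∀ {d φ} → L d φ → ∀ r → suc (dbl r) + d ≤ D → M (suc (dbl r) + d) (O r φ)
  close-E : ∀ {d φ} → L d φ → ∀ r → dbl (suc r) + d ≤ D → M (dbl (suc r) + d) (E r φ)
  close-O L-vac r le = cast (sym (ℕₚ.+-identityʳ _)) (M-O r (subst (_≤ D) (ℕₚ.+-identityʳ _) le))
  close-O L-zero r le = linear-zero s (_+_ (suc (dbl r))) (pow2 r)
  close-O (L-+ {φ = φ} {ψ} x y) r le = linear-+ s _ (pow2 r) {φ = φ} {ψ} (close-O x r le) (close-O y r le)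
  close-O (L-⊙ {φ = φ} k x) r le = linear-⊙ s _ (pow2 r) k {φ = φ} (close-O x r le)
  close-O (L-odd {φ = φ} t x) r le = linear-odd s _ (pow2 r) t {φ = φ} (close-O x r le)
  close-O (L-resp {φ = φ} {ψ} e x) r le = linear-resp s _ (pow2 r) {φ = φ} {ψ} e (close-O x r le)
  close-O (L-Y {d = d} {φ} i x) r le = M-resp (≈-sym {φ = O r (Y i φ)} {ψ = Y i (O r φ) ⊕ -2ᶻ ⊙ E (r + i) φ} (O-Y r i φ))
    (M-+ (cast eq₁ (M-Y i (subst (_≤ D) (sym eq₁) le)
                      (close-O x r (ℕₚ.≤-trans (ℕₚ.+-monoʳ-≤ (suc (dbl r)) (ℕₚ.m≤n+m d _)) le))))
         (M-⊙ -2ᶻ (cast eq₂ (close-E x (r + i) (subst (_≤ D) (sym eq₂) le)))))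
    where
    eq₁ : suc (dbl i) + (suc (dbl r) + d) ≡ suc (dbl r) + (suc (dbl i) + d)
    eq₁ = +-exch (suc (dbl i)) (suc (dbl r)) d
    eq₂ : dbl (suc (r + i)) + d ≡ suc (dbl r) + (suc (dbl i) + d)
    eq₂ rewrite dbl-+ r i = cong suc (trans (cong suc (ℕₚ.+-assoc (dbl r) (dbl i) d)) (sym (ℕₚ.+-suc (dbl r) (dbl i + d))))
  close-E L-vac r le = cast (sym (ℕₚ.+-identityʳ _)) (M-E r (subst (_≤ D) (ℕₚ.+-identityʳ _) le))
  close-E L-zero r le = linear-zero s (_+_ (dbl (suc r))) (pow2 r)
  close-E (L-+ {φ = φ} {ψ} x y) r le = linear-+ s _ (pow2 r) {φ = φ} {ψ} (close-E x r le) (close-E y r le)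
  close-E (L-⊙ {φ = φ} k x) r le = linear-⊙ s _ (pow2 r) k {φ = φ} (close-E x r le)
  close-E (L-odd {φ = φ} t x) r le = linear-odd s _ (pow2 r) t {φ = φ} (close-E x r le)
  close-E (L-resp {φ = φ} {ψ} e x) r le = linear-resp s _ (pow2 r) {φ = φ} {ψ} e (close-E x r le)
  close-E (L-Y {d = d} {φ} i x) r le = M-resp (≈-sym {φ = E r (Y i φ)} {ψ = Y i (E r φ) ⊕ (-ᶻ 1ℤ) ⊙ O (suc (r + i)) φ} (E-Y r i φ))
    (M-+ (cast eq₁ (M-Y i (subst (_≤ D) (sym eq₁) le)
                      (close-E x r (ℕₚ.≤-trans (ℕₚ.+-monoʳ-≤ (dbl (suc r)) (ℕₚ.m≤n+m d _)) le))))
         (M-⊙ (-ᶻ 1ℤ) (cast eq₂ (close-O x (suc (r + i)) (subst (_≤ D) (sym eq₂) le)))))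
    where
    eq₁ : suc (dbl i) + (dbl (suc r) + d) ≡ dbl (suc r) + (suc (dbl i) + d)
    eq₁ = +-exch (suc (dbl i)) (dbl (suc r)) d
    eq₂ : suc (dbl (suc (r + i))) + d ≡ dbl (suc r) + (suc (dbl i) + d)
    eq₂ rewrite dbl-+ r i = cong (λ z → suc (suc z))
      (trans (cong suc (ℕₚ.+-assoc (dbl r) (dbl i) d)) (sym (ℕₚ.+-suc (dbl r) (dbl i + d))))

  -- Since `F₁` kills the vacuum, only its commutators with the `Y i` contribute, and these are the
  -- operators `E i`.
  close-F₁ : ∀ {d φ} → L d φ → suc d ≤ D → M (suc d) (F₁ φ)
  close-F₁ L-vac le = M-resp (≈-sym {φ = F₁ vac} {ψ = 𝟘} (F₁-vac K)) M-zero
  close-F₁ L-zero le = M-resp (λ g A → refl) M-zero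
  close-F₁ (L-+ x y) le = M-resp (λ g A → refl) (M-+ (close-F₁ x le) (close-F₁ y le))
  close-F₁ (L-⊙ k x) le = M-resp (λ g A → refl) (M-⊙ k (close-F₁ x le))
  close-F₁ (L-odd t x) le = M-odd t (M-resp (λ g A → refl) (close-F₁ x le))
  close-F₁ (L-resp e x) le = M-resp (λ g A → e _ (oneBody-alt o suc A)) (close-F₁ x le)
  close-F₁ (L-Y {d = d} {φ} i x) le = M-resp (≈-sym {φ = F₁ (Y i φ)} {ψ = Y i (F₁ φ) ⊕ E i φ} (F₁-Y i φ))
    (M-+ (cast (ℕₚ.+-suc _ d) (M-Y i (subst (_≤ D) (sym (ℕₚ.+-suc _ d)) le)
            (close-F₁ x (ℕₚ.≤-trans (s≤s (ℕₚ.m≤n+m d _)) le))))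
         (close-E x i le))

-- Modes applied to the vacuum lie in the lattice.

Σv : ∀ {N} → (ℕ → Vect N) → ℕ → Vect N
Σv φ zero    = 𝟘
Σv φ (suc n) = φ n ⊕ Σv φ n

app-Σv : ∀ {N} (φ : ℕ → Vect N) n g → app (Σv φ n) g ≡ Σ< (λ i → app (φ i) g) n
app-Σv φ zero    g = refl
app-Σv φ (suc n) g = cong (app (φ n) g +ᶻ_) (app-Σv φ n g)

Σ<-* : ∀ k c n → Σ< (λ a → k *ᶻ c a) n ≡ k *ᶻ Σ< c n
Σ<-* k c zero    = sym (*ᶻ-zeroʳ k)
Σ<-* k c (suc n) rewrite Σ<-* k c n = sym (*ᶻ-distribˡ-+ k _ _)

opaque
  unfolding _+ᶻ_ _*ᶻ_ -ᶻ_
  odd-pos : ∀ n → + suc (dbl n) ≡ odd (+ n)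
  odd-pos zero    = refl
  odd-pos (suc n) = trans (cong (ℤ._+_ (+ 2)) (odd-pos n)) (lem (+ n))
    where
    lem : ∀ x → + 2 +ᶻ (1ℤ +ᶻ (+ 2) *ᶻ x) ≡ 1ℤ +ᶻ (+ 2) *ᶻ (1ℤ +ᶻ x)
    lem = solve-∀
  ring-M+ : ∀ e c e′ c′ x y u → (1ℤ +ᶻ (+ 2) *ᶻ e′) *ᶻ ((1ℤ +ᶻ (+ 2) *ᶻ e) *ᶻ x +ᶻ c *ᶻ u) +ᶻ (1ℤ +ᶻ (+ 2) *ᶻ e) *ᶻ ((1ℤ +ᶻ (+ 2) *ᶻ e′) *ᶻ y +ᶻ c′ *ᶻ u)
    ≡ (1ℤ +ᶻ (+ 2) *ᶻ (e +ᶻ e′ +ᶻ (+ 2) *ᶻ (e *ᶻ e′))) *ᶻ (x +ᶻ y) +ᶻ ((1ℤ +ᶻ (+ 2) *ᶻ e′) *ᶻ c +ᶻ (1ℤ +ᶻ (+ 2) *ᶻ e) *ᶻ c′) *ᶻ u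
  ring-M+ = solve-∀
  ring-M⊙ : ∀ k e c x u → k *ᶻ ((1ℤ +ᶻ (+ 2) *ᶻ e) *ᶻ x +ᶻ c *ᶻ u) ≡ (1ℤ +ᶻ (+ 2) *ᶻ e) *ᶻ (k *ᶻ x) +ᶻ (k *ᶻ c) *ᶻ u
  ring-M⊙ = solve-∀
  ring-Modd : ∀ t e c x u → (1ℤ +ᶻ (+ 2) *ᶻ e) *ᶻ ((1ℤ +ᶻ (+ 2) *ᶻ t) *ᶻ x) +ᶻ c *ᶻ u ≡ (1ℤ +ᶻ (+ 2) *ᶻ (e +ᶻ t +ᶻ (+ 2) *ᶻ (e *ᶻ t))) *ᶻ x +ᶻ c *ᶻ u
  ring-Modd = solve-∀
  ring-ML : ∀ x u → x ≡ (1ℤ +ᶻ (+ 2) *ᶻ 0ℤ) *ᶻ x +ᶻ 0ℤ *ᶻ u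
  ring-ML = solve-∀
  ring-Mu : ∀ u → 0ℤ ≡ (1ℤ +ᶻ (+ 2) *ᶻ 0ℤ) *ᶻ u +ᶻ (-ᶻ 1ℤ) *ᶻ u
  ring-Mu = solve-∀
  ring-solve : ∀ e c A B u → u ≡ A +ᶻ -2ᶻ *ᶻ B →
    (1ℤ +ᶻ (+ 2) *ᶻ e) *ᶻ A +ᶻ -2ᶻ *ᶻ ((1ℤ +ᶻ (+ 2) *ᶻ e) *ᶻ B +ᶻ c *ᶻ u) ≡ (1ℤ +ᶻ (+ 2) *ᶻ (e +ᶻ -ᶻ c)) *ᶻ u
  ring-solve e c A B u refl = lem e c A B
    where
    lem : ∀ e c A B → (1ℤ +ᶻ (+ 2) *ᶻ e) *ᶻ A +ᶻ -2ᶻ *ᶻ ((1ℤ +ᶻ (+ 2) *ᶻ e) *ᶻ B +ᶻ c *ᶻ (A +ᶻ -2ᶻ *ᶻ B)) ≡ (1ℤ +ᶻ (+ 2) *ᶻ (e +ᶻ -ᶻ c)) *ᶻ (A +ᶻ -2ᶻ *ᶻ B)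
    lem = solve-∀
  ring-oddterm : ∀ p q x → ((+ 2) *ᶻ (p *ᶻ q)) *ᶻ ((+ 2) *ᶻ x) ≡ (+ 4) *ᶻ (p *ᶻ (q *ᶻ x))
  ring-oddterm = solve-∀
  ring-eventerm : ∀ p q x → (p *ᶻ q) *ᶻ ((+ 2) *ᶻ x) ≡ (+ 2) *ᶻ (p *ᶻ (q *ᶻ x))
  ring-eventerm = solve-∀
  -- The two coefficients differ by one, so subtracting the equations leaves 2u = 2A - 4B, which can
  -- be halved over the integers.
  ring-halve : ∀ n A B u → (+ dbl (suc n)) *ᶻ u ≡ (+ 2) *ᶻ A → (+ suc (dbl n)) *ᶻ u ≡ u +ᶻ (+ 4) *ᶻ B →
               u ≡ A +ᶻ -2ᶻ *ᶻ B
  ring-halve n A B u p q = ℤₚ.*-cancelˡ-≡ (+ 2) u (A +ᶻ -2ᶻ *ᶻ B)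
    (trans (lem₁ (+ suc (dbl n)) u)
    (trans (cong₂ (λ x y → (x +ᶻ -ᶻ y) +ᶻ u) (trans (sym (lem₀ (+ suc (dbl n)) u)) p) q) (lem₂ A B u)))
    where
    lem₀ : ∀ m u → (1ℤ +ᶻ m) *ᶻ u ≡ u +ᶻ m *ᶻ u
    lem₀ = solve-∀
    lem₁ : ∀ m u → (+ 2) *ᶻ u ≡ ((u +ᶻ m *ᶻ u) +ᶻ -ᶻ (m *ᶻ u)) +ᶻ u
    lem₁ = solve-∀
    lem₂ : ∀ A B u → ((+ 2) *ᶻ A +ᶻ -ᶻ (u +ᶻ (+ 4) *ᶻ B)) +ᶻ u ≡ (+ 2) *ᶻ (A +ᶻ -2ᶻ *ᶻ B)
    lem₂ = solve-∀

L-Σv : ∀ {N d} {φ : ℕ → Vect N} n → (∀ i → i < n → L d (φ i)) → L d (Σv φ n)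
L-Σv zero    e = L-zero
L-Σv (suc n) e = L-+ (e n ℕₚ.≤-refl) (L-Σv n (λ i p → e i (ℕₚ.m<n⇒m<1+n p)))

L-cast : ∀ {N d d′} {φ : Vect N} → d ≡ d′ → L d φ → L d′ φ
L-cast refl x = x

module Vacuum (K : ℕ) where
  open Newton K using (N; newton-odd; newton-even; dbl-mono)

  relation-odd : ∀ r → r ≤ K →
    odd (+ r) ⊙ O r (vac {N}) ≈ Y r vac ⊕ (+ 4) ⊙ Σv (λ i → Y i (E (r ∸ suc i) vac)) r
  relation-odd r r≤K g A = trans (*ᶻ-swap _ (pow2 r) _)
    (trans (cong (pow2 r *ᶻ_) (trans (cong (_*ᶻ app (X (suc (dbl r)) vac) g) (sym (odd-pos r))) (newton-odd r r≤K g A)))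
    (trans (*ᶻ-distribˡ-+ (pow2 r) _ _)
    (cong (app (Y r vac) g +ᶻ_)
      (trans (sym (Σ<-* (pow2 r) _ r))
      (trans (Σ<-cong r term)
      (trans (Σ<-* (+ 4) _ r) (cong ((+ 4) *ᶻ_) (sym (app-Σv _ r g)))))))))
    where
    term : ∀ i → i < r → pow2 r *ᶻ ((+ 2) *ᶻ app (P (suc (dbl i)) (X (dbl (r ∸ i)) vac)) g)
                       ≡ (+ 4) *ᶻ app (Y i (E (r ∸ suc i) vac)) g
    term i i<r with r ∸ suc i | ℕₚ.m+[n∸m]≡n i<r
    ... | t | refl = trans
      (cong₂ (λ x m → x *ᶻ ((+ 2) *ᶻ app (P (suc (dbl i)) (X (dbl m) vac)) g))
             (cong ((+ 2) *ᶻ_) (pow2-+ i t))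
             (trans (cong (_∸ i) (sym (ℕₚ.+-suc i t))) (ℕₚ.m+n∸m≡n i (suc t))))
      (ring-oddterm (pow2 i) (pow2 t) _)

  relation-even : ∀ r → suc r ≤ K → ∀ (g : Fun N) → Alt g →
    (+ dbl (suc r)) *ᶻ app (E r vac) g ≡ (+ 2) *ᶻ app (Σv (λ i → Y i (O (r ∸ i) vac)) (suc r)) g
  relation-even r r<K g A = trans (*ᶻ-swap _ (pow2 r) _)
    (trans (cong (pow2 r *ᶻ_) (newton-even r r<K g A))
    (trans (sym (Σ<-* (pow2 r) _ (suc r)))
    (trans (Σ<-cong (suc r) term)
    (trans (Σ<-* (+ 2) _ (suc r)) (cong ((+ 2) *ᶻ_) (sym (app-Σv _ (suc r) g)))))))
    where
    term : ∀ i → i < suc r → pow2 r *ᶻ ((+ 2) *ᶻ app (P (suc (dbl i)) (X (suc (dbl (r ∸ i))) vac)) g)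
                           ≡ (+ 2) *ᶻ app (Y i (O (r ∸ i) vac)) g
    term i (s≤s i≤r) = trans
      (cong (λ x → x *ᶻ ((+ 2) *ᶻ app (P (suc (dbl i)) (X (suc (dbl (r ∸ i))) vac)) g))
            (trans (cong pow2 (sym (ℕₚ.m+[n∸m]≡n i≤r))) (pow2-+ i (r ∸ i))))
      (ring-eventerm (pow2 i) (pow2 (r ∸ i)) _)

  -- This is `relation-odd` under `F₁`. As `F₁` kills the vacuum, both `O r vac` and `Y r vac` are
  -- sent to `E r vac`.
  relation-odd′ : ∀ r → r ≤ K → ∀ (g : Fun N) → Alt g →
    (+ suc (dbl r)) *ᶻ app (E r vac) g
    ≡ app (E r vac) g +ᶻ (+ 4) *ᶻ app (Σv (λ i → F₁ (Y i (E (r ∸ suc i) vac))) r) g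
  relation-odd′ r r≤K g A =
    trans (cong₂ _*ᶻ_ (odd-pos r) (sym F₁-O))
    (trans (relation-odd r r≤K (oneBody o suc g) (oneBody-alt o suc A))
           (cong₂ (λ x y → x +ᶻ (+ 4) *ᶻ y) F₁-Yvac
             (trans (app-Σv (λ i → Y i (E (r ∸ suc i) vac)) r _) (sym (app-Σv (λ i → F₁ (Y i (E (r ∸ suc i) vac))) r g)))))
    where
    zero-F₁ : ∀ g → Alt g → app (F₁ (vac {N})) g ≡ 0ℤ
    zero-F₁ = F₁-vac K
    F₁-O : app (F₁ (O r vac)) g ≡ app (E r vac) g
    F₁-O = cong (pow2 r *ᶻ_) (trans (F₁-X r vac g)
      (trans (cong (_+ᶻ app (X (dbl (suc r)) vac) g) (zero-F₁ _ (oneBody-alt s _ A))) (+ᶻ-identityˡ _)))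
    F₁-Yvac : app (F₁ (Y r vac)) g ≡ app (E r vac) g
    F₁-Yvac = cong (pow2 r *ᶻ_) (trans (F₁-P r vac g)
      (trans (cong (_+ᶻ app (X (dbl (suc r)) vac) g) (zero-F₁ _ (oneBody-alt _ _ A))) (+ᶻ-identityˡ _)))

  relation-E : ∀ r → suc r ≤ K → E r (vac {N}) ≈
    Σv (λ i → Y i (O (r ∸ i) vac)) (suc r) ⊕ -2ᶻ ⊙ Σv (λ i → F₁ (Y i (E (r ∸ suc i) vac))) r
  relation-E r r<K g A =
    ring-halve r _ _ _ (relation-even r r<K g A) (relation-odd′ r (ℕₚ.<⇒≤ r<K) g A)

  record Base (D : ℕ) : Set where
    field
      base-O : ∀ r → suc (dbl r) ≤ D → L (suc (dbl r)) (O r (vac {N}))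
      base-E : ∀ r → dbl (suc r) ≤ D → L (dbl (suc r)) (E r (vac {N}))

  -- The lattice, enlarged in the top degree by ℤ₍₂₎ (E r vac): commuting operators to the vacuum
-- produces multiples of the vector whose membership in L is still in question.
  Ext : ℕ → ℕ → Vect N → Set
  Ext r d φ = (d < dbl (suc r) → L d φ) × ∃₂ λ e c → L d (odd e ⊙ φ ⊕ c ⊙ E r vac)

  L⇒Ext : ∀ r {d φ} → L d φ → Ext r d φ
  L⇒Ext r x = (λ _ → x) , 0ℤ , 0ℤ , L-resp (λ g A → ring-ML _ _) x

  dbl-cancel-≤ : ∀ {i j} → dbl i ≤ dbl j → i ≤ j
  dbl-cancel-≤ {zero}          p             = z≤n
  dbl-cancel-≤ {suc i} {suc j} (s≤s (s≤s p)) = s≤s (dbl-cancel-≤ p)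

  dbl-odd-≤ : ∀ {i j} → suc (dbl i) ≤ dbl j → suc i ≤ j
  dbl-odd-≤ {zero}  {suc j} p             = s≤s z≤n
  dbl-odd-≤ {suc i} {suc j} (s≤s (s≤s p)) = s≤s (dbl-odd-≤ p)

  ext-target : ∀ r → Base (suc (dbl r)) → Target (dbl (suc r)) (Ext r)
  ext-target r B = record
    { M-zero = L⇒Ext r L-zero
    ; M-+ = λ { (x , e , c , p) (y , e′ , c′ , q) → (λ lt → L-+ (x lt) (y lt)) , _ , _ ,
                L-resp (λ g A → ring-M+ e c e′ c′ _ _ _) (L-+ (L-⊙ (odd e′) p) (L-⊙ (odd e) q)) }
    ; M-⊙ = λ { k (x , e , c , p) → (λ lt → L-⊙ k (x lt)) , e , k *ᶻ c ,
                L-resp (λ g A → ring-M⊙ k e c _ _) (L-⊙ k p) }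
    ; M-odd = λ { t (x , e , c , p) → (λ lt → L-odd t (x lt)) , _ , c , L-resp (λ g A → ring-Modd t e c _ _) p }
    ; M-resp = λ { eq (x , e , c , p) → (λ lt → L-resp eq (x lt)) , e , c ,
                L-resp (λ g A → cong (λ z → odd e *ᶻ z +ᶻ c *ᶻ _) (eq g A)) p }
    -- `Y i` strictly raises the degree, so its argument is below the top degree, where the
    -- enlargement is `L` itself.
    ; M-Y = λ { i le (x , _) → L⇒Ext r (L-Y i (x (ℕₚ.≤-trans (s≤s (ℕₚ.m≤n+m _ (dbl i))) le))) }
    ; M-O = λ i le → L⇒Ext r (Base.base-O B i (s≤s (dbl-mono (ℕₚ.≤-pred (dbl-odd-≤ le)))))
    ; M-E = top }
    where
    top : ∀ i → dbl (suc i) ≤ dbl (suc r) → Ext r (dbl (suc i)) (E i vac)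
    top i le with ℕₚ.m≤n⇒m<n∨m≡n (dbl-cancel-≤ {suc i} {suc r} le)
    ... | inj₁ (s≤s i<r) = L⇒Ext r (Base.base-E B i (ℕₚ.m≤n⇒m≤1+n (dbl-mono i<r)))
    -- The vector in question enters the enlargement trivially: once itself minus once itself is
    -- zero.
    ... | inj₂ refl = (λ lt → ⊥-elim (ℕₚ.<-irrefl refl lt)) , 0ℤ , -ᶻ 1ℤ ,
                      L-resp (λ g A → ring-Mu _) L-zero

  ext-Σv : ∀ r {d} {φ : ℕ → Vect N} → Base (suc (dbl r)) → ∀ n → (∀ i → i < n → Ext r d (φ i)) → Ext r d (Σv φ n)
  ext-Σv r B zero    e = L⇒Ext r L-zero
  ext-Σv r B (suc n) e = Target.M-+ (ext-target r B) (e n ℕₚ.≤-refl) (ext-Σv r B n (λ i p → e i (ℕₚ.m<n⇒m<1+n p)))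

  -- In E = A - 2B the part A is in `L` by induction, but B consists of images under `F₁` and is
  -- only known up to a multiple of E. The factor 2 makes the resulting equation for E have an odd
  -- coefficient.
  step-E : ∀ r → suc r ≤ K → Base (suc (dbl r)) → L (dbl (suc r)) (E r (vac {N}))
  step-E r r<K B with ext-Σv r {φ = λ i → F₁ (Y i (E (r ∸ suc i) vac))} B r part
    where
    degree : ∀ i → i < r → suc (dbl i) + dbl (suc (r ∸ suc i)) ≡ suc (dbl r)
    degree i i<r = cong suc (trans (sym (dbl-+ i (suc (r ∸ suc i))))
                     (cong dbl (trans (ℕₚ.+-suc i _) (ℕₚ.m+[n∸m]≡n i<r))))
    part : ∀ i → i < r → Ext r (dbl (suc r)) (F₁ (Y i (E (r ∸ suc i) vac)))
    part i i<r = Closure.close-F₁ K (dbl (suc r)) (ext-target r B)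
      (L-cast (degree i i<r) (L-Y i (Base.base-E B (r ∸ suc i)
        (ℕₚ.≤-trans (ℕₚ.m≤n+m _ (suc (dbl i))) (ℕₚ.≤-reflexive (degree i i<r)))))) ℕₚ.≤-refl
  -- If (1 + 2e)B + cE lies in `L`, then so does (1 + 2e)A - 2((1 + 2e)B + cE) = (1 + 2(e - c))E.
  ... | _ , e , c , p = L-odd (e +ᶻ -ᶻ c)
    (L-resp (λ g A → ring-solve e c _ _ _ (relation-E r r<K g A))
            (L-+ (L-⊙ (odd e) (L-Σv (suc r) part)) (L-⊙ -2ᶻ p)))
    where
    degree : ∀ i → i < suc r → suc (dbl i) + suc (dbl (r ∸ i)) ≡ dbl (suc r)
    degree i (s≤s i≤r) = cong suc (trans (ℕₚ.+-suc (dbl i) _)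
                           (cong suc (trans (sym (dbl-+ i (r ∸ i))) (cong dbl (ℕₚ.m+[n∸m]≡n i≤r)))))
    part : ∀ i → i < suc r → L (dbl (suc r)) (Y i (O (r ∸ i) vac))
    part i i≤r = L-cast (degree i i≤r) (L-Y i (Base.base-O B (r ∸ i) (s≤s (dbl-mono (ℕₚ.m∸n≤m r i)))))

  step-O : ∀ r → r ≤ K → Base (dbl r) → L (suc (dbl r)) (O r (vac {N}))
  step-O r r≤K B = L-odd (+ r) (L-resp (≈-sym {φ = odd (+ r) ⊙ O r vac}
    {ψ = Y r vac ⊕ (+ 4) ⊙ Σv (λ i → Y i (E (r ∸ suc i) vac)) r} (relation-odd r r≤K))
    (L-+ (L-cast (ℕₚ.+-identityʳ _) (L-Y r L-vac)) (L-⊙ (+ 4) (L-Σv r part))))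
    where
    degree : ∀ i → i < r → i + suc (r ∸ suc i) ≡ r
    degree i i<r = trans (ℕₚ.+-suc i _) (ℕₚ.m+[n∸m]≡n i<r)
    part : ∀ i → i < r → L (suc (dbl r)) (Y i (E (r ∸ suc i) vac))
    part i i<r = L-cast (cong suc (trans (sym (dbl-+ i (suc (r ∸ suc i)))) (cong dbl (degree i i<r))))
      (L-Y i (Base.base-E B (r ∸ suc i)
        (dbl-mono (ℕₚ.≤-trans (ℕₚ.m≤n+m _ i) (ℕₚ.≤-reflexive (degree i i<r))))))

  base-even : ∀ r → r ≤ K → Base (dbl r)
  base-odd  : ∀ r → r ≤ K → Base (suc (dbl r))
  base-even zero r≤K = record { base-O = λ _ () ; base-E = λ _ () }
  base-even (suc r) r<K = record { base-O = λ i le → Base.base-O B i (s≤s (dbl-mono (ℕₚ.≤-pred (dbl-odd-≤ le)))) ; base-E = top }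
    where
    B : Base (suc (dbl r))
    B = base-odd r (ℕₚ.<⇒≤ r<K)
    top : ∀ i → dbl (suc i) ≤ dbl (suc r) → L (dbl (suc i)) (E i vac)
    top i le with ℕₚ.m≤n⇒m<n∨m≡n (dbl-cancel-≤ {suc i} {suc r} le)
    ... | inj₁ (s≤s i<r) = Base.base-E B i (ℕₚ.m≤n⇒m≤1+n (dbl-mono i<r))
    ... | inj₂ refl = step-E r r<K B
  base-odd r r≤K = record { base-O = top ; base-E = λ i le → Base.base-E B i (dbl-mono (dbl-odd-≤ (ℕₚ.≤-pred le))) }
    where
    B : Base (dbl r)
    B = base-even r r≤K
    top : ∀ i → suc (dbl i) ≤ suc (dbl r) → L (suc (dbl i)) (O i vac)
    top i (s≤s le) with ℕₚ.m≤n⇒m<n∨m≡n (dbl-cancel-≤ le)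
    ... | inj₁ i<r  = Base.base-O B i (ℕₚ.≤-trans (ℕₚ.n≤1+n _) (dbl-mono i<r))
    ... | inj₂ refl = step-O r r≤K B

  L-target : Target N L
  L-target = record
    { M-zero = L-zero ; M-+ = L-+ ; M-⊙ = L-⊙ ; M-odd = L-odd ; M-resp = L-resp
    ; M-Y = λ i _ x → L-Y i x
    ; M-O = Base.base-O (base-odd K ℕₚ.≤-refl)
    ; M-E = Base.base-E (base-odd K ℕₚ.≤-refl) }

  L-F₁ : ∀ {d φ} → L d φ → suc d ≤ N → L (suc d) (F₁ φ)
  L-F₁ = Closure.close-F₁ K N L-target

-- The pairing on the exterior algebra

eqᶻ : ℕ → ℕ → ℤ
eqᶻ zero    zero    = 1ℤ
eqᶻ zero    (suc b) = 0ℤ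
eqᶻ (suc a) zero    = 0ℤ
eqᶻ (suc a) (suc b) = eqᶻ a b

-- Left multiplication by the basis vector b in the exterior algebra.
wedge : ∀ {N} → ℕ → Fun N → Fun (suc N)
wedge {zero}  b h (a ∷ [])  = eqᶻ a b *ᶻ h []
wedge {suc N} b h (a ∷ as) = eqᶻ a b *ᶻ h as +ᶻ -ᶻ wedge b (λ r → h (a ∷ r)) as

-- The determinant of the Kronecker deltas between two configurations, expanded along the first bead
-- of `bs`: the inner product of the exterior power.
ker : ∀ {N} → Vec ℕ N → Fun N
ker []       _ = 1ℤ
ker (b ∷ bs)   = wedge b (ker bs)

opaque
  unfolding _+ᶻ_ _*ᶻ_ -ᶻ_
  ring-w+ : ∀ e x y u v → e *ᶻ (x +ᶻ y) +ᶻ -ᶻ (u +ᶻ v) ≡ (e *ᶻ x +ᶻ -ᶻ u) +ᶻ (e *ᶻ y +ᶻ -ᶻ v)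
  ring-w+ = solve-∀
  ring-w* : ∀ e k x u → e *ᶻ (k *ᶻ x) +ᶻ -ᶻ (k *ᶻ u) ≡ k *ᶻ (e *ᶻ x +ᶻ -ᶻ u)
  ring-w* = solve-∀
  ring-walt₀ : ∀ p q x y → p *ᶻ x +ᶻ -ᶻ (q *ᶻ y) ≡ -ᶻ (q *ᶻ y +ᶻ -ᶻ (p *ᶻ x))
  ring-walt₀ = solve-∀
  ring-walt : ∀ p q x y u → p *ᶻ x +ᶻ -ᶻ (q *ᶻ y +ᶻ -ᶻ (-ᶻ u)) ≡ -ᶻ (q *ᶻ y +ᶻ -ᶻ (p *ᶻ x +ᶻ -ᶻ u))
  ring-walt = solve-∀
  ring-wanti : ∀ p q x y u → p *ᶻ x +ᶻ -ᶻ (q *ᶻ y +ᶻ -ᶻ (-ᶻ u)) ≡ -ᶻ (q *ᶻ y +ᶻ -ᶻ (p *ᶻ x +ᶻ -ᶻ u))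
  ring-wanti = solve-∀
  ring-wanti₀ : ∀ p q p′ q′ h → p *ᶻ (q *ᶻ h) +ᶻ -ᶻ (p′ *ᶻ (q′ *ᶻ h)) ≡ -ᶻ (q′ *ᶻ (p′ *ᶻ h) +ᶻ -ᶻ (q *ᶻ (p *ᶻ h)))
  ring-wanti₀ = solve-∀
  ring-wD₀ : ∀ g e f h → g *ᶻ e ≡ f → g *ᶻ (e *ᶻ h) +ᶻ 0ℤ ≡ f *ᶻ h +ᶻ 0ℤ
  ring-wD₀ g e f h refl = lem g e h
    where
    lem : ∀ g e h → g *ᶻ (e *ᶻ h) +ᶻ 0ℤ ≡ (g *ᶻ e) *ᶻ h +ᶻ 0ℤ
    lem = solve-∀
  ring-wD : ∀ g e f x y e′ z u v → g *ᶻ e ≡ f →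
    g *ᶻ (e *ᶻ x +ᶻ -ᶻ y) +ᶻ (e′ *ᶻ z +ᶻ -ᶻ (u +ᶻ v)) ≡ (f *ᶻ x +ᶻ -ᶻ u) +ᶻ (e′ *ᶻ z +ᶻ -ᶻ (g *ᶻ y +ᶻ v))
  ring-wD g e f x y e′ z u v refl = lem g e x y e′ z u v
    where
    lem : ∀ g e x y e′ z u v → g *ᶻ (e *ᶻ x +ᶻ -ᶻ y) +ᶻ (e′ *ᶻ z +ᶻ -ᶻ (u +ᶻ v))
          ≡ ((g *ᶻ e) *ᶻ x +ᶻ -ᶻ u) +ᶻ (e′ *ᶻ z +ᶻ -ᶻ (g *ᶻ y +ᶻ v))
    lem = solve-∀

wedge-cong : ∀ {N} b {g h : Fun N} → (∀ as → g as ≡ h as) → ∀ as → wedge b g as ≡ wedge b h as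
wedge-cong {zero}  b e (a ∷ []) = cong (eqᶻ a b *ᶻ_) (e [])
wedge-cong {suc N} b e (a ∷ as) =
  cong₂ (λ x y → eqᶻ a b *ᶻ x +ᶻ -ᶻ y) (e as) (wedge-cong b (λ r → e (a ∷ r)) as)

wedge-+ : ∀ {N} b (g h : Fun N) as → wedge b (λ r → g r +ᶻ h r) as ≡ wedge b g as +ᶻ wedge b h as
wedge-+ {zero}  b g h (a ∷ []) = *ᶻ-distribˡ-+ _ _ _
wedge-+ {suc N} b g h (a ∷ as) rewrite wedge-+ b (λ r → g (a ∷ r)) (λ r → h (a ∷ r)) as = ring-w+ _ _ _ _ _

wedge-* : ∀ {N} b k (g : Fun N) as → wedge b (λ r → k *ᶻ g r) as ≡ k *ᶻ wedge b g as
wedge-* {zero}  b k g (a ∷ []) = *ᶻ-swap _ _ _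
wedge-* {suc N} b k g (a ∷ as) rewrite wedge-* b k (λ r → g (a ∷ r)) as = ring-w* _ _ _ _

wedge-neg : ∀ {N} b (g : Fun N) as → wedge b (λ r → -ᶻ g r) as ≡ -ᶻ wedge b g as
wedge-neg b g as = trans (wedge-cong b (λ r → sym (-1*ᶻ (g r))) as)
  (trans (wedge-* b (-ᶻ 1ℤ) g as) (-1*ᶻ _))

alt-neg : ∀ {N} {g : Fun N} → Alt g → Alt (λ as → -ᶻ g as)
alt-neg A = alt-resp (λ as → -1*ᶻ _) (alt-* (-ᶻ 1ℤ) A)

wedge-alt : ∀ {N} b {h : Fun N} → Alt h → Alt (wedge b h)
wedge-alt {zero} b A = alt-one
wedge-alt {suc zero} b {h} A = alt-cons (λ { a a′ [] → ring-walt₀ _ _ _ _ }) (λ _ → alt-one)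
wedge-alt {suc (suc N)} b {h} (alt-cons s t) = alt-cons
  (λ a a′ r → trans (cong (λ z → eqᶻ a b *ᶻ h (a′ ∷ r) +ᶻ -ᶻ (eqᶻ a′ b *ᶻ h (a ∷ r) +ᶻ -ᶻ z))
                          (trans (wedge-cong b (λ r → s a a′ r) r) (wedge-neg b (λ r → h (a′ ∷ a ∷ r)) r)))
                    (ring-walt _ _ _ _ _))
  (λ a → alt-+ (alt-* (eqᶻ a b) (alt-cons s t)) (alt-neg (wedge-alt b (t a))))

wedge-alt-param : ∀ {N M} b {H : Vec ℕ M → Fun N} → (∀ as → Alt (λ r → H r as)) → ∀ as → Alt (λ r → wedge b (H r) as)
wedge-alt-param {zero}  b A (a ∷ []) = alt-* (eqᶻ a b) (A [])
wedge-alt-param {suc N} b A (a ∷ as) =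
  alt-+ (alt-* (eqᶻ a b) (A as)) (alt-neg (wedge-alt-param b (λ as → A (a ∷ as)) as))

-- Gives the antisymmetry of `ker` in its first configuration, so that vectors may be substituted on
-- both sides of the pairing.
wedge-anti : ∀ {N} b b′ (h : Fun N) as → wedge b (wedge b′ h) as ≡ -ᶻ wedge b′ (wedge b h) as
wedge-anti {zero} b b′ h (a ∷ a′ ∷ []) = ring-wanti₀ (eqᶻ a b) (eqᶻ a′ b′) (eqᶻ a′ b) (eqᶻ a b′) (h [])
wedge-anti {suc N} b b′ h (a ∷ as)
  rewrite wedge-+ b (λ r → eqᶻ a b′ *ᶻ h r) (λ r → -ᶻ wedge b′ (λ r → h (a ∷ r)) r) as
        | wedge-+ b′ (λ r → eqᶻ a b *ᶻ h r) (λ r → -ᶻ wedge b (λ r → h (a ∷ r)) r) as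
        | wedge-* b (eqᶻ a b′) h as | wedge-* b′ (eqᶻ a b) h as
        | wedge-neg b (wedge b′ (λ r → h (a ∷ r))) as
        | wedge-neg b′ (wedge b (λ r → h (a ∷ r))) as
        | wedge-anti b b′ (λ r → h (a ∷ r)) as = ring-wanti _ _ _ _ _

ker-alt : ∀ {N} (bs : Vec ℕ N) → Alt (ker bs)
ker-alt []       = alt-nil
ker-alt (b ∷ bs) = wedge-alt b (ker-alt bs)

ker-alt′ : ∀ {N} (as : Vec ℕ N) → Alt (λ bs → ker bs as)
ker-alt′ {zero} as = alt-nil
ker-alt′ {suc zero} as = alt-one
ker-alt′ {suc (suc N)} as = alt-cons (λ b b′ r → wedge-anti b b′ (ker r) as)
  (λ b → wedge-alt-param b ker-alt′ as)

ge-eq : ∀ k a b → ge k a *ᶻ eqᶻ (a ∸ k) b ≡ eqᶻ a (k + b)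
ge-eq zero    a       b = *ᶻ-identityˡ _
ge-eq (suc k) zero    b = *ᶻ-zeroˡ _
ge-eq (suc k) (suc a) b = ge-eq k a b

-- A Leibniz rule: a bead lowered by `k` matches `b` exactly when it started at k + b, and otherwise
-- the operator passes to the remaining factor.
D̂-wedge : ∀ k {N} b (h : Fun N) as → D̂ k (wedge b h) as ≡ wedge (k + b) h as +ᶻ wedge b (D̂ k h) as
D̂-wedge k {zero} b h (a ∷ []) =
  trans (ring-wD₀ _ _ _ (h []) (ge-eq k a b)) (cong (eqᶻ a (k + b) *ᶻ h [] +ᶻ_) (sym (*ᶻ-zeroʳ _)))
D̂-wedge k {suc N} b h (a ∷ as) =
  trans (cong (ge k a *ᶻ wedge b h ((a ∸ k) ∷ as) +ᶻ_)
    (trans (oneBody-+ (ge k) (_∸ k) (λ r → eqᶻ a b *ᶻ h r) (λ r → -ᶻ wedge b (λ r → h (a ∷ r)) r) as)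
      (cong₂ _+ᶻ_ (oneBody-* (ge k) (_∸ k) (eqᶻ a b) h as)
        (trans (oneBody-cong (ge k) (_∸ k) (λ r → sym (-1*ᶻ _)) as)
        (trans (oneBody-* (ge k) (_∸ k) (-ᶻ 1ℤ) (wedge b (λ r → h (a ∷ r))) as)
        (trans (-1*ᶻ _) (cong -ᶻ_ (D̂-wedge k b (λ r → h (a ∷ r)) as))))))))
  (trans (ring-wD _ _ _ _ _ _ _ _ _ (ge-eq k a b))
    (cong (λ z → wedge (k + b) h (a ∷ as) +ᶻ (eqᶻ a b *ᶻ D̂ k h as +ᶻ -ᶻ z))
      (sym (trans (wedge-+ b (λ r → ge k a *ᶻ h ((a ∸ k) ∷ r)) (D̂ k (λ r → h (a ∷ r))) as)
                  (cong (_+ᶻ wedge b (D̂ k (λ r → h (a ∷ r))) as) (wedge-* b (ge k a) (λ r → h ((a ∸ k) ∷ r)) as))))))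

oneBody-wedge : ∀ c τ {N M} b (H : Vec ℕ M → Fun N) bs as →
  oneBody c τ (λ r → wedge b (H r) as) bs ≡ wedge b (λ as → oneBody c τ (λ r → H r as) bs) as
oneBody-wedge c τ {zero} b H bs (a ∷ []) = oneBody-* c τ (eqᶻ a b) (λ r → H r []) bs
oneBody-wedge c τ {suc N} b H bs (a ∷ as) =
  trans (oneBody-+ c τ (λ r → eqᶻ a b *ᶻ H r as) (λ r → -ᶻ wedge b (λ as → H r (a ∷ as)) as) bs)
  (cong₂ _+ᶻ_ (oneBody-* c τ (eqᶻ a b) (λ r → H r as) bs)
    (trans (oneBody-cong c τ (λ r → sym (-1*ᶻ _)) bs)
    (trans (oneBody-* c τ (-ᶻ 1ℤ) (λ r → wedge b (λ as → H r (a ∷ as)) as) bs)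
    (trans (-1*ᶻ _) (cong -ᶻ_ (oneBody-wedge c τ b (λ r as → H r (a ∷ as)) bs as))))))

ker-adjoint : ∀ k {N} (as bs : Vec ℕ N) → P̂ k (λ bs → ker bs as) bs ≡ D̂ k (ker bs) as
ker-adjoint k [] [] = refl
ker-adjoint k as (b ∷ bs) =
  trans (cong₂ _+ᶻ_ (*ᶻ-identityˡ _)
          (trans (oneBody-wedge (λ _ → 1ℤ) (_+_ k) b ker bs as)
                 (wedge-cong b (λ as → ker-adjoint k as bs) as)))
        (sym (D̂-wedge k b (ker bs) as))

app-oneBody : ∀ c τ {N M} (ψ : Vect N) (H : Vec ℕ N → Fun M) as →
  app ψ (λ b → oneBody c τ (H b) as) ≡ oneBody c τ (λ as → app ψ (λ b → H b as)) as
app-oneBody c τ ψ H [] = trans (app-cong ψ (λ _ → sym (*ᶻ-zeroˡ 0ℤ))) (trans (app-* ψ 0ℤ (λ _ → 0ℤ)) (*ᶻ-zeroˡ _))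
app-oneBody c τ ψ H (a ∷ as) = trans (app-+ ψ _ _)
  (cong₂ _+ᶻ_ (app-* ψ (c a) _) (app-oneBody c τ ψ (λ b r → H b (a ∷ r)) as))

app-alt : ∀ {N M} (ψ : Vect N) {H : Vec ℕ N → Fun M} → (∀ b → Alt (H b)) → Alt (λ as → app ψ (λ b → H b as))
app-alt {M = zero} ψ A = alt-nil
app-alt {M = suc zero} ψ A = alt-one
app-alt {M = suc (suc M)} ψ {H} A = alt-cons
  (λ a a′ r → trans (app-cong ψ (λ b → trans (swap (A b) a a′ r) (sym (-1*ᶻ _))))
                    (trans (app-* ψ (-ᶻ 1ℤ) _) (-1*ᶻ _)))
  (λ a → app-alt ψ (λ b → alt-tail (A b) a))
  where
  swap : ∀ {M} {g : Fun (suc (suc M))} → Alt g → ∀ a b r → g (a ∷ b ∷ r) ≡ -ᶻ g (b ∷ a ∷ r)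
  swap (alt-cons s t) = s

-- Adjoints on monomials

mon : List ℕ → ∀ {N} → Vect N
mon []       = vac
mon (i ∷ is) = Y i (mon is)

deg : List ℕ → ℕ
deg []       = 0
deg (i ∷ is) = suc (dbl i) + deg is

opaque
  unfolding _+ᶻ_ _*ᶻ_ -ᶻ_
  ring-loc₁ : ∀ x y z → 1ℤ *ᶻ (x *ᶻ y) ≡ 0ℤ *ᶻ (1ℤ *ᶻ z) +ᶻ (x +ᶻ -ᶻ 0ℤ) *ᶻ y
  ring-loc₁ = solve-∀
  ring-loc₂ : ∀ x c y → 1ℤ *ᶻ (x *ᶻ y) ≡ c *ᶻ (1ℤ *ᶻ y) +ᶻ (x +ᶻ -ᶻ c) *ᶻ y
  ring-loc₂ = solve-∀
  ring-loc₃ : ∀ p κ x y → p *ᶻ (κ *ᶻ x) +ᶻ p *ᶻ (0ℤ *ᶻ y) ≡ κ *ᶻ (p *ᶻ x)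
  ring-loc₃ = solve-∀

-- Commuting with `P k` replaces the weight by its difference over the distance `k`. The condition
-- `low` gives weight zero wherever the subtraction of `w` would be truncated.
P-comm : ∀ c u w k → (∀ a → u + a < w → c a ≡ 0ℤ) → ∀ {N} (φ : Vect N) g →
  app (act c (λ a → u + a ∸ w) (P k φ)) g ≡ app (P k (act c (λ a → u + a ∸ w) φ)) g
  +ᶻ app (act (λ a → c (k + a) +ᶻ -ᶻ c a) (λ a → k + u + a ∸ w) φ) g
P-comm c u w k low φ g = act-comm c _ _ (_+_ k) _ _ H φ g
  where
  eq : ∀ a → u + (k + a) ≡ k + u + a
  eq a = trans (+-exch u k a) (sym (ℕₚ.+-assoc k u a))
  H : ∀ a (h : ℕ → ℤ) → 1ℤ *ᶻ (c (k + a) *ᶻ h (u + (k + a) ∸ w))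
    ≡ c a *ᶻ (1ℤ *ᶻ h (k + (u + a ∸ w))) +ᶻ (c (k + a) +ᶻ -ᶻ c a) *ᶻ h (k + u + a ∸ w)
  H a h rewrite eq a with w ≤? u + a
  ... | yes p rewrite sym (ℕₚ.+-∸-assoc k p) | ℕₚ.+-assoc k u a = ring-loc₂ _ _ _
  ... | no ¬p rewrite low a (ℕₚ.≰⇒> ¬p) = ring-loc₁ _ _ _

Σ<-low : ∀ c k n → (∀ a → a < k → c a ≡ 0ℤ) → Σ< c (k + n) ≡ Σ< (λ a → c (k + a)) n
Σ<-low c k zero    e rewrite ℕₚ.+-identityʳ k = Σ<-zero k e
Σ<-low c k (suc n) e rewrite ℕₚ.+-suc k n = cong (c (k + n) +ᶻ_) (Σ<-low c k n e)

-- A low bead can only land on an occupied site, so only the diagonal part survives.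
local : ∀ is c u w M κ {N} → M + u + deg is ≤ N →
  (∀ a → M ≤ a → c a ≡ 0ℤ) → (∀ a → u + a < w → c a ≡ 0ℤ) →
  (u ≢ w × κ ≡ 0ℤ) ⊎ (u ≡ w × κ ≡ Σ< c N) →
  act c (λ a → u + a ∸ w) (mon is {N}) ≈ κ ⊙ mon is
local [] c u w M κ {N} le high low (inj₂ (refl , refl)) g A =
  oneBody-diagonal c _ N (λ a _ → ℕₚ.m+n∸m≡n u a) g
local [] c u w M κ {N} le high low (inj₁ (u≢w , refl)) g A =
  trans (act-occupied c _ C g A) (sym (*ᶻ-zeroˡ _))
  where
  C : ∀ a → a < N → c a ≡ 0ℤ ⊎ (u + a ∸ w ≢ a × u + a ∸ w < N)
  C a a<N with M ≤? a | w ≤? u + a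
  ... | yes p | _     = inj₁ (high a p)
  ... | no ¬p | no ¬q = inj₁ (low a (ℕₚ.≰⇒> ¬q))
  ... | no ¬p | yes q = inj₂
    ( (λ e → u≢w (ℕₚ.+-cancelʳ-≡ a u w (trans (sym (ℕₚ.m∸n+n≡m q)) (trans (cong (_+ w) e) (ℕₚ.+-comm a w)))))
    , ℕₚ.≤-<-trans (ℕₚ.m∸n≤m (u + a) w)
        (ℕₚ.<-≤-trans (ℕₚ.+-monoʳ-< u (ℕₚ.≰⇒> ¬p))
          (ℕₚ.≤-trans (ℕₚ.≤-reflexive (ℕₚ.+-comm u M)) (ℕₚ.≤-trans (ℕₚ.m≤m+n _ 0) le))))
local (i ∷ is) c u w M κ {N} le high low hyp g A =
  trans (cong (pow2 i *ᶻ_) (P-comm c u w k low (mon is) g))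
  (trans (*ᶻ-distribˡ-+ _ _ _)
  (trans (cong₂ (λ x y → pow2 i *ᶻ x +ᶻ pow2 i *ᶻ y)
           (local is c u w M κ (ℕₚ.≤-trans (ℕₚ.+-monoʳ-≤ (M + u) (ℕₚ.m≤n+m (deg is) k)) le) high low hyp _ (oneBody-P-alt k A))
           (local is c′ (k + u) w M 0ℤ le′ high′ low′ hyp′ g A))
         (ring-loc₃ _ _ _ _)))
  where
  k : ℕ
  k = suc (dbl i)
  c′ : ℕ → ℤ
  c′ a = c (k + a) +ᶻ -ᶻ c a
  le′ : M + (k + u) + deg is ≤ N
  le′ = subst (_≤ N) (trans (sym (ℕₚ.+-assoc (M + u) k (deg is)))
          (cong (_+ deg is) (trans (ℕₚ.+-assoc M u k) (cong (_+_ M) (ℕₚ.+-comm u k))))) le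
  high′ : ∀ a → M ≤ a → c′ a ≡ 0ℤ
  high′ a p = trans (cong₂ (λ x y → x +ᶻ -ᶻ y) (high (k + a) (ℕₚ.≤-trans p (ℕₚ.m≤n+m a k))) (high a p)) 0-0
  low′ : ∀ a → k + u + a < w → c′ a ≡ 0ℤ
  low′ a p = trans (cong₂ (λ x y → x +ᶻ -ᶻ y)
      (low (k + a) (subst (_< w) (trans (ℕₚ.+-assoc k u a) (+-exch k u a)) p))
      (low a (ℕₚ.≤-<-trans (ℕₚ.+-monoˡ-≤ a (ℕₚ.m≤n+m u k)) p))) 0-0
  -- After commuting past `P k` the weight is a difference of finitely supported weights, so its sum
  -- telescopes to zero. Hence the commutator contributes nothing even when its displacement becomes
  -- zero.
  hyp′ : (k + u ≢ w × 0ℤ ≡ 0ℤ) ⊎ (k + u ≡ w × 0ℤ ≡ Σ< c′ N)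
  hyp′ with k + u ≟ w
  ... | no ne = inj₁ (ne , refl)
  ... | yes e = inj₂ (e , sym (trans (Σ<-+ _ _ N) (trans (cong₂ _+ᶻ_
          (trans (sym (Σ<-low c k N (λ a a<k → low a (subst (u + a <_) (trans (ℕₚ.+-comm u k) e) (ℕₚ.+-monoʳ-< u a<k)))))
          (trans (cong (Σ< c) (ℕₚ.+-comm k N)) (Σ<-above c N k (λ a N≤a → high a (ℕₚ.≤-trans M≤N N≤a)))))
          (Σ<-neg c N)) (+ᶻ-inverseʳ _))))
    where
    M≤N : M ≤ N
    M≤N = ℕₚ.≤-trans (ℕₚ.m≤m+n M u) (ℕₚ.≤-trans (ℕₚ.m≤m+n (M + u) _) le)

dbl-injective : ∀ {i j} → dbl i ≡ dbl j → i ≡ j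
dbl-injective {zero}  {zero}  e = refl
dbl-injective {suc i} {suc j} e = cong suc (dbl-injective (ℕₚ.suc-injective (ℕₚ.suc-injective e)))

opaque
  unfolding _+ᶻ_ _*ᶻ_ -ᶻ_
  ring-1+pos : ∀ n → 1ℤ +ᶻ (+ n) ≡ + suc n
  ring-1+pos n = refl

-- The Heisenberg relation, valid while the degree leaves room. The commutator lives on beads below
-- k, where `local` reduces it to a scalar; if the two indices agree, the scalar counts those k
-- beads.
D-Y-comm : ∀ i j is {N} → suc (dbl i) + deg (j ∷ is) ≤ N → ∀ κ →
  (i ≢ j × κ ≡ 0ℤ) ⊎ (i ≡ j × κ ≡ + suc (dbl i)) → ∀ (g : Fun N) → Alt g →
  app (D (suc (dbl i)) (Y j (mon is))) g
  ≡ app (Y j (D (suc (dbl i)) (mon is))) g +ᶻ pow2 j *ᶻ (κ *ᶻ app (mon is) g)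
D-Y-comm i j is {N} le κ hyp g A =
  trans (cong (pow2 j *ᶻ_) (P-comm (ge k) 0 k l (λ a → ge-no) (mon is) g))
  (trans (*ᶻ-distribˡ-+ _ _ _) (cong (λ x → app (Y j (D k (mon is))) g +ᶻ pow2 j *ᶻ x)
    (local is c′ (l + 0) k k κ (subst (_≤ N) eq le) high low (hyp′ hyp) g A)))
  where
  k l : ℕ
  k = suc (dbl i)
  l = suc (dbl j)
  c′ : ℕ → ℤ
  c′ a = ge k (l + a) +ᶻ -ᶻ ge k a
  eq : k + (l + deg is) ≡ k + (l + 0) + deg is
  eq = trans (sym (ℕₚ.+-assoc k l (deg is))) (cong (λ x → k + x + deg is) (sym (ℕₚ.+-identityʳ l)))
  high : ∀ a → k ≤ a → c′ a ≡ 0ℤ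
  high a p = trans (cong₂ (λ x y → x +ᶻ -ᶻ y) (ge-yes (ℕₚ.≤-trans p (ℕₚ.m≤n+m a l))) (ge-yes p)) 1-1
  low : ∀ a → l + 0 + a < k → c′ a ≡ 0ℤ
  low a p = trans (cong₂ (λ x y → x +ᶻ -ᶻ y)
      (ge-no (subst (λ z → z + a < k) (ℕₚ.+-identityʳ l) p))
      (ge-no (ℕₚ.≤-<-trans (ℕₚ.m≤n+m a (l + 0)) p))) 0-0
  low-sum : ∀ n → n ≤ k → Σ< (λ a → ge k (k + a) +ᶻ -ᶻ ge k a) n ≡ + n
  low-sum zero    p = refl
  low-sum (suc n) p = trans (cong₂ _+ᶻ_ (trans (cong₂ (λ x y → x +ᶻ -ᶻ y) (ge-yes (ℕₚ.m≤m+n k n)) (ge-no p)) 1-0)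
                                        (low-sum n (ℕₚ.<⇒≤ p))) (ring-1+pos n)
  hyp′ : (i ≢ j × κ ≡ 0ℤ) ⊎ (i ≡ j × κ ≡ + k) →
         (l + 0 ≢ k × κ ≡ 0ℤ) ⊎ (l + 0 ≡ k × κ ≡ Σ< c′ N)
  hyp′ (inj₁ (ne , e)) = inj₁ ((λ q → ne (sym (dbl-injective (ℕₚ.suc-injective (trans (sym (ℕₚ.+-identityʳ l)) q))))) , e)
  hyp′ (inj₂ (refl , e)) = inj₂ (ℕₚ.+-identityʳ l , trans e (sym
          (trans (cong (Σ< c′) (sym (ℕₚ.m+[n∸m]≡n (ℕₚ.≤-trans (ℕₚ.m≤m+n k _) le))))
          (trans (Σ<-above c′ k (N ∸ k) high) (low-sum k ℕₚ.≤-refl)))))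

count : ℕ → List ℕ → ℕ
count i []       = 0
count i (j ∷ js) with i ≟ j
... | yes _ = suc (count i js)
... | no  _ = count i js

remove : ℕ → List ℕ → List ℕ
remove i []       = []
remove i (j ∷ js) with i ≟ j
... | yes _ = js
... | no  _ = j ∷ remove i js

Y-Y : ∀ i j {N} (φ : Vect N) → Y i (Y j φ) ≈ Y j (Y i φ)
Y-Y i j φ g A = trans (cong (λ z → pow2 i *ᶻ (pow2 j *ᶻ z)) (P-P (suc (dbl i)) (suc (dbl j)) φ g)) (*ᶻ-swap _ _ _)

Y-cong : ∀ i {N} {φ ψ : Vect N} → φ ≈ ψ → Y i φ ≈ Y i ψ
Y-cong i e g A = cong (pow2 i *ᶻ_) (e _ (oneBody-P-alt _ A))

Y-remove : ∀ i is {N} → 0 < count i is → Y i (mon (remove i is)) ≈ mon is {N}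
Y-remove i (j ∷ js) p g A with i ≟ j
... | yes refl = refl
... | no  _    = trans (Y-Y i j (mon (remove i js)) g A)
                       (Y-cong j {φ = Y i (mon (remove i js))} {ψ = mon js} (Y-remove i js p) g A)

deg-remove : ∀ i is → 0 < count i is → suc (dbl i) + deg (remove i is) ≡ deg is
deg-remove i (j ∷ js) p with i ≟ j
... | yes refl = refl
... | no  _    = trans (+-exch (suc (dbl i)) (suc (dbl j)) _) (cong (_+_ (suc (dbl j))) (deg-remove i js p))

opaque
  unfolding _+ᶻ_ _*ᶻ_ -ᶻ_
  ring-Dm₁ : ∀ p c k q x y → p *ᶻ (c *ᶻ (q *ᶻ (k *ᶻ x))) +ᶻ p *ᶻ (0ℤ *ᶻ y) ≡ c *ᶻ (q *ᶻ (k *ᶻ (p *ᶻ x)))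
  ring-Dm₁ = solve-∀
  ring-Dm₂ : ∀ p k x y → p *ᶻ (0ℤ *ᶻ y) +ᶻ p *ᶻ (k *ᶻ x) ≡ 1ℤ *ᶻ (p *ᶻ (k *ᶻ x))
  ring-Dm₂ = solve-∀
  ring-Dm₃ : ∀ n p k x y → p *ᶻ y ≡ x →
    p *ᶻ ((+ suc n) *ᶻ (p *ᶻ (k *ᶻ y))) +ᶻ p *ᶻ (k *ᶻ x) ≡ (+ suc (suc n)) *ᶻ (p *ᶻ (k *ᶻ x))
  ring-Dm₃ n p k x y refl = lem (+ suc n) p k y
    where
    lem : ∀ n p k y → p *ᶻ (n *ᶻ (p *ᶻ (k *ᶻ y))) +ᶻ p *ᶻ (k *ᶻ (p *ᶻ y)) ≡ (1ℤ +ᶻ n) *ᶻ (p *ᶻ (k *ᶻ (p *ᶻ y)))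
    lem = solve-∀

-- On polynomials in the y's, `D` of index 2i + 1 is (2i + 1) 2^i times the partial derivative in
-- y_i. If y_i does not occur, the factor `count` is zero.
D-mon : ∀ i is {N} → suc (dbl i) + deg is ≤ N → ∀ (g : Fun N) → Alt g →
  app (D (suc (dbl i)) (mon is)) g
  ≡ (+ count i is) *ᶻ (pow2 i *ᶻ ((+ suc (dbl i)) *ᶻ app (mon (remove i is)) g))
D-mon i [] le g A = trans (D-vac (dbl i) g A) (sym (*ᶻ-zeroˡ _))
D-mon i (j ∷ js) {N} le g A with i ≟ j
... | no ne = trans (D-Y-comm i j js le 0ℤ (inj₁ (ne , refl)) g A)
  (trans (cong (λ x → pow2 j *ᶻ x +ᶻ pow2 j *ᶻ (0ℤ *ᶻ app (mon js) g))
           (D-mon i js (ℕₚ.≤-trans (ℕₚ.+-monoʳ-≤ (suc (dbl i)) (ℕₚ.m≤n+m _ (suc (dbl j)))) le) _ (oneBody-P-alt _ A)))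
         (ring-Dm₁ _ _ _ _ _ _))
... | yes refl = trans (D-Y-comm i i js le _ (inj₂ (refl , refl)) g A)
  (trans (cong (λ x → pow2 i *ᶻ x +ᶻ pow2 i *ᶻ ((+ suc (dbl i)) *ᶻ app (mon js) g))
           (D-mon i js (ℕₚ.≤-trans (ℕₚ.+-monoʳ-≤ (suc (dbl i)) (ℕₚ.m≤n+m _ (suc (dbl i)))) le) _ (oneBody-P-alt _ A)))
         (combine (count i js) refl))
  where
  combine : ∀ n → n ≡ count i js →
    pow2 i *ᶻ ((+ n) *ᶻ (pow2 i *ᶻ ((+ suc (dbl i)) *ᶻ app (mon (remove i js)) (P̂ (suc (dbl i)) g))))
    +ᶻ pow2 i *ᶻ ((+ suc (dbl i)) *ᶻ app (mon js) g)
    ≡ (+ suc n) *ᶻ (pow2 i *ᶻ ((+ suc (dbl i)) *ᶻ app (mon js) g))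
  combine zero    e = ring-Dm₂ _ _ _ _
  combine (suc n) e = ring-Dm₃ n _ _ _ _ (Y-remove i js (subst (0 <_) e (s≤s z≤n)) g A)

-- Divisibility of the pairing

-- The square norm of the monomial, up to an odd factor.
norm : List ℕ → ℕ
norm []       = 1
norm (i ∷ is) = 4 ^ i * suc (count i is) * norm is

count-remove : ∀ i j is → i ≢ j → count j (remove i is) ≡ count j is
count-remove i j [] ne = refl
count-remove i j (k ∷ ks) ne with i ≟ k
... | yes refl with j ≟ k
...   | yes refl = ⊥-elim (ne refl)
...   | no _     = refl
count-remove i j (k ∷ ks) ne | no _ with j ≟ k
...   | yes refl = cong suc (count-remove i j ks ne)
...   | no _     = count-remove i j ks ne

norm-remove : ∀ i is → 0 < count i is → norm is ≡ 4 ^ i * count i is * norm (remove i is)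
norm-remove i (j ∷ js) p with i ≟ j
... | yes refl = refl
... | no ne rewrite norm-remove i js p | count-remove i j js ne = lem (4 ^ j) (suc (count j js)) (4 ^ i) (count i js) _
  where
  lem : ∀ x c y d z → x * c * (y * d * z) ≡ y * d * (x * c * z)
  lem = ℕ-Solver.solve-∀

gram : List ℕ → ∀ {N} → Fun N
gram js as = app (mon js) (λ bs → ker bs as)

gram-alt : ∀ js {N} → Alt (gram js {N})
gram-alt js = app-alt (mon js) ker-alt

gram-∷ : ∀ i js {N} (as : Vec ℕ N) → gram (i ∷ js) as ≡ pow2 i *ᶻ D̂ (suc (dbl i)) (gram js) as
gram-∷ i js as = cong (pow2 i *ᶻ_)
  (trans (app-cong (mon js) (ker-adjoint (suc (dbl i)) as))
         (app-oneBody _ _ (mon js) ker as))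

opaque
  unfolding _+ᶻ_ _*ᶻ_ -ᶻ_
  pos-* : ∀ m n → + (m * n) ≡ + m *ᶻ + n
  pos-* = ℤₚ.pos-*

pow2² : ∀ i → pow2 i *ᶻ pow2 i ≡ + (4 ^ i)
pow2² zero    = *ᶻ-identityˡ _
pow2² (suc i) = trans (lem (pow2 i)) (trans (cong ((+ 4) *ᶻ_) (pow2² i)) (sym (pos-* 4 (4 ^ i))))
  where opaque
  unfolding _*ᶻ_
  lem : ∀ x → ((+ 2) *ᶻ x) *ᶻ ((+ 2) *ᶻ x) ≡ (+ 4) *ᶻ (x *ᶻ x)
  lem = solve-∀

pow2-pos : ∀ n → + (2 ^ n) ≡ pow2 n
pow2-pos zero    = refl
pow2-pos (suc n) = trans (pos-* 2 (2 ^ n)) (cong ((+ 2) *ᶻ_) (pow2-pos n))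

_∣ᶻ_ : ℤ → ℤ → Set
q ∣ᶻ x = ∃ λ z → x ≡ z *ᶻ q

opaque
  unfolding _+ᶻ_ _*ᶻ_ -ᶻ_
  ring-pair₂ : ∀ p c k z n q → p *ᶻ p ≡ q → p *ᶻ (c *ᶻ (p *ᶻ (k *ᶻ (z *ᶻ n)))) ≡ (k *ᶻ z) *ᶻ ((q *ᶻ c) *ᶻ n)
  ring-pair₂ p c k z n q refl = lem p c k z n
    where
    lem : ∀ p c k z n → p *ᶻ (c *ᶻ (p *ᶻ (k *ᶻ (z *ᶻ n)))) ≡ (k *ᶻ z) *ᶻ (((p *ᶻ p) *ᶻ c) *ᶻ n)
    lem = solve-∀
  *ᶻ-identityʳ : ∀ x → x ≡ x *ᶻ 1ℤ
  *ᶻ-identityʳ x = sym (ℤₚ.*-identityʳ x)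

deg≡0 : ∀ is → deg is ≡ 0 → is ≡ []
deg≡0 [] _ = refl

gram-step : ∀ i js is {N} → deg is ≡ deg (i ∷ js) → deg is + deg is ≤ N →
  app (mon is {N}) (gram (i ∷ js)) ≡
  pow2 i *ᶻ ((+ count i is) *ᶻ (pow2 i *ᶻ ((+ suc (dbl i)) *ᶻ app (mon (remove i is)) (gram js))))
gram-step i js is e le =
  trans (app-cong (mon is) (gram-∷ i js))
  (trans (app-* (mon is) (pow2 i) _)
  (cong (pow2 i *ᶻ_) (D-mon i is (ℕₚ.≤-trans (ℕₚ.+-monoˡ-≤ (deg is)
    (ℕₚ.≤-trans (ℕₚ.m≤m+n _ (deg js)) (ℕₚ.≤-reflexive (sym e)))) le) (gram js) (gram-alt js))))

-- Factors of the second monomial are moved across the pairing one at a time and differentiate the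
-- first. A missing variable gives zero; otherwise the factor 4^i times the multiplicity splits off
-- and 2i + 1 joins the quotient.
gram-norm : ∀ js is {N} → deg is ≡ deg js → deg is + deg is ≤ N →
            (+ norm is) ∣ᶻ app (mon is {N}) (gram js)
gram-norm [] is e le rewrite deg≡0 is e = _ , *ᶻ-identityʳ _
gram-norm (i ∷ js) is {N} e le with 0 <? count i is
... | no ¬p = 0ℤ , trans (gram-step i js is e le)
  (trans (cong (λ c → pow2 i *ᶻ ((+ c) *ᶻ (pow2 i *ᶻ ((+ suc (dbl i)) *ᶻ app (mon (remove i is)) (gram js)))))
               (ℕₚ.n≤0⇒n≡0 (ℕₚ.≮⇒≥ ¬p)))
  (trans (cong (pow2 i *ᶻ_) (*ᶻ-zeroˡ _)) (trans (*ᶻ-zeroʳ _) (sym (*ᶻ-zeroˡ _)))))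
... | yes pos = (+ suc (dbl i)) *ᶻ proj₁ rec , trans (gram-step i js is e le)
  (trans (cong (λ x → pow2 i *ᶻ ((+ count i is) *ᶻ (pow2 i *ᶻ ((+ suc (dbl i)) *ᶻ x)))) (proj₂ rec))
  (trans (ring-pair₂ (pow2 i) (+ count i is) (+ suc (dbl i)) (proj₁ rec) (+ norm (remove i is)) _ (pow2² i))
  (cong (((+ suc (dbl i)) *ᶻ proj₁ rec) *ᶻ_)
    (trans (cong (_*ᶻ (+ norm (remove i is))) (sym (pos-* (4 ^ i) (count i is))))
    (trans (sym (pos-* (4 ^ i * count i is) (norm (remove i is))))
           (cong (λ x → + x) (sym (norm-remove i is pos))))))))
  where
  smaller : deg (remove i is) ≤ deg is
  smaller = ℕₚ.≤-trans (ℕₚ.m≤n+m _ (suc (dbl i))) (ℕₚ.≤-reflexive (deg-remove i is pos))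
  rec : (+ norm (remove i is)) ∣ᶻ app (mon (remove i is) {N}) (gram js)
  rec = gram-norm js (remove i is)
    (ℕₚ.+-cancelˡ-≡ (suc (dbl i)) _ _ (trans (deg-remove i is pos) e))
    (ℕₚ.≤-trans (ℕₚ.+-mono-≤ smaller smaller) le)

opaque
  unfolding _+ᶻ_ _*ᶻ_ -ᶻ_
  -- Induction on `e`: x = (1 + 2t)x - 2tx is even, and both sides can be halved.
  odd-cancel : ∀ t e x → pow2 e ∣ᶻ (odd t *ᶻ x) → pow2 e ∣ᶻ x
  odd-cancel t zero    x _ = x , *ᶻ-identityʳ x
  odd-cancel t (suc e) x (z , p) = proj₁ rec , trans x-even (trans (cong ((+ 2) *ᶻ_) (proj₂ rec)) (lem₃ (proj₁ rec) (pow2 e)))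
    where
    lem₁ : ∀ t x → x ≡ (1ℤ +ᶻ (+ 2) *ᶻ t) *ᶻ x +ᶻ -ᶻ ((+ 2) *ᶻ (t *ᶻ x))
    lem₁ = solve-∀
    lem₂ : ∀ t x z q → z *ᶻ ((+ 2) *ᶻ q) +ᶻ -ᶻ ((+ 2) *ᶻ (t *ᶻ x)) ≡ (+ 2) *ᶻ (z *ᶻ q +ᶻ -ᶻ (t *ᶻ x))
    lem₂ = solve-∀
    lem₃ : ∀ z q → (+ 2) *ᶻ (z *ᶻ q) ≡ z *ᶻ ((+ 2) *ᶻ q)
    lem₃ = solve-∀
    lem₄ : ∀ t y → (+ 2) *ᶻ ((1ℤ +ᶻ (+ 2) *ᶻ t) *ᶻ y) ≡ (1ℤ +ᶻ (+ 2) *ᶻ t) *ᶻ ((+ 2) *ᶻ y)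
    lem₄ = solve-∀
    y : ℤ
    y = z *ᶻ pow2 e +ᶻ -ᶻ (t *ᶻ x)
    x-even : x ≡ (+ 2) *ᶻ y
    x-even = trans (lem₁ t x) (trans (cong (λ w → w +ᶻ -ᶻ ((+ 2) *ᶻ (t *ᶻ x))) p) (lem₂ t x z (pow2 e)))
    rec : pow2 e ∣ᶻ y
    rec = odd-cancel t e y (z , ℤₚ.*-cancelˡ-≡ (+ 2) _ _
      (trans (lem₄ t y) (trans (cong ((1ℤ +ᶻ (+ 2) *ᶻ t) *ᶻ_) (sym x-even)) (trans p (sym (lem₃ z (pow2 e)))))))

  ∣ᶻ-+ : ∀ q x y → q ∣ᶻ x → q ∣ᶻ y → q ∣ᶻ (x +ᶻ y)
  ∣ᶻ-+ q x y (z , refl) (w , refl) = z +ᶻ w , lem z w q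
    where
    lem : ∀ z w q → z *ᶻ q +ᶻ w *ᶻ q ≡ (z +ᶻ w) *ᶻ q
    lem = solve-∀
  ∣ᶻ-* : ∀ q k x → q ∣ᶻ x → q ∣ᶻ (k *ᶻ x)
  ∣ᶻ-* q k x (z , refl) = k *ᶻ z , sym (ℤₚ.*-assoc k z q)

-- Divisibility respects sums, multiples and division by odd numbers, so only monomials matter; a
-- factor `Y i` is absorbed into the test function.
L-divisible : ∀ e {N d} {φ : Vect N} → L d φ → ∀ g → Alt g →
  (∀ is → deg is ≡ d → pow2 e ∣ᶻ app (mon is) g) → pow2 e ∣ᶻ app φ g
L-divisible e L-vac g A H = H [] refl
L-divisible e L-zero g A H = 0ℤ , sym (*ᶻ-zeroˡ _)
L-divisible e (L-+ x y) g A H = ∣ᶻ-+ _ _ _ (L-divisible e x g A H) (L-divisible e y g A H)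
L-divisible e (L-⊙ k x) g A H = ∣ᶻ-* _ k _ (L-divisible e x g A H)
L-divisible e (L-odd t x) g A H = odd-cancel t e _ (L-divisible e x g A H)
L-divisible e (L-resp {φ = φ} {ψ} eq x) g A H = subst (pow2 e ∣ᶻ_) (eq g A) (L-divisible e x g A H)
L-divisible e (L-Y {φ = φ} i x) g A H = subst (pow2 e ∣ᶻ_) (app-* φ (pow2 i) _)
  (L-divisible e x _ (alt-* (pow2 i) (oneBody-P-alt (suc (dbl i)) A))
    (λ is p → subst (pow2 e ∣ᶻ_) (sym (app-* (mon is) (pow2 i) _)) (H (i ∷ is) (cong (_+_ (suc (dbl i))) p))))

mon-fubini : ∀ is {N M} (ψ : Vect M) (H : Vec ℕ M → Fun N) →
  app (mon is) (λ as → app ψ (λ bs → H bs as)) ≡ app ψ (λ bs → app (mon is) (H bs))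
mon-fubini []       ψ H = refl
mon-fubini (i ∷ is) ψ H = trans (cong (pow2 i *ᶻ_)
  (trans (app-cong (mon is) (λ as → sym (app-oneBody _ _ ψ H as)))
         (mon-fubini is ψ (λ bs → P̂ (suc (dbl i)) (H bs)))))
  (sym (app-* ψ (pow2 i) _))

pairing-divisible : ∀ e n {N} {φ ψ : Vect N} → n + n ≤ N → (∀ is → deg is ≡ n → 2 ^ e ∣ norm is) →
  L n φ → L n ψ → pow2 e ∣ᶻ app φ (λ as → app ψ (λ bs → ker bs as))
pairing-divisible e n {N} {φ} {ψ} le H x y =
  L-divisible e x _ (app-alt ψ ker-alt) (λ is p → subst (pow2 e ∣ᶻ_) (sym (mon-fubini is ψ ker))
    (L-divisible e y _ (app-alt (mon is) ker-alt′)
      (λ js q → subst (pow2 e ∣ᶻ_) (mon-fubini is (mon js) ker) (monomials is js p q))))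
  where
  monomials : ∀ is js → deg is ≡ n → deg js ≡ n → pow2 e ∣ᶻ app (mon is) (gram js {N})
  monomials is js p q with gram-norm js is {N} (trans p (sym q)) (subst (λ m → m + m ≤ N) (sym p) le) | H is p
  ... | z , eq | divides w eq′ = z *ᶻ (+ w) , trans eq (trans (cong (z *ᶻ_)
        (trans (cong (λ x → + x) eq′) (trans (pos-* w (2 ^ e)) (cong ((+ w) *ᶻ_) (pow2-pos e))))) (sym (*ᶻ-assoc _ _ _)))

-- Glaisher merging of odd parts

dbl≡2* : ∀ n → dbl n ≡ 2 * n
dbl≡2* n = trans (dbl≡+ n) (cong (_+_ n) (sym (ℕₚ.+-identityʳ n)))

-- A list m₀, m₁, … of multiplicities stands for the partition with mᵢ parts 2i + 1.
incr : ℕ → List ℕ → List ℕ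
incr zero    []       = 1 ∷ []
incr zero    (m ∷ ms) = suc m ∷ ms
incr (suc i) []       = 0 ∷ incr i []
incr (suc i) (m ∷ ms) = m ∷ incr i ms

entry : ℕ → List ℕ → ℕ
entry i       []       = 0
entry zero    (m ∷ ms) = m
entry (suc i) (m ∷ ms) = entry i ms

mult : List ℕ → List ℕ
mult []       = []
mult (i ∷ is) = incr i (mult is)

∏! : List ℕ → ℕ
∏! []       = 1
∏! (m ∷ ms) = m ! * ∏! ms

size : ℕ → List ℕ → ℕ
size j []       = 0
size j (m ∷ ms) = suc (dbl j) * m + size (suc j) ms

entry-incr-≡ : ∀ i ms → entry i (incr i ms) ≡ suc (entry i ms)
entry-incr-≡ zero    []       = refl
entry-incr-≡ zero    (m ∷ ms) = refl
entry-incr-≡ (suc i) []       = entry-incr-≡ i []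
entry-incr-≡ (suc i) (m ∷ ms) = entry-incr-≡ i ms

entry-[] : ∀ i → entry i [] ≡ 0
entry-[] zero    = refl
entry-[] (suc i) = refl

entry-incr-≢ : ∀ i j ms → i ≢ j → entry i (incr j ms) ≡ entry i ms
entry-incr-≢ zero    zero    ms       ne = ⊥-elim (ne refl)
entry-incr-≢ zero    (suc j) []       ne = refl
entry-incr-≢ zero    (suc j) (m ∷ ms) ne = refl
entry-incr-≢ (suc i) zero    []       ne = entry-[] i
entry-incr-≢ (suc i) zero    (m ∷ ms) ne = refl
entry-incr-≢ (suc i) (suc j) []       ne = trans (entry-incr-≢ i j [] (λ e → ne (cong suc e))) (entry-[] i)
entry-incr-≢ (suc i) (suc j) (m ∷ ms) ne = entry-incr-≢ i j ms (λ e → ne (cong suc e))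

count≡entry : ∀ i is → count i is ≡ entry i (mult is)
count≡entry i []       = sym (entry-[] i)
count≡entry i (j ∷ js) with i ≟ j
... | yes refl = trans (cong suc (count≡entry i js)) (sym (entry-incr-≡ i (mult js)))
... | no ne    = trans (count≡entry i js) (sym (entry-incr-≢ i j (mult js) ne))

∏!-incr : ∀ i ms → ∏! (incr i ms) ≡ suc (entry i ms) * ∏! ms
∏!-incr zero    []       = refl
∏!-incr zero    (m ∷ ms) = ℕₚ.*-assoc (suc m) (m !) (∏! ms)
∏!-incr (suc i) []       = trans (ℕₚ.+-identityʳ _) (trans (∏!-incr i []) (cong (λ e → suc e * 1) (entry-[] i)))
∏!-incr (suc i) (m ∷ ms) rewrite ∏!-incr i ms = lem (m !) (suc (entry i ms)) (∏! ms)
  where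
  lem : ∀ x y z → x * (y * z) ≡ y * (x * z)
  lem = ℕ-Solver.solve-∀

size-incr : ∀ i j ms → size j (incr i ms) ≡ suc (dbl (j + i)) + size j ms
size-incr zero    j []       rewrite ℕₚ.+-identityʳ j = cong suc (cong (_+ 0) (ℕₚ.*-identityʳ (dbl j)))
size-incr zero    j (m ∷ ms) rewrite ℕₚ.+-identityʳ j = lem (dbl j) m (size (suc j) ms)
  where
  lem : ∀ d m z → suc d * suc m + z ≡ suc d + (suc d * m + z)
  lem = ℕ-Solver.solve-∀
size-incr (suc i) j []       rewrite ℕₚ.*-zeroʳ (dbl j) | ℕₚ.+-suc j i = size-incr i (suc j) []
size-incr (suc i) j (m ∷ ms) rewrite size-incr i (suc j) ms | ℕₚ.+-suc j i =
  +-exch (suc (dbl j) * m) (suc (dbl (suc (j + i)))) (size (suc j) ms)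

sum-incr : ∀ i ms → sum (incr i ms) ≡ suc (sum ms)
sum-incr zero    []       = refl
sum-incr zero    (m ∷ ms) = refl
sum-incr (suc i) []       = sum-incr i []
sum-incr (suc i) (m ∷ ms) = trans (cong (_+_ m) (sum-incr i ms)) (ℕₚ.+-suc m (sum ms))

sum-mult : ∀ is → sum (mult is) ≡ length is
sum-mult []       = refl
sum-mult (i ∷ is) = trans (sum-incr i (mult is)) (cong suc (sum-mult is))

size-mult : ∀ is → size 0 (mult is) ≡ deg is
size-mult []       = refl
size-mult (i ∷ is) = trans (size-incr i 0 (mult is)) (cong (_+_ (suc (dbl i))) (size-mult is))

norm-∏! : ∀ is → norm is ≡ 4 ^ sum is * ∏! (mult is)
norm-∏! []       = refl
norm-∏! (i ∷ is) rewrite norm-∏! is | ∏!-incr i (mult is) | count≡entry i is | ℕₚ.^-distribˡ-+-* 4 i (sum is) =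
  lem (4 ^ i) (suc (entry i (mult is))) (4 ^ sum is) (∏! (mult is))
  where
  lem : ∀ x c y z → x * c * (y * z) ≡ x * y * (c * z)
  lem = ℕ-Solver.solve-∀

deg-sum : ∀ is → deg is ≡ 2 * sum is + length is
deg-sum []       = refl
deg-sum (i ∷ is) rewrite deg-sum is | dbl≡2* i = lem i (sum is) (length is)
  where
  lem : ∀ i s l → suc (2 * i) + (2 * s + l) ≡ 2 * (i + s) + suc l
  lem = ℕ-Solver.solve-∀

half parity : ℕ → ℕ
half zero          = 0
half (suc zero)    = 0
half (suc (suc n)) = suc (half n)
parity zero          = 0
parity (suc zero)    = 1
parity (suc (suc n)) = parity n

parity+2half : ∀ n → n ≡ parity n + 2 * half n
parity+2half zero          = refl
parity+2half (suc zero)    = refl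
parity+2half (suc (suc n)) = trans (cong (λ x → suc (suc x)) (parity+2half n)) (lem (parity n) (half n))
  where
  lem : ∀ p h → suc (suc (p + 2 * h)) ≡ p + 2 * suc h
  lem = ℕ-Solver.solve-∀

parity-cases : ∀ n → parity n ≡ 0 ⊎ parity n ≡ 1
parity-cases zero          = inj₁ refl
parity-cases (suc zero)    = inj₂ refl
parity-cases (suc (suc n)) = parity-cases n

-- The even factors 2, 4, ..., 2h of the factorial already have this product.
half-! : ∀ h → 2 ^ h * h ! ∣ (2 * h) !
half-! zero    = ∣-refl
half-! (suc h) = subst₂ _∣_ (lem₁ h (2 ^ h) (h !)) (lem₂ h)
  (*-pres-∣ (∣n⇒∣m*n (suc (2 * h)) (∣-refl {2 * suc h})) (half-! h))
  where
  lem₁ : ∀ h x y → 2 * suc h * (x * y) ≡ 2 * x * (suc h * y)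
  lem₁ = ℕ-Solver.solve-∀
  lem₂ : ∀ h → suc (2 * h) * (2 * suc h) * (2 * h) ! ≡ (2 * suc h) !
  lem₂ h rewrite ℕₚ.+-suc h (h + 0) = lem (2 * h) ((2 * h) !)
    where
    lem : ∀ x y → suc x * suc (suc x) * y ≡ suc (suc x) * (suc x * y)
    lem = ℕ-Solver.solve-∀

parity-! : ∀ m → 2 ^ half m * half m ! ∣ m !
parity-! m with parity-cases m | parity+2half m
... | inj₁ e | q = subst (λ x → 2 ^ half m * half m ! ∣ x !) (sym (trans q (cong (_+ 2 * half m) e))) (half-! (half m))
... | inj₂ e | q = subst (λ x → 2 ^ half m * half m ! ∣ x !) (sym (trans q (cong (_+ 2 * half m) e)))
                     (∣n⇒∣m*n (suc (2 * half m)) (half-! (half m)))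

halves parities : List ℕ → List ℕ
halves   = map half
parities = map parity

∏!-halves : ∀ ms → 2 ^ sum (halves ms) * ∏! (halves ms) ∣ ∏! ms
∏!-halves []       = ∣-refl
∏!-halves (m ∷ ms) = subst (_∣ m ! * ∏! ms)
  (trans (lem (2 ^ half m) (half m !) (2 ^ sum (halves ms)) _) (cong (_* (half m ! * ∏! (halves ms))) (sym (ℕₚ.^-distribˡ-+-* 2 (half m) _))))
  (*-pres-∣ (parity-! m) (∏!-halves ms))
  where
  lem : ∀ x y z w → x * y * (z * w) ≡ x * z * (y * w)
  lem = ℕ-Solver.solve-∀

sum-halves : ∀ ms → sum ms ≡ sum (parities ms) + 2 * sum (halves ms)
sum-halves []       = refl
sum-halves (m ∷ ms) = trans (cong₂ _+_ (parity+2half m) (sum-halves ms)) (lem (parity m) (half m) _ _)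
  where
  lem : ∀ p h x y → p + 2 * h + (x + 2 * y) ≡ p + x + 2 * (h + y)
  lem = ℕ-Solver.solve-∀

size-halves : ∀ j ms → size j ms ≡ size j (parities ms) + 2 * size j (halves ms)
size-halves j []       = refl
size-halves j (m ∷ ms) = trans (cong₂ (λ x y → suc (dbl j) * x + y) (parity+2half m) (size-halves (suc j) ms))
  (lem (suc (dbl j)) (parity m) (half m) _ _)
  where
  lem : ∀ d p h x y → d * (p + 2 * h) + (x + 2 * y) ≡ d * p + x + 2 * (d * h + y)
  lem = ℕ-Solver.solve-∀

-- The odd multiplicities contribute distinct odd parts, and z of them, all at least 2j + 1, have
-- sum at least (2j + 1) + (2j + 3) + ... = 2jz + z².
size-parities : ∀ j ms → 2 * j * sum (parities ms) + sum (parities ms) * sum (parities ms) ≤ size j (parities ms)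
size-parities j []       = ℕₚ.≤-reflexive (cong (_+ 0) (ℕₚ.*-zeroʳ (2 * j)))
size-parities j (m ∷ ms) with parity m | parity-cases m
... | .0 | inj₁ refl = ℕₚ.≤-trans (ℕₚ.+-monoˡ-≤ _ (ℕₚ.*-monoˡ-≤ _ (ℕₚ.*-monoʳ-≤ 2 (ℕₚ.n≤1+n j))))
                        (ℕₚ.≤-trans (size-parities (suc j) ms) (ℕₚ.m≤n+m _ _))
... | .1 | inj₂ refl = ℕₚ.≤-trans (ℕₚ.≤-reflexive (trans (lem j (sum (parities ms))) (cong (λ d → suc d * 1 + (2 * suc j * sum (parities ms) + sum (parities ms) * sum (parities ms))) (sym (dbl≡2* j)))))
                        (ℕₚ.+-monoʳ-≤ (suc (dbl j) * 1) (size-parities (suc j) ms))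
  where
  lem : ∀ j z → 2 * j * suc z + suc z * suc z ≡ suc (2 * j) * 1 + (2 * suc j * z + z * z)
  lem = ℕ-Solver.solve-∀

-- Twice o² + t(t + 1) exceeds the left side by (t - o)(t - o + 1), a product of consecutive
-- integers and hence nonnegative.
triangle-bound : ∀ o t B H → o * o ≤ B → t * suc t ≤ 2 * H → (o + t) * suc (o + t) ≤ 2 * (B + 2 * H)
triangle-bound o t B H p q = ℕₚ.≤-trans (core (ℕₚ.≤-total o t))
  (ℕₚ.≤-trans (ℕₚ.+-mono-≤ (ℕₚ.*-monoʳ-≤ 2 p) (ℕₚ.*-monoʳ-≤ 2 q)) (ℕₚ.≤-reflexive (lem B H)))
  where
  lem : ∀ B H → 2 * B + 2 * (2 * H) ≡ 2 * (B + 2 * H)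
  lem = ℕ-Solver.solve-∀
  core : o ≤ t ⊎ t ≤ o → (o + t) * suc (o + t) ≤ 2 * (o * o) + 2 * (t * suc t)
  core (inj₁ le) with t ∸ o | ℕₚ.m+[n∸m]≡n le
  ... | d | refl = ℕₚ.≤-trans (ℕₚ.m≤m+n _ (d * d + d)) (ℕₚ.≤-reflexive (lem₁ o d))
    where
    lem₁ : ∀ o d → (o + (o + d)) * suc (o + (o + d)) + (d * d + d) ≡ 2 * (o * o) + 2 * ((o + d) * suc (o + d))
    lem₁ = ℕ-Solver.solve-∀
  core (inj₂ le) with o ∸ t | ℕₚ.m+[n∸m]≡n le
  ... | zero  | refl = ℕₚ.≤-reflexive (lem₂ t)
    where
    lem₂ : ∀ t → (t + 0 + t) * suc (t + 0 + t) ≡ 2 * ((t + 0) * (t + 0)) + 2 * (t * suc t)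
    lem₂ = ℕ-Solver.solve-∀
  ... | suc d | refl = ℕₚ.≤-trans (ℕₚ.m≤m+n _ (d * suc d)) (ℕₚ.≤-reflexive (lem₃ t d))
    where
    lem₃ : ∀ t d → (t + suc d + t) * suc (t + suc d + t) + d * suc d ≡ 2 * ((t + suc d) * (t + suc d)) + 2 * (t * suc t)
    lem₃ = ℕ-Solver.solve-∀

-- s is the number of distinct parts left when equal parts k, k are merged into 2k as long as possible.
merge : ∀ f ms → sum ms ≤ f → ∃ λ s → (2 ^ sum ms ∣ 2 ^ s * ∏! ms) × s * suc s ≤ 2 * size 0 ms
merge zero ms le = 0 , subst (λ x → 2 ^ x ∣ 1 * ∏! ms) (sym (ℕₚ.n≤0⇒n≡0 le)) (1∣ _) , z≤n
merge (suc f) ms le with merge f (halves ms) smaller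
  where
  small : ∀ h → 2 * h ≤ suc f → h ≤ f
  small zero    p = z≤n
  small (suc h) p = ℕₚ.≤-trans (s≤s (ℕₚ.m≤m+n h (h + 0))) (ℕₚ.≤-pred (subst (_≤ suc f) (cong suc (ℕₚ.+-suc h (h + 0))) p))
  smaller : sum (halves ms) ≤ f
  smaller = small _ (ℕₚ.≤-trans (ℕₚ.m≤n+m _ (sum (parities ms))) (ℕₚ.≤-trans (ℕₚ.≤-reflexive (sym (sum-halves ms))) le))
-- The parities are the parts left unpaired. The pairs merge into even parts, which after division
-- by two are the partition `halves ms` treated by the recursion.
... | s , dv , bd = odds + s
  , subst₂ _∣_ (trans (cong (2 ^ odds *_) eq₁) (trans (sym (ℕₚ.^-distribˡ-+-* 2 odds (2 * h))) (cong (2 ^_) (sym (sum-halves ms)))))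
               (trans (sym (ℕₚ.*-assoc (2 ^ odds) (2 ^ s) _)) (cong (_* ∏! ms) (sym (ℕₚ.^-distribˡ-+-* 2 odds s))))
      (*-monoʳ-∣ (2 ^ odds) (∣-trans (*-monoʳ-∣ (2 ^ h) dv)
        (subst (_∣ 2 ^ s * ∏! ms) (lem (2 ^ s) (2 ^ h) _) (*-monoʳ-∣ (2 ^ s) (∏!-halves ms)))))
  , ℕₚ.≤-trans (triangle-bound odds s (size 0 (parities ms)) (size 0 (halves ms)) (size-parities 0 ms) bd) (ℕₚ.≤-reflexive (cong (2 *_) (sym (size-halves 0 ms))))
  where
  odds h : ℕ
  odds = sum (parities ms)
  h = sum (halves ms)
  lem : ∀ x y z → x * (y * z) ≡ y * (x * z)
  lem = ℕ-Solver.solve-∀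
  eq₁ : 2 ^ h * 2 ^ h ≡ 2 ^ (2 * h)
  eq₁ = trans (sym (ℕₚ.^-distribˡ-+-* 2 h h)) (cong (λ x → 2 ^ (h + x)) (sym (ℕₚ.+-identityʳ h)))

length-filter-≥ : ∀ {P : ℕ → Set} (P? : Decidable P) (f : ℕ → ℕ) s n → s ≤ n →
                  (∀ k → k < s → P (f k)) → s ≤ length (filter P? (applyUpTo f n))
length-filter-≥ P? f zero    n       le H = z≤n
length-filter-≥ P? f (suc s) (suc n) (s≤s le) H
  rewrite Listₚ.filter-accept P? {xs = applyUpTo (λ k → f (suc k)) n} (H 0 (s≤s z≤n)) =
  s≤s (length-filter-≥ P? (λ k → f (suc k)) s n le (λ k p → H (suc k) (s≤s p)))

triangular⇒≤a : ∀ s n → s * suc s ≤ 2 * n → s ≤ a n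
triangular⇒≤a s n le =
  subst (λ ms → s ≤ length (filter (λ m → (m * suc m) / 2 ≤? n) ms)) (sym (Listₚ.map-upTo suc n))
    (length-filter-≥ (λ m → (m * suc m) / 2 ≤? n) suc s n s≤n
      (λ k k<s → ℕₚ.≤-trans
        (/-monoˡ-≤ 2 (ℕₚ.≤-trans (ℕₚ.*-mono-≤ k<s (s≤s k<s)) (ℕₚ.≤-trans le (ℕₚ.≤-reflexive (ℕₚ.*-comm 2 n)))))
        (ℕₚ.≤-reflexive (m*n/n≡m n 2))))
  where
  s≤n : s ≤ n
  s≤n = bound s le
    where
    bound : ∀ s → s * suc s ≤ 2 * n → s ≤ n
    bound zero    p = z≤n
    bound (suc s) p = ℕₚ.*-cancelˡ-≤ 2 (ℕₚ.≤-trans (ℕₚ.≤-reflexive (ℕₚ.*-comm 2 (suc s)))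
                        (ℕₚ.≤-trans (ℕₚ.*-monoʳ-≤ (suc s) (s≤s (s≤s z≤n))) p))

-- The degree is 2 Σ i plus the number of parts. The power of 4 in the norm accounts for the first
-- summand, and `merge` for the second at the cost of 2^s with s at most `a`.
norm-divisible : ∀ is → 2 ^ (deg is ∸ a (deg is)) ∣ norm is
norm-divisible is with merge (sum (mult is)) (mult is) ℕₚ.≤-refl
... | s , dv , bd with deg is ∸ a (deg is) in eq
-- Separated because the truncated difference shows that `A` is at most the degree only when it is
-- positive.
...   | zero = 1∣ _
...   | suc e = *-cancelˡ-∣ (2 ^ A) {{ℕₚ.m^n≢0 2 A}} (subst₂ _∣_ eq₁ eq₂
                 (*-monoʳ-∣ (2 ^ (2 * sum is)) (∣-trans dv (*-monoˡ-∣ (∏! (mult is)) pow-∣))))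
  where
  A : ℕ
  A = a (deg is)
  s≤A : s ≤ A
  s≤A = triangular⇒≤a s (deg is) (subst (λ x → s * suc s ≤ 2 * x) (size-mult is) bd)
  pow-∣ : 2 ^ s ∣ 2 ^ A
  pow-∣ = divides (2 ^ (A ∸ s)) (trans (cong (2 ^_) (sym (ℕₚ.m∸n+n≡m s≤A))) (ℕₚ.^-distribˡ-+-* 2 (A ∸ s) s))
  A≤ : A ≤ deg is
  A≤ = ℕₚ.<⇒≤ (ℕₚ.m∸n≢0⇒n<m (λ z → case z))
    where
    case : deg is ∸ A ≢ 0
    case z with trans (sym eq) z
    ... | ()
  eq₁ : 2 ^ (2 * sum is) * 2 ^ sum (mult is) ≡ 2 ^ A * 2 ^ suc e
  eq₁ = trans (sym (ℕₚ.^-distribˡ-+-* 2 (2 * sum is) _))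
       (trans (cong (λ x → 2 ^ (2 * sum is + x)) (sum-mult is))
       (trans (cong (2 ^_) (trans (sym (deg-sum is)) (trans (sym (ℕₚ.m+[n∸m]≡n A≤)) (cong (_+_ A) eq))))
              (ℕₚ.^-distribˡ-+-* 2 A (suc e))))
  eq₂ : 2 ^ (2 * sum is) * (2 ^ A * ∏! (mult is)) ≡ 2 ^ A * norm is
  eq₂ = trans (lem (2 ^ (2 * sum is)) (2 ^ A) (∏! (mult is))) (cong (2 ^ A *_) (trans (cong (_* ∏! (mult is)) (sym (ℕₚ.^-*-assoc 2 2 (sum is)))) (sym (norm-∏! is))))
    where
    lem : ∀ x y z → x * (y * z) ≡ y * (x * z)
    lem = ℕ-Solver.solve-∀

-- Partitions as bead configurations

data Part : ℕ → List ℕ → Set where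
  part-nil  : ∀ {p} → Part p []
  part-cons : ∀ {p x xs} → 0 < x → x ≤ p → Part x xs → Part p (x ∷ xs)

part-mono : ∀ {p q xs} → p ≤ q → Part p xs → Part q xs
part-mono le part-nil            = part-nil
part-mono le (part-cons 0<x p q) = part-cons 0<x (ℕₚ.≤-trans p le) q

part-head : ∀ {p q xs} → rowLen xs 0 ≤ q → Part p xs → Part q xs
part-head le part-nil            = part-nil
part-head le (part-cons 0<x p q) = part-cons 0<x le q

part-length : ∀ {p xs} → Part p xs → length xs ≤ sum xs
part-length part-nil            = z≤n
part-length (part-cons 0<x _ q) = ℕₚ.+-mono-≤ 0<x (part-length q)

part-row : ∀ {p xs} → Part p xs → ∀ i → rowLen xs (suc i) ≤ rowLen xs i
part-row part-nil            i       = z≤n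
part-row (part-cons _ _ part-nil) i  = z≤n
part-row (part-cons _ _ (part-cons _ le _)) zero = le
part-row (part-cons _ _ q@(part-cons _ _ _)) (suc i) = part-row q i

Part⇒IsPartition : ∀ {p xs} → Part p xs → IsPartition (sum xs) xs
Part⇒IsPartition pt = refl , decreasing pt , positive pt
  where
  decreasing : ∀ {p xs} → Part p xs → Decreasing xs
  decreasing part-nil                                = dec-nil
  decreasing (part-cons _ _ part-nil)                = dec-one _
  decreasing (part-cons _ _ q@(part-cons _ le _))    = dec-cons le (decreasing q)
  positive : ∀ {p xs} → Part p xs → AllPositive xs
  positive part-nil            = pos-nil
  positive (part-cons 0<x _ q) = pos-cons 0<x (positive q)

IsPartition⇒Part : ∀ {n xs} → IsPartition n xs → Part (rowLen xs 0) xs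
IsPartition⇒Part (_ , d , p) = go d p
  where
  go : ∀ {xs} → Decreasing xs → AllPositive xs → Part (rowLen xs 0) xs
  go dec-nil         _               = part-nil
  go (dec-one x)     (pos-cons 0<x _) = part-cons 0<x ℕₚ.≤-refl part-nil
  go (dec-cons le d) (pos-cons 0<x p) = part-cons 0<x ℕₚ.≤-refl (part-head le (go d p))

-- A cell is added to row r; p bounds the first row of the result.
data Add : ℕ → ℕ → List ℕ → List ℕ → Set where
  add-new   : ∀ {p} → Add (suc p) 0 [] (1 ∷ [])
  add-here  : ∀ {p x xs} → x < p → Add p 0 (x ∷ xs) (suc x ∷ xs)
  add-there : ∀ {p r x xs ys} → Add x r xs ys → Add p (suc r) (x ∷ xs) (x ∷ ys)

lower : ℕ → ℕ × List ℕ → ℕ × List ℕ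
lower x (r , ys) = suc r , x ∷ ys

kids : ℕ → List ℕ → List (ℕ × List ℕ)
kids p []       = newRow p
  where
  newRow : ℕ → List (ℕ × List ℕ)
  newRow zero    = []
  newRow (suc p) = (0 , 1 ∷ []) ∷ []
kids p (x ∷ xs) with x <? p
... | yes _ = (0 , suc x ∷ xs) ∷ map (lower x) (kids x xs)
... | no _  = map (lower x) (kids x xs)

kids⇒Add : ∀ p xs {r ys} → (r , ys) ∈ kids p xs → Add p r xs ys
kids⇒Add-map : ∀ p x xs {r ys} → (r , ys) ∈ map (lower x) (kids x xs) → Add p r (x ∷ xs) ys
kids⇒Add (suc p) [] (here refl) = add-new
kids⇒Add p (x ∷ xs) m with x <? p
kids⇒Add p (x ∷ xs) (here refl) | yes lt = add-here lt
kids⇒Add p (x ∷ xs) (there m)   | yes lt = kids⇒Add-map p x xs m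
kids⇒Add p (x ∷ xs) m           | no _   = kids⇒Add-map p x xs m
kids⇒Add-map p x xs m with ∈-map⁻ (lower x) m
... | _ , m′ , refl = add-there (kids⇒Add x xs m′)

Add⇒kids : ∀ {p r xs ys} → Add p r xs ys → (r , ys) ∈ kids p xs
Add⇒kids add-new = here refl
Add⇒kids {p} (add-here {x = x} lt) with x <? p
... | yes _ = here refl
... | no ¬p = ⊥-elim (¬p lt)
Add⇒kids {p} (add-there {x = x} m) with x <? p
... | yes _ = there (∈-map⁺ (lower x) (Add⇒kids m))
... | no _  = ∈-map⁺ (lower x) (Add⇒kids m)

-- Row r of length x becomes a bead at x + N - 1 - r, with empty rows filling up to `N` beads.
beads : ∀ N → List ℕ → Vec ℕ N
beads zero    xs       = []
beads (suc N) []       = N ∷ beads N []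
beads (suc N) (x ∷ xs) = (x + N) ∷ beads N xs

beads-[] : ∀ N → beads N [] ≡ δ N
beads-[] zero    = refl
beads-[] (suc N) = cong (N ∷_) (beads-[] N)

Σl : ∀ {A : Set} → (A → ℤ) → List A → ℤ
Σl f []       = 0ℤ
Σl f (x ∷ xs) = f x +ᶻ Σl f xs

Σl-cong : ∀ {A : Set} {f g : A → ℤ} xs → (∀ x → x ∈ xs → f x ≡ g x) → Σl f xs ≡ Σl g xs
Σl-cong []       e = refl
Σl-cong (x ∷ xs) e = cong₂ _+ᶻ_ (e x (here refl)) (Σl-cong xs (λ y p → e y (there p)))

Σl-map : ∀ {A B : Set} (f : B → ℤ) (g : A → B) xs → Σl f (map g xs) ≡ Σl (λ x → f (g x)) xs
Σl-map f g []       = refl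
Σl-map f g (x ∷ xs) = cong (f (g x) +ᶻ_) (Σl-map f g xs)

Σl-++ : ∀ {A : Set} (f : A → ℤ) xs ys → Σl f (xs ++ ys) ≡ Σl f xs +ᶻ Σl f ys
Σl-++ f []       ys = sym (+ᶻ-identityˡ _)
Σl-++ f (x ∷ xs) ys = trans (cong (f x +ᶻ_) (Σl-++ f xs ys)) (sym (+ᶻ-assoc _ _ _))

Σl-concatMap : ∀ {A B : Set} (f : B → ℤ) (g : A → List B) xs → Σl f (concatMap g xs) ≡ Σl (λ x → Σl f (g x)) xs
Σl-concatMap f g []       = refl
Σl-concatMap f g (x ∷ xs) = trans (Σl-++ f (g x) _) (cong (Σl f (g x) +ᶻ_) (Σl-concatMap f g xs))

HeadIs : ∀ {n} → ℕ → Vec ℕ n → Set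
HeadIs b []      = ⊥
HeadIs b (a ∷ _) = a ≡ b

childTerm : (ℕ → ℤ) → ∀ {n} → Fun n → List ℕ → ℕ × List ℕ → ℤ
childTerm c {n} h xs (r , ys) = c (rowLen xs r + (n ∸ suc r)) *ᶻ h (beads n ys)

-- Moving a bead that is not an addable corner makes two beads collide.
oneBody-kids : ∀ c n p xs {h : Fun n} → Alt h → Part p xs → length xs < n ⊎ p ≡ 0 →
  (rowLen xs 0 ≡ p → ∀ as → HeadIs (p + n) as → h as ≡ 0ℤ) →
  oneBody c suc h (beads n xs) ≡ Σl (childTerm c h xs) (kids p xs)
oneBody-kids-tail : ∀ c n x xs {h : Fun (suc n)} → Alt h → Part x xs → length xs < n →
  oneBody c suc (λ r → h (x + n ∷ r)) (beads n xs) ≡ Σl (childTerm c h (x ∷ xs)) (map (lower x) (kids x xs))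
oneBody-kids c zero p [] A pt (inj₂ refl) V = refl
oneBody-kids c zero .0 (x ∷ xs) A (part-cons 0<x x≤0 _) (inj₂ refl) V = ⊥-elim (ℕₚ.<⇒≱ 0<x x≤0)
oneBody-kids c (suc n) zero [] {h} A pt len V = trans
  (cong₂ (λ x y → c n *ᶻ x +ᶻ y) (V refl _ refl)
    (oneBody-kids c n 0 [] (alt-tail A n) part-nil (inj₂ refl) collide))
  (trans (+ᶻ-identityʳ _) (*ᶻ-zeroʳ _))
  where
  collide : 0 ≡ 0 → ∀ as → HeadIs n as → h (n ∷ as) ≡ 0ℤ
  collide _ (b ∷ bs) refl = alt-vanish A (VecAny.here refl)
oneBody-kids c (suc n) (suc p) [] {h} A pt len V =
  cong (c n *ᶻ h (suc n ∷ beads n []) +ᶻ_)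
    (oneBody-kids c n 0 [] (alt-tail A n) part-nil (inj₂ refl) collide)
  where
  collide : 0 ≡ 0 → ∀ as → HeadIs n as → h (n ∷ as) ≡ 0ℤ
  collide _ (b ∷ bs) refl = alt-vanish A (VecAny.here refl)
oneBody-kids c (suc n) p (x ∷ xs) {h} A (part-cons 0<x x≤p pt) (inj₂ refl) V = ⊥-elim (ℕₚ.<⇒≱ 0<x x≤p)
oneBody-kids c (suc n) p (x ∷ xs) {h} A (part-cons 0<x x≤p pt) (inj₁ (s≤s len)) V with x <? p
... | yes _ = cong (c (x + n) *ᶻ h (suc (x + n) ∷ beads n xs) +ᶻ_) (oneBody-kids-tail c n x xs A pt len)
... | no ¬p = trans (cong₂ (λ u v → c (x + n) *ᶻ u +ᶻ v)
    (V x≡p _ (trans (cong (λ z → suc (z + n)) x≡p) (sym (ℕₚ.+-suc p n))))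
    (oneBody-kids-tail c n x xs A pt len))
  (trans (cong (_+ᶻ Σl (childTerm c h (x ∷ xs)) (map (lower x) (kids x xs))) (*ᶻ-zeroʳ _)) (+ᶻ-identityˡ _))
  where
  x≡p : x ≡ p
  x≡p = ℕₚ.≤-antisym x≤p (ℕₚ.≮⇒≥ ¬p)
oneBody-kids-tail c n x xs {h} A pt len = trans
  (oneBody-kids c n x xs (alt-tail A (x + n)) pt (inj₁ len) collide)
  (sym (Σl-map (childTerm c h (x ∷ xs)) (lower x) (kids x xs)))
  where
  collide : rowLen xs 0 ≡ x → ∀ as → HeadIs (x + n) as → h (x + n ∷ as) ≡ 0ℤ
  collide _ (b ∷ bs) refl = alt-vanish A (VecAny.here refl)

-- Residues as parities of bead positions.

wt : Fin 2 → ℕ → ℤ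
wt zero       a = 1ℤ +ᶻ -ᶻ o a
wt (suc zero) a = o a

mod2-+2 : ∀ m → suc (suc m) mod 2 ≡ m mod 2
mod2-+2 m = Finₚ.toℕ-injective (trans (Finₚ.toℕ-fromℕ< _)
  (trans (cong (_% 2) (ℕₚ.+-comm 2 m)) (trans ([m+n]%n≡m%n m 2) (sym (Finₚ.toℕ-fromℕ< _)))))

o-+2 : ∀ m → o (suc (suc m)) ≡ o m
o-+2 m = 1-[1-x] (o m)

wt-yes : ∀ b m → m mod 2 ≡ b → wt b m ≡ 1ℤ
wt-yes zero       zero          e = 1-0
wt-yes (suc zero) zero          ()
wt-yes zero       (suc zero)    ()
wt-yes (suc zero) (suc zero)    e = 1-0
wt-yes zero       (suc (suc m)) e = trans (cong (λ x → 1ℤ +ᶻ -ᶻ x) (o-+2 m)) (wt-yes zero m (trans (sym (mod2-+2 m)) e))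
wt-yes (suc zero) (suc (suc m)) e = trans (o-+2 m) (wt-yes (suc zero) m (trans (sym (mod2-+2 m)) e))

wt-no : ∀ b m → m mod 2 ≢ b → wt b m ≡ 0ℤ
wt-no zero       zero          ne = ⊥-elim (ne refl)
wt-no (suc zero) zero          ne = refl
wt-no zero       (suc zero)    ne = 1-[1-x] 0ℤ
wt-no (suc zero) (suc zero)    ne = ⊥-elim (ne refl)
wt-no zero       (suc (suc m)) ne = trans (cong (λ x → 1ℤ +ᶻ -ᶻ x) (o-+2 m)) (wt-no zero m (λ e → ne (trans (mod2-+2 m) e)))
wt-no (suc zero) (suc (suc m)) ne = trans (o-+2 m) (wt-no (suc zero) m (λ e → ne (trans (mod2-+2 m) e)))

-- With 2K + 1 beads, row r of length j sits at j + 2K - r. This is congruent modulo 2 to r + j, the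
-- residue of the next cell of that row.
o-position : ∀ K r j → r ≤ dbl K → o (j + (dbl K ∸ r)) ≡ o (r + j)
o-position K r j le = trans (sym (o-dbl r _)) (trans (cong o eq) (o-dbl K (r + j)))
  where
  eq : dbl r + (j + (dbl K ∸ r)) ≡ dbl K + (r + j)
  eq rewrite dbl≡+ r = begin
    r + r + (j + (dbl K ∸ r))   ≡⟨ ℕₚ.+-assoc r r _ ⟩
    r + (r + (j + (dbl K ∸ r))) ≡⟨ cong (_+_ r) (+-exch r j (dbl K ∸ r)) ⟩
    r + (j + (r + (dbl K ∸ r))) ≡⟨ cong (λ z → r + (j + z)) (ℕₚ.m+[n∸m]≡n le) ⟩
    r + (j + dbl K)             ≡⟨ sym (ℕₚ.+-assoc r j (dbl K)) ⟩
    r + j + dbl K               ≡⟨ ℕₚ.+-comm (r + j) (dbl K) ⟩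
    dbl K + (r + j)             ∎
    where open ≡-Reasoning

wt-position : ∀ K b r j → r ≤ dbl K → wt b (j + (dbl K ∸ r)) ≡ wt b (r + j)
wt-position K zero       r j le = cong (λ x → 1ℤ +ᶻ -ᶻ x) (o-position K r j le)
wt-position K (suc zero) r j le = o-position K r j le

step : Fin 2 → ∀ {N} → Vect N → Vect N
step b = act (wt b) suc

word : ∀ {n} → (Fin n → Fin 2) → ∀ {N} → Vect N
word {zero}  v = vac
word {suc n} v = step (v (fromℕ n)) (word (λ k → v (inject₁ k)))

opaque
  unfolding _+ᶻ_ _*ᶻ_ -ᶻ_
  ring-even : ∀ u x → (1ℤ +ᶻ -ᶻ u) *ᶻ x ≡ 1ℤ *ᶻ x +ᶻ ((-ᶻ 1ℤ) *ᶻ u) *ᶻ x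
  ring-even = solve-∀

L-word : ∀ K {n} (v : Fin n → Fin 2) → n ≤ suc (dbl K) → L {suc (dbl K)} n (word v)
L-word K {zero}  v le = L-vac
L-word K {suc n} v le with v (fromℕ n) | L-word K (λ k → v (inject₁ k)) (ℕₚ.<⇒≤ le)
... | suc zero | x = Vacuum.L-F₁ K x le
-- Adding a cell of residue 0 is adding any cell minus adding one of residue 1.
... | zero     | x = L-resp {φ = Y 0 w ⊕ (-ᶻ 1ℤ) ⊙ F₁ w} eq (L-+ (L-Y 0 x) (L-⊙ (-ᶻ 1ℤ) (Vacuum.L-F₁ K x le)))
  where
  w : Vect (suc (dbl K))
  w = word (λ k → v (inject₁ k))
  eq : Y 0 w ⊕ (-ᶻ 1ℤ) ⊙ F₁ w ≈ act (wt zero) suc w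
  eq g A = sym (trans
    (act-lin (wt zero) suc (λ _ → 1ℤ) suc (λ a → (-ᶻ 1ℤ) *ᶻ o a) suc (λ a h → ring-even (o a) _) w g)
    (cong₂ _+ᶻ_ (sym (*ᶻ-identityˡ _)) (act-weight (-ᶻ 1ℤ) o suc w g)))

-- Standard tableaux as growth sequences

add-sum : ∀ {p r xs ys} → Add p r xs ys → sum ys ≡ suc (sum xs)
add-sum add-new                = refl
add-sum (add-here lt)          = refl
add-sum (add-there {x = x} m) = trans (cong (_+_ x) (add-sum m)) (ℕₚ.+-suc x _)

add-row-≡ : ∀ {p r xs ys} → Add p r xs ys → rowLen ys r ≡ suc (rowLen xs r)
add-row-≡ add-new       = refl
add-row-≡ (add-here lt) = refl
add-row-≡ (add-there m) = add-row-≡ m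

add-row-≢ : ∀ {p r xs ys} → Add p r xs ys → ∀ i → i ≢ r → rowLen ys i ≡ rowLen xs i
add-row-≢ add-new       zero    ne = ⊥-elim (ne refl)
add-row-≢ add-new       (suc i) ne = refl
add-row-≢ (add-here lt) zero    ne = ⊥-elim (ne refl)
add-row-≢ (add-here lt) (suc i) ne = refl
add-row-≢ (add-there m) zero    ne = refl
add-row-≢ (add-there m) (suc i) ne = add-row-≢ m i (λ e → ne (cong suc e))

add-part : ∀ {p r xs ys} → Add p r xs ys → Part p xs → Part p ys
add-part add-new       pt                   = part-cons (s≤s z≤n) (s≤s z≤n) part-nil
add-part (add-here lt) (part-cons 0<x _ pt) = part-cons (s≤s z≤n) lt (part-mono (ℕₚ.n≤1+n _) pt)
add-part (add-there m) (part-cons 0<x le pt) = part-cons 0<x le (add-part m pt)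

add-mono : ∀ {p q r xs ys} → p ≤ q → Add p r xs ys → Add q r xs ys
add-mono (s≤s le) add-new       = add-new
add-mono le       (add-here lt) = add-here (ℕₚ.≤-trans lt le)
add-mono le       (add-there m) = add-there m

add-head : ∀ {p r xs ys} → Add p r xs ys → rowLen ys 0 ≤ suc (rowLen xs 0)
add-head add-new       = ℕₚ.≤-refl
add-head (add-here lt) = ℕₚ.≤-refl
add-head (add-there m) = ℕₚ.n≤1+n _

add-row-bound : ∀ {p r xs ys} → Add p r xs ys → r ≤ length xs
add-row-bound add-new       = z≤n
add-row-bound (add-here lt) = z≤n
add-row-bound (add-there m) = s≤s (add-row-bound m)

-- Positivity excludes a row of length zero, whose growth would be indistinguishable from opening a
-- new row.
add-unique : ∀ {p p′ q q′ r xs xs′ ys} → Part q xs → Part q′ xs′ → Add p r xs ys → Add p′ r xs′ ys → xs ≡ xs′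
add-unique _ _ add-new       add-new        = refl
add-unique _ (part-cons () _ _) add-new (add-here lt)
add-unique (part-cons () _ _) _ (add-here lt) add-new
add-unique _ _ (add-here lt) (add-here lt′) = refl
add-unique (part-cons _ _ pt) (part-cons _ _ pt′) (add-there m) (add-there m′) = cong (_ ∷_) (add-unique pt pt′ m m′)

remove-corner : ∀ {p ys} r j → Part p ys → rowLen ys r ≡ suc j → rowLen ys (suc r) ≤ j →
                ∃ λ xs → Part p xs × Add p r xs ys
remove-corner r j part-nil () _
remove-corner zero zero (part-cons _ (s≤s z≤n) part-nil) refl z≤n = [] , part-nil , add-new
remove-corner zero zero (part-cons _ _ (part-cons (s≤s _) _ _)) refl ()
remove-corner zero (suc j) (part-cons 0<y y≤p pt) refl le =
  suc j ∷ _ , part-cons (s≤s z≤n) (ℕₚ.<⇒≤ y≤p) (part-head le pt) , add-here y≤p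
remove-corner (suc r) j (part-cons {x = y} 0<y y≤p pt) e le with remove-corner r j pt e le
... | xs , pt′ , m = y ∷ xs , part-cons 0<y y≤p pt′ , add-there m

add-inShape⁺ : ∀ {p r xs ys} → Add p r xs ys → ∀ {c} → InShape xs c → InShape ys c
add-inShape⁺ {r = r} m {i , j} lt with i ≟ r
... | yes refl = subst (j <_) (sym (add-row-≡ m)) (ℕₚ.m<n⇒m<1+n lt)
... | no ne    = subst (j <_) (sym (add-row-≢ m i ne)) lt

add-inShape⁻ : ∀ {p r xs ys} → Add p r xs ys → ∀ {c} → InShape ys c → InShape xs c ⊎ c ≡ (r , rowLen xs r)
add-inShape⁻ {r = r} {xs} m {i , j} lt with i ≟ r
... | no ne    = inj₁ (subst (j <_) (add-row-≢ m i ne) lt)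
... | yes refl with ℕₚ.m≤n⇒m<n∨m≡n (ℕₚ.≤-pred (subst (j <_) (add-row-≡ m) lt))
...   | inj₁ lt′  = inj₁ lt′
...   | inj₂ refl = inj₂ refl

init : ∀ {A : Set} {n} → (Fin (suc n) → A) → Fin n → A
init f k = f (inject₁ k)

toℕ-last : ∀ {n} (k : Fin (suc n)) → ¬ (n < toℕ k)
toℕ-last k lt = ℕₚ.<⇒≱ (Finₚ.toℕ<n k) lt

extend-SYT : ∀ {n p q r xs ys} {T : Fin (suc n) → Cell} → Part q xs → Add p r xs ys →
  T (fromℕ n) ≡ (r , rowLen xs r) → IsSYT n xs (init T) → IsSYT (suc n) ys T
extend-SYT {n} {r = r} {xs} {ys} {T} pt m eq S = record
  { inShape = shape ; injective = inj ; surjective = surj ; rowsIncrease = rows ; colsIncrease = cols }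
  where
  open IsSYT S
  new-outside : ∀ {i} → ¬ (T (inject₁ i) ≡ T (fromℕ n))
  new-outside {i} e = ℕₚ.<-irrefl refl (subst (InShape xs) (trans e eq) (inShape i))
  shape : ∀ k → InShape ys (T k)
  shape k with view k
  ... | ‵fromℕ = subst (InShape ys) (sym eq) (ℕₚ.≤-reflexive (sym (add-row-≡ m)))
  ... | ‵inject₁ i = add-inShape⁺ m (inShape i)
  inj : ∀ k l → T k ≡ T l → k ≡ l
  inj k l e with view k | view l
  ... | ‵fromℕ     | ‵fromℕ     = refl
  ... | ‵fromℕ     | ‵inject₁ i = ⊥-elim (new-outside {i} (sym e))
  ... | ‵inject₁ i | ‵fromℕ     = ⊥-elim (new-outside {i} e)
  ... | ‵inject₁ i | ‵inject₁ j = cong inject₁ (injective i j e)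
  surj : ∀ i j → InShape ys (i , j) → ∃ λ k → T k ≡ (i , j)
  surj i j lt with add-inShape⁻ m {i , j} lt
  ... | inj₂ e   = fromℕ n , trans eq (sym e)
  ... | inj₁ lt′ with surjective i j lt′
  ...   | k , e = inject₁ k , e
  before : ∀ (i : Fin n) → toℕ (inject₁ i) < toℕ (fromℕ n)
  before i = subst₂ _<_ (sym (Finₚ.toℕ-inject₁ i)) (sym (Finₚ.toℕ-fromℕ n)) (Finₚ.toℕ<n i)
  rows : ∀ k l → proj₁ (T l) ≡ proj₁ (T k) → proj₂ (T l) ≡ suc (proj₂ (T k)) → toℕ k < toℕ l
  rows k l e f with view k | view l
  ... | ‵fromℕ     | ‵fromℕ     = ⊥-elim (ℕₚ.<-irrefl f (ℕₚ.n<1+n _))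
  ... | ‵inject₁ i | ‵fromℕ     = before i
  ... | ‵inject₁ i | ‵inject₁ j =
        subst₂ _<_ (sym (Finₚ.toℕ-inject₁ i)) (sym (Finₚ.toℕ-inject₁ j)) (rowsIncrease i j e f)
  ... | ‵fromℕ     | ‵inject₁ i = ⊥-elim (ℕₚ.<⇒≱ (subst₂ (λ x y → x < rowLen xs y)
        (trans f (cong (λ c → suc (proj₂ c)) eq)) (trans e (cong proj₁ eq)) (inShape i)) (ℕₚ.n≤1+n _))
  cols : ∀ k l → proj₂ (T l) ≡ proj₂ (T k) → proj₁ (T l) ≡ suc (proj₁ (T k)) → toℕ k < toℕ l
  cols k l e f with view k | view l
  ... | ‵fromℕ     | ‵fromℕ     = ⊥-elim (ℕₚ.<-irrefl f (ℕₚ.n<1+n _))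
  ... | ‵inject₁ i | ‵fromℕ     = before i
  ... | ‵inject₁ i | ‵inject₁ j =
        subst₂ _<_ (sym (Finₚ.toℕ-inject₁ i)) (sym (Finₚ.toℕ-inject₁ j)) (colsIncrease i j e f)
  ... | ‵fromℕ     | ‵inject₁ i = ⊥-elim (ℕₚ.<⇒≱ (subst₂ (λ x y → x < rowLen xs y)
        (trans e (cong proj₂ eq)) (trans f (cong (λ c → suc (proj₁ c)) eq)) (inShape i)) (part-row pt r))

restrict-SYT : ∀ {n p r xs ys} {T : Fin (suc n) → Cell} → Add p r xs ys →
  T (fromℕ n) ≡ (r , rowLen xs r) → IsSYT (suc n) ys T → IsSYT n xs (init T)
restrict-SYT {n} {r = r} {xs} {ys} {T} m eq S = record
  { inShape = shape
  ; injective = λ k l e → Finₚ.inject₁-injective (injective _ _ e)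
  ; surjective = surj
  ; rowsIncrease = λ k l e f → subst₂ _<_ (Finₚ.toℕ-inject₁ k) (Finₚ.toℕ-inject₁ l) (rowsIncrease _ _ e f)
  ; colsIncrease = λ k l e f → subst₂ _<_ (Finₚ.toℕ-inject₁ k) (Finₚ.toℕ-inject₁ l) (colsIncrease _ _ e f) }
  where
  open IsSYT S
  shape : ∀ k → InShape xs (T (inject₁ k))
  shape k with add-inShape⁻ m {T (inject₁ k)} (inShape (inject₁ k))
  ... | inj₁ lt = lt
  ... | inj₂ e  = ⊥-elim (Finₚ.fromℕ≢inject₁ (injective _ _ (trans eq (sym e))))
  surj : ∀ i j → InShape xs (i , j) → ∃ λ k → T (inject₁ k) ≡ (i , j)
  surj i j lt with surjective i j (add-inShape⁺ m {i , j} lt)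
  ... | k , e with view k
  ...   | ‵inject₁ l = l , e
  ...   | ‵fromℕ     = ⊥-elim (ℕₚ.<-irrefl refl (subst (InShape xs) (trans (sym e) eq) lt))

-- A cell to the right of the largest entry, or below it, would have to hold a larger one.
last-corner : ∀ {n ys} {T : Fin (suc n) → Cell} → IsSYT (suc n) ys T → let (r , j) = T (fromℕ n) in
  rowLen ys r ≡ suc j × rowLen ys (suc r) ≤ j
last-corner {n} {ys} {T} S = ℕₚ.≤-antisym (ℕₚ.≮⇒≥ right) (inShape (fromℕ n)) , ℕₚ.≮⇒≥ below
  where
  open IsSYT S
  r j : ℕ
  r = proj₁ (T (fromℕ n))
  j = proj₂ (T (fromℕ n))
  late : ∀ k → ¬ (toℕ (fromℕ n) < toℕ k)
  late k lt = toℕ-last k (subst (_< toℕ k) (Finₚ.toℕ-fromℕ n) lt)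
  right : ¬ (suc j < rowLen ys r)
  right lt with surjective r (suc j) lt
  ... | k , e = late k (rowsIncrease (fromℕ n) k (cong proj₁ e) (cong proj₂ e))
  below : ¬ (j < rowLen ys (suc r))
  below lt with surjective (suc r) j lt
  ... | k , e = late k (colsIncrease (fromℕ n) k (cong proj₂ e) (cong proj₁ e))

SYT-resp : ∀ {n xs} {T U : Fin n → Cell} → (∀ k → T k ≡ U k) → IsSYT n xs T → IsSYT n xs U
SYT-resp {n} {xs} {T} {U} eq S = record
  { inShape = λ k → subst (InShape xs) (eq k) (inShape k)
  ; injective = λ k l e → injective k l (trans (eq k) (trans e (sym (eq l))))
  ; surjective = λ i j lt → proj₁ (surjective i j lt) , trans (sym (eq _)) (proj₂ (surjective i j lt))
  ; rowsIncrease = λ k l e f → rowsIncrease k l (subst₂ (λ x y → proj₁ x ≡ proj₁ y) (sym (eq l)) (sym (eq k)) e)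
                                                (subst₂ (λ x y → proj₂ x ≡ suc (proj₂ y)) (sym (eq l)) (sym (eq k)) f)
  ; colsIncrease = λ k l e f → colsIncrease k l (subst₂ (λ x y → proj₂ x ≡ proj₂ y) (sym (eq l)) (sym (eq k)) e)
                                                (subst₂ (λ x y → proj₁ x ≡ suc (proj₁ y)) (sym (eq l)) (sym (eq k)) f) }
  where open IsSYT S

lookup-∷ʳ-last : ∀ {A : Set} {n} (xs : Vec A n) x → lookup (xs ∷ʳ x) (fromℕ n) ≡ x
lookup-∷ʳ-last []       x = refl
lookup-∷ʳ-last (y ∷ ys) x = lookup-∷ʳ-last ys x

lookup-∷ʳ-init : ∀ {A : Set} {n} (xs : Vec A n) x k → lookup (xs ∷ʳ x) (inject₁ k) ≡ lookup xs k
lookup-∷ʳ-init (y ∷ ys) x zero    = refl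
lookup-∷ʳ-init (y ∷ ys) x (suc k) = lookup-∷ʳ-init ys x k

Tableau : ℕ → Set
Tableau n = List ℕ × Vec Cell n

fits : Fin 2 → List ℕ → ℕ × List ℕ → Set
fits b xs (r , ys) = residue (r , rowLen xs r) ≡ b

fits? : ∀ b xs → Decidable (fits b xs)
fits? b xs (r , ys) = residue (r , rowLen xs r) ≟F b

grown : ∀ {n} → List ℕ → Vec Cell n → ℕ × List ℕ → Tableau (suc n)
grown xs T (r , ys) = ys , T ∷ʳ (r , rowLen xs r)

children : List ℕ → List (ℕ × List ℕ)
children xs = kids (suc (rowLen xs 0)) xs

extend : ∀ {n} → Fin 2 → Tableau n → List (Tableau (suc n))
extend b (xs , T) = map (grown xs T) (filter (fits? b xs) (children xs))

growth : ∀ {n} → (Fin n → Fin 2) → List (Tableau n)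
growth {zero}  v = ([] , []) ∷ []
growth {suc n} v = concatMap (extend (v (fromℕ n))) (growth (init v))

Good : ∀ {n} → (Fin n → Fin 2) → Tableau n → Set
Good {n} v (xs , T) = IsPartition n xs × IsSYT n xs (lookup T) × HasResidues (lookup T) v

extend⁻ : ∀ {n} b xs (T : Vec Cell n) {t} → t ∈ extend b (xs , T) →
          ∃₂ λ r ys → Add (suc (rowLen xs 0)) r xs ys × residue (r , rowLen xs r) ≡ b × t ≡ grown xs T (r , ys)
extend⁻ b xs T m with ∈-map⁻ (grown xs T) m
... | (r , ys) , m′ , e with ∈-filter⁻ (fits? b xs) m′
...   | m″ , res = r , ys , kids⇒Add _ xs m″ , res , e

growth-sound : ∀ {n} (v : Fin n → Fin 2) {t} → t ∈ growth v → Good v t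
growth-sound {zero} v (here refl) = (refl , dec-nil , pos-nil) ,
  record { inShape = λ () ; injective = λ () ; surjective = λ _ _ () ; rowsIncrease = λ () ; colsIncrease = λ () } , λ ()
growth-sound {suc n} v m with find (∈-concatMap⁻ (extend (v (fromℕ n))) {xs = growth (init v)} m)
... | (xs , T) , m₀ , m₁ with growth-sound (init v) m₀ | extend⁻ _ xs T m₁
...   | isP , S , R | r , ys , ad , res , refl =
  subst (λ k → IsPartition k ys) (trans (add-sum ad) (cong suc (proj₁ isP)))
        (Part⇒IsPartition (add-part ad (part-mono (ℕₚ.n≤1+n _) pt)))
  , extend-SYT pt ad (lookup-∷ʳ-last T _) (SYT-resp (λ k → sym (lookup-∷ʳ-init T _ k)) S)
  , residues
  where
  pt : Part (rowLen xs 0) xs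
  pt = IsPartition⇒Part isP
  residues : HasResidues (lookup (T ∷ʳ (r , rowLen xs r))) v
  residues k with view k
  ... | ‵fromℕ     = trans (cong residue (lookup-∷ʳ-last T _)) res
  ... | ‵inject₁ i = trans (cong residue (lookup-∷ʳ-init T _ i)) (R i)

IsPartition-0 : ∀ {xs} → IsPartition 0 xs → xs ≡ []
IsPartition-0 {[]} _ = refl
IsPartition-0 {suc x ∷ xs} (() , _)
IsPartition-0 {zero ∷ xs} (_ , _ , pos-cons () _)

growth-complete : ∀ {n} (v : Fin n → Fin 2) t → Good v t → t ∈ growth v
growth-complete {zero} v (xs , []) (isP , _) rewrite IsPartition-0 isP = here refl
growth-complete {suc n} v (ys , U) (isP , S , R) with initLast U
... | T , (r , j) , refl with last-corner S
...   | right , below rewrite lookup-∷ʳ-last T (r , j) with remove-corner r j (IsPartition⇒Part isP) right below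
...     | xs , pt , ad = ∈-concatMap⁺ (extend (v (fromℕ n))) (lose prefix (subst (_∈ extend (v (fromℕ n)) (xs , T)) cell child))
  where
  row : rowLen xs r ≡ j
  row = ℕₚ.suc-injective (trans (sym (add-row-≡ ad)) right)
  cell : grown xs T (r , ys) ≡ (ys , T ∷ʳ (r , j))
  cell = cong (λ c → ys , T ∷ʳ (r , c)) row
  sum-xs : sum xs ≡ n
  sum-xs = ℕₚ.suc-injective (trans (sym (add-sum ad)) (proj₁ isP))
  prefix : (xs , T) ∈ growth (init v)
  prefix = growth-complete (init v) (xs , T)
    ( subst (λ k → IsPartition k xs) sum-xs (Part⇒IsPartition pt)
    , SYT-resp (lookup-∷ʳ-init T _)
        (restrict-SYT ad (trans (lookup-∷ʳ-last T _) (cong (r ,_) (sym row))) S)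
    , λ k → trans (cong residue (sym (lookup-∷ʳ-init T _ k))) (R (inject₁ k)) )
  child : grown xs T (r , ys) ∈ extend (v (fromℕ n)) (xs , T)
  child = ∈-map⁺ (grown xs T) (∈-filter⁺ (fits? (v (fromℕ n)) xs)
    (Add⇒kids (add-mono (add-head ad) ad))
    (trans (cong (λ c → residue (r , c)) row) (trans (cong residue (sym (lookup-∷ʳ-last T (r , j)))) (R (fromℕ n)))))

concatMap-unique : ∀ {A B : Set} (f : A → List B) xs → Unique xs → (∀ x → x ∈ xs → Unique (f x)) →
  (∀ x y z → x ∈ xs → y ∈ xs → z ∈ f x → z ∈ f y → x ≡ y) → Unique (concatMap f xs)
concatMap-unique f [] _ _ _ = []
concatMap-unique f (x ∷ xs) (ne ∷ u) uf dis =
  Uniqueₚ.++⁺ (uf x (here refl))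
    (concatMap-unique f xs u (λ y p → uf y (there p)) (λ y z w p q → dis y z w (there p) (there q)))
    (λ { (p , q) → let (y , y∈ , w∈) = find (∈-concatMap⁻ f {xs = xs} q) in
         All.lookup ne y∈ (dis x y _ (here refl) (there y∈) p w∈) })

kids-unique : ∀ p xs → Unique (kids p xs)
kids-unique zero    []       = []
kids-unique (suc p) []       = [] ∷ []
kids-unique p       (x ∷ xs) with x <? p
... | no _  = Uniqueₚ.map⁺ (λ { refl → refl }) (kids-unique x xs)
... | yes _ = All.tabulate (λ m e → distinct (∈-map⁻ (lower x) m) e) ∷ Uniqueₚ.map⁺ (λ { refl → refl }) (kids-unique x xs)
  where
  distinct : ∀ {t} → (∃ λ c → c ∈ kids x xs × t ≡ lower x c) → (0 , suc x ∷ xs) ≢ t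
  distinct (_ , _ , refl) ()

-- A grown tableau determines its parent: the last cell gives the row, and shape and row determine
-- the previous shape.
growth-unique : ∀ {n} (v : Fin n → Fin 2) → Unique (growth v)
growth-unique {zero}  v = [] ∷ []
growth-unique {suc n} v = concatMap-unique (extend (v (fromℕ n))) (growth (init v)) (growth-unique (init v))
  (λ { (xs , T) _ → Uniqueₚ.map⁺ (grown-injective xs T) (Uniqueₚ.filter⁺ (fits? _ xs) (kids-unique _ xs)) })
  disjoint
  where
  grown-injective : ∀ xs (T : Vec Cell n) {s t} → grown xs T s ≡ grown xs T t → s ≡ t
  grown-injective xs T e = cong₂ _,_ (cong proj₁ (Vecₚ.∷ʳ-injectiveʳ T T (cong proj₂ e))) (cong proj₁ e)
  disjoint : ∀ s t z → s ∈ growth (init v) → t ∈ growth (init v) → z ∈ extend (v (fromℕ n)) s →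
             z ∈ extend (v (fromℕ n)) t → s ≡ t
  disjoint (xs , T) (xs′ , T′) z p q zs zt with extend⁻ _ xs T zs | extend⁻ _ xs′ T′ zt
  ... | r , ys , ad , _ , e | r′ , ys′ , ad′ , _ , e′ = cong₂ _,_ same-shape (Vecₚ.∷ʳ-injectiveˡ T T′ rows)
    where
    rows : T ∷ʳ (r , rowLen xs r) ≡ T′ ∷ʳ (r′ , rowLen xs′ r′)
    rows = cong proj₂ (trans (sym e) e′)
    same-shape : xs ≡ xs′
    same-shape = add-unique (IsPartition⇒Part (proj₁ (growth-sound (init v) p))) (IsPartition⇒Part (proj₁ (growth-sound (init v) q))) ad
      (subst₂ (λ i zs → Add (suc (rowLen xs′ 0)) i xs′ zs) (sym (cong proj₁ (Vecₚ.∷ʳ-injectiveʳ T T′ rows)))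
              (sym (cong proj₁ (trans (sym e) e′))) ad′)

-- From tableaux to the pairing

Σl-filter : ∀ {A : Set} {P : A → Set} (P? : Decidable P) (f g : A → ℤ) xs →
  (∀ x → x ∈ xs → P x → f x ≡ g x) → (∀ x → x ∈ xs → ¬ P x → f x ≡ 0ℤ) → Σl f xs ≡ Σl g (filter P? xs)
Σl-filter P? f g [] yes′ no′ = refl
Σl-filter P? f g (x ∷ xs) yes′ no′ with P? x
... | yes p = cong₂ _+ᶻ_ (yes′ x (here refl) p) (Σl-filter P? f g xs (λ y m → yes′ y (there m)) (λ y m → no′ y (there m)))
... | no ¬p = trans (cong₂ _+ᶻ_ (no′ x (here refl) ¬p) (Σl-filter P? f g xs (λ y m → yes′ y (there m)) (λ y m → no′ y (there m))))
                    (+ᶻ-identityˡ _)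

extend-sum : ∀ K b {n} xs (T : Vec Cell n) (g : Fun (suc (dbl K))) → length xs ≤ dbl K →
  Σl (childTerm (wt b) g xs) (children xs) ≡ Σl (λ t → g (beads _ (proj₁ t))) (extend b (xs , T))
extend-sum K b xs T g le =
  trans (Σl-filter (fits? b xs) _ (λ t → g (beads _ (proj₂ t))) (children xs) fit unfit)
        (sym (Σl-map _ (grown xs T) (filter (fits? b xs) (children xs))))
  where
  weight-at : ∀ {r ys} → (r , ys) ∈ children xs → wt b (rowLen xs r + (dbl K ∸ r)) ≡ wt b (r + rowLen xs r)
  weight-at {r} m = wt-position K b r (rowLen xs r) (ℕₚ.≤-trans (add-row-bound (kids⇒Add _ xs m)) le)
  fit : ∀ t → t ∈ children xs → fits b xs t → childTerm (wt b) g xs t ≡ g (beads _ (proj₂ t))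
  fit (r , ys) m e = trans (cong (_*ᶻ g (beads _ ys)) (trans (weight-at m) (wt-yes b (r + rowLen xs r) e))) (*ᶻ-identityˡ _)
  unfit : ∀ t → t ∈ children xs → ¬ fits b xs t → childTerm (wt b) g xs t ≡ 0ℤ
  unfit (r , ys) m ne = trans (cong (_*ᶻ g (beads _ ys)) (trans (weight-at m) (wt-no b (r + rowLen xs r) ne))) (*ᶻ-zeroˡ _)

-- Peeling off the last letter turns the sum over added cells into one bead move. The bound on `n`
-- keeps a spare bead for a new row.
growth-sum : ∀ K {n} (v : Fin n → Fin 2) → n ≤ dbl K → ∀ (g : Fun (suc (dbl K))) → Alt g →
  Σl (λ t → g (beads _ (proj₁ t))) (growth v) ≡ app (word v) g
growth-sum K {zero} v le g A = trans (+ᶻ-identityʳ _) (cong g (beads-[] (suc (dbl K))))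
growth-sum K {suc n} v le g A = trans (Σl-concatMap _ (extend b) (growth (init v)))
  (trans (Σl-cong (growth (init v)) children-sum)
         (growth-sum K (init v) (ℕₚ.<⇒≤ le) (oneBody (wt b) suc g) (oneBody-alt (wt b) suc A)))
  where
  b : Fin 2
  b = v (fromℕ n)
  children-sum : ∀ t → t ∈ growth (init v) →
    Σl (λ t → g (beads _ (proj₁ t))) (extend b t) ≡ oneBody (wt b) suc g (beads _ (proj₁ t))
  children-sum (xs , T) m = sym (trans
    (oneBody-kids (wt b) (suc (dbl K)) (suc (rowLen xs 0)) xs A (part-mono (ℕₚ.n≤1+n _) pt) (inj₁ (s≤s len))
      -- The bound on the first row is one more than its length, so no bead above it can obstruct a
      -- move.
      (λ e → ⊥-elim (ℕₚ.<-irrefl e (ℕₚ.n<1+n _))))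
    (extend-sum K b xs T g len))
    where
    isP : IsPartition n xs
    isP = proj₁ (growth-sound (init v) m)
    pt : Part (rowLen xs 0) xs
    pt = IsPartition⇒Part isP
    len : length xs ≤ dbl K
    len = ℕₚ.≤-trans (part-length pt) (ℕₚ.≤-trans (ℕₚ.≤-reflexive (proj₁ isP)) (ℕₚ.<⇒≤ le))

module _ {A : Set} where
  Σl-↭ : ∀ (f : A → ℤ) {xs ys} → xs ↭ ys → Σl f xs ≡ Σl f ys
  Σl-↭ f Perm.refl          = refl
  Σl-↭ f (Perm.prep x p)    = cong (f x +ᶻ_) (Σl-↭ f p)
  Σl-↭ f (Perm.swap x y p)  = trans (cong (λ z → f x +ᶻ (f y +ᶻ z)) (Σl-↭ f p))
    (trans (sym (+ᶻ-assoc _ _ _)) (trans (cong (_+ᶻ _) (+ᶻ-comm _ _)) (+ᶻ-assoc _ _ _)))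
  Σl-↭ f (Perm.trans p q)   = trans (Σl-↭ f p) (Σl-↭ f q)

  Σl-const : ∀ (xs : List A) c → Σl (λ _ → c) xs ≡ (+ length xs) *ᶻ c
  Σl-const []       c = sym (*ᶻ-zeroˡ _)
  Σl-const (x ∷ xs) c = trans (cong (c +ᶻ_) (Σl-const xs c)) (ring-suc (length xs) c)

  Σl-zero : ∀ (f : A → ℤ) xs → (∀ x → x ∈ xs → f x ≡ 0ℤ) → Σl f xs ≡ 0ℤ
  Σl-zero f []       e = refl
  Σl-zero f (x ∷ xs) e = trans (cong₂ _+ᶻ_ (e x (here refl)) (Σl-zero f xs (λ y p → e y (there p)))) (+ᶻ-identityʳ _)

  Σl-single : ∀ (f : A → ℤ) {xs} → Unique xs → ∀ {x} → x ∈ xs → (∀ y → y ∈ xs → x ≢ y → f y ≡ 0ℤ) → Σl f xs ≡ f x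
  Σl-single f {x ∷ xs} (ne ∷ u) (here refl) e =
    trans (cong (f x +ᶻ_) (Σl-zero f xs (λ y p → e y (there p) (All.lookup ne p)))) (+ᶻ-identityʳ _)
  Σl-single f {y ∷ xs} (ne ∷ u) (there p) e =
    trans (cong₂ _+ᶻ_ (e y (here refl) (λ { refl → All.lookup ne p refl })) (Σl-single f u p (λ z q → e z (there q))))
          (+ᶻ-identityˡ _)

-- Enumerated fillings and growth sequences.

length-filter-map : ∀ {A B : Set} {P : B → Set} (P? : Decidable P) (f : A → B) xs →
  length (filter P? (map f xs)) ≡ length (filter (λ x → P? (f x)) xs)
length-filter-map P? f []       = refl
length-filter-map P? f (x ∷ xs) with P? (f x)
... | yes _ = cong suc (length-filter-map P? f xs)
... | no _  = length-filter-map P? f xs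

vecsOf-unique : ∀ {A : Set} (xs : List A) n → Unique xs → Unique (vecsOf xs n)
vecsOf-unique xs zero    u = [] ∷ []
vecsOf-unique xs (suc n) u = concatMap-unique (λ x → map (Vec._∷_ x) (vecsOf xs n)) xs u
  (λ x _ → Uniqueₚ.map⁺ Vecₚ.∷-injectiveʳ (vecsOf-unique xs n u))
  (λ x y z _ _ p q → trans (sym (head-of p)) (head-of q))
  where
  head-of : ∀ {x z} → z ∈ map (Vec._∷_ x) (vecsOf xs n) → Data.Vec.head z ≡ x
  head-of {x} m with ∈-map⁻ (Vec._∷_ x) m
  ... | _ , _ , refl = refl

vecsOf-complete : ∀ {A : Set} (xs : List A) {n} (T : Vec A n) → (∀ k → lookup T k ∈ xs) → T ∈ vecsOf xs n
vecsOf-complete xs []      H = here refl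
vecsOf-complete xs {suc n} (t ∷ T) H = ∈-concatMap⁺ (λ x → map (Vec._∷_ x) (vecsOf xs n))
  (lose (H zero) (∈-map⁺ (Vec._∷_ t) (vecsOf-complete xs T (λ k → H (suc k)))))

boxCells-unique : ∀ n → Unique (boxCells n)
boxCells-unique n = concatMap-unique (λ i → map (i ,_) (upTo n)) (upTo n) (Uniqueₚ.upTo⁺ n)
  (λ i _ → Uniqueₚ.map⁺ (λ { refl → refl }) (Uniqueₚ.upTo⁺ n))
  (λ i j z _ _ p q → trans (sym (row-of p)) (row-of q))
  where
  row-of : ∀ {i z} → z ∈ map (i ,_) (upTo n) → proj₁ z ≡ i
  row-of {i} m with ∈-map⁻ (i ,_) m
  ... | _ , _ , refl = refl

boxCells-complete : ∀ n {i j} → i < n → j < n → (i , j) ∈ boxCells n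
boxCells-complete n {i} i<n j<n =
  ∈-concatMap⁺ (λ i → map (i ,_) (upTo n)) (lose (∈-upTo⁺ i<n) (∈-map⁺ (i ,_) (∈-upTo⁺ j<n)))

rowLen-row : ∀ xs {i j} → j < rowLen xs i → i < length xs
rowLen-row (x ∷ xs) {zero}  lt = s≤s z≤n
rowLen-row (x ∷ xs) {suc i} lt = s≤s (rowLen-row xs lt)

rowLen≤sum : ∀ xs i → rowLen xs i ≤ sum xs
rowLen≤sum []       i       = z≤n
rowLen≤sum (x ∷ xs) zero    = ℕₚ.m≤m+n x _
rowLen≤sum (x ∷ xs) (suc i) = ℕₚ.≤-trans (rowLen≤sum xs i) (ℕₚ.m≤n+m _ x)

module Partitions {n : ℕ} (ps : List (List ℕ)) (unique : Unique ps) (isAll : ∀ μ → μ ∈ ps ⇔ IsPartition n μ) where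

  good? : (v : Fin n → Fin 2) (μ : List ℕ) → Decidable (λ T → IsSYT n μ T × HasResidues T v)
  good? v μ T = isSYT? n μ T ×-dec hasResidues? T v

  tableaux : (Fin n → Fin 2) → List ℕ → List (Vec Cell n)
  tableaux v μ = filter (λ T → good? v μ (lookup T)) (vecsOf (boxCells n) n)

  C₂≡length : ∀ v μ → C₂ v μ ≡ length (tableaux v μ)
  C₂≡length v μ = length-filter-map (good? v μ) lookup (vecsOf (boxCells n) n)

  shaped : (Fin n → Fin 2) → List ℕ → List (Tableau n)
  shaped v μ = map (μ ,_) (tableaux v μ)

  all-shaped : (Fin n → Fin 2) → List (Tableau n)
  all-shaped v = concatMap (shaped v) ps

  shaped⁻ : ∀ v μ {t} → t ∈ shaped v μ → proj₁ t ≡ μ × IsSYT n μ (lookup (proj₂ t)) × HasResidues (lookup (proj₂ t)) v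
  shaped⁻ v μ m with ∈-map⁻ (μ ,_) m
  ... | T , m′ , refl = refl , proj₂ (∈-filter⁻ (λ T → good? v μ (lookup T)) {xs = vecsOf (boxCells n) n} m′)

  all-shaped-unique : ∀ v → Unique (all-shaped v)
  all-shaped-unique v = concatMap-unique (shaped v) ps unique
    (λ μ _ → Uniqueₚ.map⁺ (λ { refl → refl })
      (Uniqueₚ.filter⁺ (λ T → good? v μ (lookup T)) (vecsOf-unique (boxCells n) n (boxCells-unique n))))
    (λ μ ν z _ _ p q → trans (sym (proj₁ (shaped⁻ v μ p))) (proj₁ (shaped⁻ v ν q)))

  all-shaped-sound : ∀ v {t} → t ∈ all-shaped v → Good v t
  all-shaped-sound v {t} m with find (∈-concatMap⁻ (shaped v) {xs = ps} m)
  ... | μ , μ∈ , m′ with shaped⁻ v μ m′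
  ...   | refl , good = Equivalence.to (isAll μ) μ∈ , good

  all-shaped-complete : ∀ v {t} → Good v t → t ∈ all-shaped v
  all-shaped-complete v {μ , T} (isP , S , R) = ∈-concatMap⁺ (shaped v) (lose (Equivalence.from (isAll μ) isP)
    (∈-map⁺ (μ ,_) (∈-filter⁺ (λ T → good? v μ (lookup T)) (vecsOf-complete (boxCells n) T inBox) (S , R))))
    where
    sum≤n : sum μ ≤ n
    sum≤n = ℕₚ.≤-reflexive (proj₁ isP)
    inBox : ∀ k → lookup T k ∈ boxCells n
    inBox k = boxCells-complete n
      (ℕₚ.<-≤-trans (rowLen-row μ (IsSYT.inShape S k)) (ℕₚ.≤-trans (part-length (IsPartition⇒Part isP)) sum≤n))
      (ℕₚ.<-≤-trans (IsSYT.inShape S k) (ℕₚ.≤-trans (rowLen≤sum μ _) sum≤n))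

  -- The filtered candidates, collected over all shapes, and the growth sequences are duplicate-free
  -- lists with the same members, hence permutations of each other.
  Σ-C₂ : ∀ v (G : List ℕ → ℤ) → Σl (λ μ → (+ C₂ v μ) *ᶻ G μ) ps ≡ Σl (λ t → G (proj₁ t)) (growth v)
  Σ-C₂ v G = trans (Σl-cong ps (λ μ _ → trans (cong (λ k → (+ k) *ᶻ G μ) (C₂≡length v μ))
      (trans (sym (Σl-const (tableaux v μ) (G μ))) (sym (Σl-map (λ t → G (proj₁ t)) (μ ,_) (tableaux v μ))))))
    (trans (sym (Σl-concatMap (λ t → G (proj₁ t)) (shaped v) ps))
      (Σl-↭ (λ t → G (proj₁ t)) (∼bag⇒↭ (unique∧set⇒bag (all-shaped-unique v) (growth-unique v)
        (mk⇔ (λ m → growth-complete v _ (all-shaped-sound v m)) (λ m → all-shaped-complete v (growth-sound v m)))))))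

-- Orthonormality of bead configurations.

data Desc : ∀ {n} → Vec ℕ n → Set where
  desc-nil  : Desc []
  desc-cons : ∀ {n a} {as : Vec ℕ n} → Allᵥ (_< a) as → Desc as → Desc (a ∷ as)

eqᶻ-refl : ∀ a → eqᶻ a a ≡ 1ℤ
eqᶻ-refl zero    = refl
eqᶻ-refl (suc a) = eqᶻ-refl a

eqᶻ-≢ : ∀ {a b} → a ≢ b → eqᶻ a b ≡ 0ℤ
eqᶻ-≢ {zero}  {zero}  ne = ⊥-elim (ne refl)
eqᶻ-≢ {zero}  {suc b} ne = refl
eqᶻ-≢ {suc a} {zero}  ne = refl
eqᶻ-≢ {suc a} {suc b} ne = eqᶻ-≢ (λ e → ne (cong suc e))

minus-0 : ∀ {x y z} → x ≡ z → y ≡ 0ℤ → x +ᶻ -ᶻ y ≡ z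
minus-0 {x} refl refl = trans (cong (x +ᶻ_) neg-0) (+ᶻ-identityʳ x)

wedge-zero : ∀ {n} b {h : Fun n} → (∀ as → h as ≡ 0ℤ) → ∀ as → wedge b h as ≡ 0ℤ
wedge-zero {zero}  b e (a ∷ []) = trans (cong (eqᶻ a b *ᶻ_) (e [])) (*ᶻ-zeroʳ _)
wedge-zero {suc n} b e (a ∷ as) = minus-0 (trans (cong (eqᶻ a b *ᶻ_) (e as)) (*ᶻ-zeroʳ _)) (wedge-zero b (λ r → e (a ∷ r)) as)

wedge-above : ∀ {n} b (h : Fun n) as → Allᵥ (_< b) as → wedge b h as ≡ 0ℤ
wedge-above {zero}  b h (a ∷ []) (lt ∷ []) = trans (cong (_*ᶻ h []) (eqᶻ-≢ (ℕₚ.<⇒≢ lt))) (*ᶻ-zeroˡ _)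
wedge-above {suc n} b h (a ∷ as) (lt ∷ ls) =
  minus-0 (trans (cong (_*ᶻ h as) (eqᶻ-≢ (ℕₚ.<⇒≢ lt))) (*ᶻ-zeroˡ _)) (wedge-above b (λ r → h (a ∷ r)) as ls)

ker-above : ∀ {n} {bs : Vec ℕ (suc n)} {a} → Allᵥ (_< a) bs → ∀ as → ker bs (a ∷ as) ≡ 0ℤ
ker-above {zero} {b ∷ []} (lt ∷ []) [] = trans (cong (_*ᶻ 1ℤ) (eqᶻ-≢ (λ e → ℕₚ.<⇒≢ lt (sym e)))) (*ᶻ-zeroˡ _)
ker-above {suc n} {b ∷ bs} (lt ∷ ls) as =
  minus-0 (trans (cong (_*ᶻ ker bs as) (eqᶻ-≢ (λ e → ℕₚ.<⇒≢ lt (sym e)))) (*ᶻ-zeroˡ _))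
          (wedge-zero b (ker-above ls) as)

ker-head : ∀ {n} b (bs : Vec ℕ n) as → Allᵥ (_< b) bs → ker (b ∷ bs) (b ∷ as) ≡ ker bs as
ker-head {zero}  b [] [] _ = trans (cong (_*ᶻ 1ℤ) (eqᶻ-refl b)) (*ᶻ-identityˡ _)
ker-head {suc n} b bs as ls =
  minus-0 (trans (cong (_*ᶻ ker bs as) (eqᶻ-refl b)) (*ᶻ-identityˡ _)) (wedge-zero b (ker-above ls) as)

ker-≡ : ∀ {n} {bs : Vec ℕ n} → Desc bs → ker bs bs ≡ 1ℤ
ker-≡ desc-nil           = refl
ker-≡ (desc-cons ls d) = trans (ker-head _ _ _ ls) (ker-≡ d)

-- At the first disagreement the larger of the two leading beads exceeds all beads of the other
-- configuration, so it can be matched with none.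
ker-≢ : ∀ {n} {bs as : Vec ℕ n} → Desc bs → Desc as → bs ≢ as → ker bs as ≡ 0ℤ
ker-≢ desc-nil desc-nil ne = ⊥-elim (ne refl)
ker-≢ {bs = b ∷ bs} {a ∷ as} (desc-cons lb db) (desc-cons la da) ne with ℕₚ.<-cmp a b
... | tri< a<b _ _ = wedge-above b (ker bs) (a ∷ as) (a<b ∷ VecAll.map (λ lt → ℕₚ.<-trans lt a<b) la)
... | tri> _ _ b<a = ker-above (b<a ∷ VecAll.map (λ lt → ℕₚ.<-trans lt b<a) lb) as
... | tri≈ _ refl _ = trans (ker-head b bs as lb) (ker-≢ db da (λ e → ne (cong (b ∷_) e)))

beads-below : ∀ {p} n xs → Part p xs → Allᵥ (_< p + n) (beads n xs)
beads-below zero    xs pt = []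
beads-below (suc n) [] pt = ℕₚ.<-≤-trans (ℕₚ.n<1+n n) (ℕₚ.m≤n+m _ _)
  ∷ VecAll.map (λ lt → ℕₚ.<-≤-trans lt (ℕₚ.≤-trans (ℕₚ.n≤1+n n) (ℕₚ.m≤n+m _ _))) (beads-below {0} n [] part-nil)
beads-below {p} (suc n) (x ∷ xs) (part-cons 0<x x≤p pt) = bound
  ∷ VecAll.map (λ lt → ℕₚ.<-trans lt bound) (beads-below n xs pt)
  where
  bound : x + n < p + suc n
  bound = ℕₚ.+-mono-≤-< x≤p (ℕₚ.n<1+n n)

beads-desc : ∀ {p} n {xs} → Part p xs → Desc (beads n xs)
beads-desc zero                     pt               = desc-nil
beads-desc (suc n) {[]}     pt               = desc-cons (beads-below {0} n [] part-nil) (beads-desc n {[]} (part-nil {0}))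
beads-desc (suc n) {x ∷ xs} (part-cons _ _ pt) = desc-cons (beads-below n xs pt) (beads-desc n pt)

beads-injective : ∀ n {p q xs ys} → Part p xs → Part q ys → length xs ≤ n → length ys ≤ n →
                  beads n xs ≡ beads n ys → xs ≡ ys
beads-injective n part-nil part-nil _ _ e = refl
beads-injective (suc n) part-nil (part-cons {x = suc y} _ _ _) _ _ e =
  ⊥-elim (ℕₚ.<⇒≢ (s≤s (ℕₚ.m≤n+m n y)) (cong Data.Vec.head e))
beads-injective (suc n) (part-cons {x = suc x} _ _ _) part-nil _ _ e =
  ⊥-elim (ℕₚ.<⇒≢ (s≤s (ℕₚ.m≤n+m n x)) (sym (cong Data.Vec.head e)))
beads-injective (suc n) (part-cons _ _ p) (part-cons _ _ q) (s≤s l) (s≤s l′) e =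
  cong₂ _∷_ (ℕₚ.+-cancelʳ-≡ n _ _ (cong Data.Vec.head e)) (beads-injective n p q l l′ (cong Data.Vec.tail e))

opaque
  unfolding _*ᶻ_
  ∣ᶻ⇒∣ : ∀ e m → pow2 e ∣ᶻ (+ m) → 2 ^ e ∣ m
  ∣ᶻ⇒∣ e m (z , eq) = divides ℤ.∣ z ∣ (trans (cong ℤ.∣_∣ (trans eq (cong (z *ᶻ_) (sym (pow2-pos e))))) (ℤₚ.abs-* z (+ (2 ^ e))))

pos-sum : ∀ {A : Set} (f : A → ℕ) xs → + sum (map f xs) ≡ Σl (λ x → + f x) xs
pos-sum f []       = refl
pos-sum f (x ∷ xs) = trans (pos-+ (f x) _) (cong ((+ f x) +ᶻ_) (pos-sum f xs))

theorem1p2 : (n : ℕ) → 1 ≤ n → (v w : Fin n → Fin 2) →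
    (partitions : List (List ℕ)) → Unique partitions →
    (∀ μ → μ ∈ partitions ⇔ IsPartition n μ) →
    2 ^ (n ∸ a n) ∣ sum (map (λ μ → C₂ v μ * C₂ w μ) partitions)
theorem1p2 n _ v w ps unique isAll = ∣ᶻ⇒∣ (n ∸ a n) _ (subst (pow2 (n ∸ a n) ∣ᶻ_) (sym total)
  (pairing-divisible (n ∸ a n) n {φ = word v} {ψ = word w} 2n≤N
    (λ is e → subst (λ m → 2 ^ (m ∸ a m) ∣ norm is) e (norm-divisible is))
    (L-word n v n≤N) (L-word n w n≤N)))
  where
  open Partitions ps unique isAll
  -- The oddness makes bead parity the residue, and 2n beads give the room that pairing two vectors
  -- of degree n requires.
  N : ℕ
  N = suc (dbl n)
  2n≤N : n + n ≤ N
  2n≤N = ℕₚ.≤-trans (ℕₚ.≤-reflexive (sym (dbl≡+ n))) (ℕₚ.n≤1+n _)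
  n≤dbl : n ≤ dbl n
  n≤dbl = ℕₚ.≤-trans (ℕₚ.m≤m+n n n) (ℕₚ.≤-reflexive (sym (dbl≡+ n)))
  n≤N : n ≤ N
  n≤N = ℕₚ.≤-trans n≤dbl (ℕₚ.n≤1+n _)
  short : ∀ {μ} → IsPartition n μ → length μ ≤ N
  short isP = ℕₚ.≤-trans (part-length (IsPartition⇒Part isP)) (ℕₚ.≤-trans (ℕₚ.≤-reflexive (proj₁ isP)) n≤N)
  -- Orthonormality extracts the coefficient of μ from the word of `w`, so one of the two counts
  -- becomes a test function for the other word.
  coefficient : ∀ μ → IsPartition n μ → + C₂ w μ ≡ app (word w) (λ bs → ker bs (beads N μ))
  coefficient μ isP = trans (sym (trans
      (Σl-single (λ ν → (+ C₂ w ν) *ᶻ ker (beads N ν) (beads N μ)) unique (Equivalence.from (isAll μ) isP)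
        (λ ν ν∈ ne → trans (cong ((+ C₂ w ν) *ᶻ_) (off-diagonal ν (Equivalence.to (isAll ν) ν∈) ne)) (*ᶻ-zeroʳ _)))
      (trans (cong ((+ C₂ w μ) *ᶻ_) (ker-≡ (beads-desc N (IsPartition⇒Part isP)))) (sym (*ᶻ-identityʳ _)))))
    (trans (Σ-C₂ w (λ ν → ker (beads N ν) (beads N μ)))
           (growth-sum n w n≤dbl (λ bs → ker bs (beads N μ)) (ker-alt′ (beads N μ))))
    where
    off-diagonal : ∀ ν → IsPartition n ν → μ ≢ ν → ker (beads N ν) (beads N μ) ≡ 0ℤ
    off-diagonal ν isQ ne = ker-≢ (beads-desc N (IsPartition⇒Part isQ)) (beads-desc N (IsPartition⇒Part isP))
      (λ e → ne (sym (beads-injective N (IsPartition⇒Part isQ) (IsPartition⇒Part isP) (short isQ) (short isP) e)))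
  total : + sum (map (λ μ → C₂ v μ * C₂ w μ) ps) ≡ app (word v) (λ as → app (word w) (λ bs → ker bs as))
  total = trans (pos-sum _ ps)
    (trans (Σl-cong ps (λ μ μ∈ → trans (pos-* (C₂ v μ) (C₂ w μ))
             (cong ((+ C₂ v μ) *ᶻ_) (coefficient μ (Equivalence.to (isAll μ) μ∈)))))
    (trans (Σ-C₂ v (λ μ → app (word w) (λ bs → ker bs (beads N μ))))
           (growth-sum n v n≤dbl (λ as → app (word w) (λ bs → ker bs as)) (app-alt (word w) ker-alt))))
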